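{- Let $n\ge 1$ and let $c$ be a positive integer. Let $k_1\ge k_2\ge\cdots\ge k_n\ge 0$ be integers and put $k_{n+1}=0$. Let $a,b_1,\dots,b_n$ be nonnegative integers, put $a_1=a$, $a_2=\cdots=a_n=0$, and $\sigma_s=b_1+\cdots+b_s$ for $s=1,\dots,n$. For $s=1,\dots,n$ let $z^{(s)}=(z^{(s)}_1,\dots,z^{(s)}_{k_s})$ be variables and $z=(z^{(1)},\dots,z^{(n)})$. If $a+\sigma_s+s\ge sc$ for every $s=1,\dots,n$, then \[ \mathrm{CT}_{z}\prod_{s=1}^{n}\frac{\prod_{i=1}^{k_s}(1/z_i^{(s)})_{a_s}(qz_i^{(s)})_{b_s}\prod_{1\le i<j\le k_s}(z_i^{(s)}/z_j^{(s)})_c(qz_j^{(s)}/z_i^{(s)})_c}{\prod_{i=1}^{k_s}(z_i^{(s)})^{b_s+1-c}\prod_{j=1}^{k_{s+1}}\prod_{i=1}^{k_s}(q^{b_s+1-c}z_i^{(s)}/z_j^{(s+1)})_c} =(-1)^{\sum_{s=1}^nk_s(b_s+1-c)}q^{\sum_{s=1}^nk_s\binom{b_s+2-c}{2}}\prod_{s=1}^nM_{k_s}\big(a+\sigma_s+s(1-c),c-1,c\big). \]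
   Context: $q$ is an indeterminate. For an integer $m\ge 0$, $(y)_m=(y;q)_m=(1-y)(1-yq)\cdots(1-yq^{m-1})$, with $(y)_0=1$. $\mathrm{CT}_{z}$ denotes the constant term (coefficient of total exponent zero) with respect to all the listed variables. Each inverse factor $(1-d\,z_i^{(s)}/z_j^{(s+1)})^{ -1}$ with $d\in\mathbb{Q}(q)$ is expanded as the geometric series $\sum_{m\ge0}(d\,z_i^{(s)}/z_j^{(s+1)})^m$. For integers $k\ge 0$ and $A,B\ge0$, $c\ge 1$, \[M_k(A,B,c)=\prod_{i=0}^{k-1}\frac{(q)_{A+B+ic}(q)_{(i+1)c}}{(q)_{A+ic}(q)_{B+ic}(q)_c}.\] For any integer $m$, $\binom{m}{2}=m(m-1)/2$. -}

module Defs where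

open import Data.Nat as ℕ using (ℕ; zero; suc; _≤_; _<_; _∸_; _≤?_)
open import Data.Nat.DivMod using (_/_)
open import Data.Integer as ℤ using (ℤ; +_; ∣_∣; -[1+_]; 0ℤ; 1ℤ; -1ℤ)
open import Data.Fin using (Fin; toℕ)
open import Data.Vec using (Vec; tabulate; zipWith; replicate; _∷_; [])
open import Data.Vec.Properties using (≡-dec)
open import Data.List as L using (List; []; _∷_; _++_; map; concatMap; foldr; filter; upTo)
open import Data.Nat.ListAction renaming (sum to sumℕ)
open import Data.Product using (_×_; _,_; proj₁; proj₂)
open import Data.Bool using (if_then_else_)
open import Relation.Nullary.Decidable using (does)
open import Relation.Binary.PropositionalEquality using (_≡_)

private variable N : ℕ

-- Laurent polynomials with integer coefficients in N variables, stored
-- as finite lists of terms (coefficient , exponent vector).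
-- Variable 0 is q; variables 1 .. N-1 are the z-variables.

Term : ℕ → Set
Term N = ℤ × Vec ℤ N

Poly : ℕ → Set
Poly N = List (Term N)

_+v_ : Vec ℤ N → Vec ℤ N → Vec ℤ N
_+v_ = zipWith ℤ._+_

zeroV : Vec ℤ N
zeroV = replicate _ 0ℤ

unit : (N j : ℕ) → ℤ → Vec ℤ N
unit N j e = tabulate (λ x → if does (toℕ x ℕ.≟ j) then e else 0ℤ)

mono : ℤ → Vec ℤ N → Poly N
mono c v = (c , v) ∷ []

oneP : Poly N
oneP = mono 1ℤ zeroV

_⊕_ : Poly N → Poly N → Poly N
_⊕_ = _++_

negP : Poly N → Poly N
negP = map (λ t → (ℤ.- proj₁ t , proj₂ t))

_⊗_ : Poly N → Poly N → Poly N
p ⊗ r = concatMap (λ t → map (λ u → (proj₁ t ℤ.* proj₁ u , proj₂ t +v proj₂ u)) r) p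

sumP : List (Poly N) → Poly N
sumP = foldr _⊕_ []

prodP : List (Poly N) → Poly N
prodP = foldr _⊗_ oneP

powP : Poly N → ℕ → Poly N
powP p zero = oneP
powP p (suc m) = p ⊗ powP p m

coeff : Poly N → Vec ℤ N → ℤ
coeff p v = foldr ℤ._+_ 0ℤ (map proj₁ (filter (λ t → ≡-dec ℤ._≟_ (proj₂ t) v) p))

_≈_ : Poly N → Poly N → Set
p ≈ r = ∀ v → coeff p v ≡ coeff r v

ctZ : Poly (suc N) → Poly (suc N)
ctZ = filter (λ t → ≡-dec ℤ._≟_ (Data.Vec.tail (proj₂ t)) zeroV)
  where import Data.Vec

Frac : ℕ → Set
Frac N = Poly N × Poly N

poly : Poly N → Frac N
poly p = (p , oneP)

_⊗F_ : Frac N → Frac N → Frac N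
(p , p') ⊗F (r , r') = (p ⊗ r , p' ⊗ r')

prodF : List (Frac N) → Frac N
prodF = foldr _⊗F_ (oneP , oneP)

_≈F_ : Frac N → Frac N → Set
(p , p') ≈F (r , r') = (p ⊗ r') ≈ (r ⊗ p')

-- monomial q^d z^v  (v the z-exponents; its q-entry is 0)
qmon : ℤ → Vec ℤ N → Poly N
qmon {N} d v = mono 1ℤ (unit N 0 d +v v)

poch : ℤ → Vec ℤ N → ℕ → Poly N
poch d v m = prodP (map (λ l → oneP ⊕ negP (qmon (d ℤ.+ + l) v)) (upTo m))

qPoch : ℕ → Poly N
qPoch m = poch 1ℤ zeroV m

geom : ℕ → ℤ → Vec ℤ N → Poly N
geom T d v = sumP (map (powP (qmon d v)) (upTo (suc T)))

-- 1/(q^d z^v ; q)_c = ∏_{l<c} (1 - q^(d+l) z^v)^{-1}, each factor expanded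
-- geometrically and truncated at degree T
pochInv : ℕ → ℤ → Vec ℤ N → ℕ → Poly N
pochInv T d v c = prodP (map (λ l → geom T (d ℤ.+ + l) v) (upTo c))

MF : ℕ → ℕ → ℕ → ℕ → Frac N
MF k A B c = prodF (map (λ i →
   (qPoch (A ℕ.+ B ℕ.+ i ℕ.* c) ⊗ qPoch (suc i ℕ.* c)) ,
   (qPoch (A ℕ.+ i ℕ.* c) ⊗ (qPoch (B ℕ.+ i ℕ.* c) ⊗ qPoch c))) (upTo k))

-- binom(m,2) = m(m-1)/2 for an integer m (always a natural number)
binom2 : ℤ → ℕ
binom2 m = ∣ m ℤ.* (m ℤ.- 1ℤ) ∣ / 2

-- The data of Theorem 1.2.  Indices s, i, j are 1-based.

ints1 : ℕ → List ℕ
ints1 m = map suc (upTo m)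

off : (ℕ → ℕ) → ℕ → ℕ
off k s = sumℕ (map k (ints1 (s ∸ 1)))

-- number of variables: q plus all z^{(s)}_i, s = 1..n
dim : ℕ → (ℕ → ℕ) → ℕ
dim n k = suc (off k (suc n))

kext : ℕ → (ℕ → ℕ) → ℕ → ℕ
kext n k s = if does (s ≤? n) then k s else 0

σ : (ℕ → ℕ) → ℕ → ℕ
σ b s = sumℕ (map b (ints1 s))

aa : ℕ → ℕ → ℕ
aa a s = if does (s ℕ.≟ 1) then a else 0

-- exponent vector of (z^{(s)}_i)^e
zv : (n : ℕ) (k : ℕ → ℕ) → ℕ → ℕ → ℤ → Vec ℤ (dim n k)
zv n k s i e = unit (dim n k) (off k s ℕ.+ i) e

ex : (ℕ → ℕ) → ℕ → ℕ → ℤ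
ex b c s = + b s ℤ.+ 1ℤ ℤ.- + c

factor : (n c : ℕ) (k : ℕ → ℕ) (a : ℕ) (b : ℕ → ℕ) (T s : ℕ) → Poly (dim n k)
factor n c k a b T s =
  prodP (map (λ i → poch 0ℤ (z i -1ℤ) (aa a s) ⊗ poch 1ℤ (z i 1ℤ) (b s)) (ints1 (k s)))
  ⊗ (prodP (concatMap (λ j → map (λ i →
        poch 0ℤ (z i 1ℤ +v z j -1ℤ) c ⊗ poch 1ℤ (z j 1ℤ +v z i -1ℤ) c)
        (ints1 (j ∸ 1))) (ints1 (k s)))
  ⊗ (prodP (map (λ i → mono 1ℤ (z i (ℤ.- e))) (ints1 (k s)))
  ⊗ prodP (concatMap (λ j → map (λ i →
        pochInv T e (z i 1ℤ +v zv n k (suc s) j -1ℤ) c)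
        (ints1 (k s))) (ints1 (kext n k (suc s))))))
  where
  z = zv n k s
  e = ex b c s

lhs : (n c : ℕ) (k : ℕ → ℕ) (a : ℕ) (b : ℕ → ℕ) (T : ℕ) → Poly (dim n k)
lhs n c k a b T = prodP (map (factor n c k a b T) (ints1 n))

rhs : (n c : ℕ) (k : ℕ → ℕ) (a : ℕ) (b : ℕ → ℕ) → Frac (dim n k)
rhs n c k a b =
  poly (mono ((-1ℤ) ℤ.^ ∣ E ∣) (unit (dim n k) 0 (+ Q)))
  ⊗F prodF (map (λ s → MF (k s) (a ℕ.+ σ b s ℕ.+ s ∸ s ℕ.* c) (c ∸ 1) c) (ints1 n))
  where
  E = L.foldr ℤ._+_ 0ℤ (map (λ s → + k s ℤ.* ex b c s) (ints1 n))
  Q = sumℕ (map (λ s → k s ℕ.* binom2 (+ b s ℤ.+ + 2 ℤ.- + c)) (ints1 n))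

{-# OPTIONS --safe #-}

-- Specialise q to 2^(u+1) and every variable to an integral power of q, so that points are integer
-- vectors, and eliminate the levels in turn. With e = b_s + 1 - c and z^(s)_i = q^(-e) u_i, the
-- constant term over z^(s) is, up to the factor ((-1)^e q^binom(e+1,2))^k, that of
--   f(u) ∏_{i,j} 1/(u_i y_j)_c,   y_j = 1/z^(s+1)_j,
--   f(u) = ∏_i (1/u_i)_A (q u_i)_{c-1} ∏_{i<j} (u_i/u_j)_c (q u_j/u_i)_c,
-- and it equals M_k(A,c-1,c) ∏_j (y_j)_A, which is absorbed into the next level.
-- For k parameters y_j, the degree of f in each u_i is less than kc, so Lagrange interpolation at the
-- kc poles u = 1/(y_j q^l) gives the constant term as a weighted sum of f over tuples of poles. If the
-- y_j are far apart and one of them is q^(-l) with l < A, then f vanishes at every tuple. Hence, on a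
-- line t y, the constant term is a polynomial in t of degree kA all of whose roots are known, that is,
-- its value at t = 0 times ∏_j (t y_j)_A. Other parameters are reached by deforming them along powers
-- of q^x, and fewer parameters by letting some of them tend to 0. The value at t = 0 is found at
-- y_j = q^(-A-jc), where f vanishes at all tuples of poles but u_i = q^(A+ic).

module Submission where

open import Data.Nat as ℕ using (ℕ; zero; suc)
import Data.Nat.Properties as ℕ
open import Data.Integer as ℤ using (ℤ; +_; -[1+_]; 0ℤ; 1ℤ)
import Data.Integer.Properties as ℤ
import Data.Rational as ℚ₀
open import Data.Rational using (ℚ; 0ℚ; 1ℚ; ≢-nonZero; 1/_)
open import Data.Rational.Properties as ℚ using (+-*-commutativeRing)
open import Relation.Binary.PropositionalEquality
open import Tactic.RingSolver.Core.AlmostCommutativeRing using (AlmostCommutativeRing; fromCommutativeRing)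
open import Tactic.RingSolver using (solve-∀)
import Data.Integer.Tactic.RingSolver as ℤR
open import Relation.Nullary
open import Relation.Nullary.Decidable using (dec⇒maybe)
open import Level using (0ℓ)
open import Data.List using (List; _∷_; []; _++_; map; concatMap; applyUpTo; upTo; length)
open import Data.Vec as Vec using (Vec; _∷_; [])
open import Data.List.Relation.Unary.All as All using (All; _∷_; [])
open import Data.List.Relation.Unary.AllPairs as AllPairs using (AllPairs; _∷_; [])
open import Data.Product using (Σ; _×_; _,_; proj₁; proj₂)
open import Data.Sum using (_⊎_; inj₁; inj₂)
open import Data.Empty using (⊥; ⊥-elim)
open import Data.Unit using (⊤; tt)
open import Function using (_∘_; id; case_of_)
open import Data.Fin as Fin using (Fin; toℕ)
import Data.Fin.Properties as Fin

-- A constant term is treated as a relation: `HasCT` links a function on integer points to a number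
-- through an explicit expansion in characters, and the number is unique because `q` is not a root
-- of unity. Identities come from reaching the constant term of one function in two ways, for
-- instance by eliminating a deformation parameter first or last. The degree `k A` comes from a
-- grading. On the line `t y` each power of `t` is accompanied by the same power of the `u_i`, the
-- pair products are homogeneous of degree 0, and only the factors `(1/u_i)_A` lower the degree in
-- `u`, by at most `k A`; a term free of `u` therefore contains at most `t^(k A)`. The length
-- `c - 1` of `(q u_i)_{c-1}` makes the interpolation exact: the top degree in one variable is
-- `(c - 1) + (k - 1) c = k c - 1`. The poles of the parameters `q^(-A-jc)` fill an interval, which
-- turns the Lagrange weights into q-factorials. In general these parameters are too close for the
-- vanishing argument, which asks for gaps of `A + c`; so the product formula has to reach arbitrary
-- parameters before its constant can be found.

module Preliminaries where

  open ℚ₀ using (_+_; _*_; _-_; -_)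

  ℚring : AlmostCommutativeRing 0ℓ 0ℓ
  ℚring = fromCommutativeRing +-*-commutativeRing λ x → dec⇒maybe (0ℚ ℚ.≟ x)

  inverse : ∀ p → p ≢ 0ℚ → Σ ℚ λ r → r * p ≡ 1ℚ
  inverse p p≢0 = (1/ p) , ℚ.*-inverseˡ p
    where instance _ = ≢-nonZero p≢0

  cancelˡ : ∀ p {a b} → p ≢ 0ℚ → p * a ≡ p * b → a ≡ b
  cancelˡ p {a} {b} p≢0 eq with inverse p p≢0
  ... | r , rp = begin
    a              ≡⟨ ℚ.*-identityˡ a ⟨
    1ℚ * a         ≡⟨ cong (_* a) rp ⟨
    r * p * a      ≡⟨ ℚ.*-assoc r p a ⟩
    r * (p * a)    ≡⟨ cong (r *_) eq ⟩
    r * (p * b)    ≡⟨ ℚ.*-assoc r p b ⟨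
    r * p * b      ≡⟨ cong (_* b) rp ⟩
    1ℚ * b         ≡⟨ ℚ.*-identityˡ b ⟩
    b              ∎
    where open ≡-Reasoning

  *-≢0 : ∀ {p r} → p ≢ 0ℚ → r ≢ 0ℚ → p * r ≢ 0ℚ
  *-≢0 {p} p≢0 r≢0 eq = r≢0 (cancelˡ p p≢0 (trans eq (sym (ℚ.*-zeroʳ p))))

  1≢0 : 1ℚ ≢ 0ℚ
  1≢0 ()

  *-zeroˡ-≡ : ∀ {a b} → a ≡ 0ℚ → a * b ≡ 0ℚ
  *-zeroˡ-≡ {b = b} refl = ℚ.*-zeroˡ b

  *-zeroʳ-≡ : ∀ {a b} → b ≡ 0ℚ → a * b ≡ 0ℚ
  *-zeroʳ-≡ {a} refl = ℚ.*-zeroʳ a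

  a-b≡0⇒a≡b : ∀ {a b} → a - b ≡ 0ℚ → a ≡ b
  a-b≡0⇒a≡b {a} {b} eq = begin
    a           ≡⟨ lem a b ⟩
    a - b + b   ≡⟨ cong (_+ b) eq ⟩
    0ℚ + b      ≡⟨ ℚ.+-identityˡ b ⟩
    b           ∎
    where
    open ≡-Reasoning
    lem : ∀ a b → a ≡ a - b + b
    lem = solve-∀ ℚring

  a≡b⇒a-b≡0 : ∀ {a b} → a ≡ b → a - b ≡ 0ℚ
  a≡b⇒a-b≡0 {a} refl = ℚ.+-inverseʳ a

  i≤∣i∣ : ∀ i → i ℤ.≤ + ℤ.∣ i ∣
  i≤∣i∣ (+ n)    = ℤ.≤-refl
  i≤∣i∣ -[1+ n ] = ℤ.-≤+

  -- Finite products, geometric sums and the character `q^a`.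

  ∏< : ℕ → (ℕ → ℚ) → ℚ
  ∏< zero    f = 1ℚ
  ∏< (suc n) f = f 0 * ∏< n (f ∘ suc)

  ∏ : {A : Set} → (A → ℚ) → List A → ℚ
  ∏ f []       = 1ℚ
  ∏ f (x ∷ xs) = f x * ∏ f xs

  ∏<-cong : ∀ n {f g : ℕ → ℚ} → (∀ i → i ℕ.< n → f i ≡ g i) → ∏< n f ≡ ∏< n g
  ∏<-cong zero    eq = refl
  ∏<-cong (suc n) eq = cong₂ _*_ (eq 0 (ℕ.s≤s ℕ.z≤n)) (∏<-cong n (λ i i<n → eq (suc i) (ℕ.s≤s i<n)))

  interchange : ∀ a b c d → (a * b) * (c * d) ≡ (a * c) * (b * d)
  interchange = solve-∀ ℚring

  ∏<-* : ∀ n (f g : ℕ → ℚ) → ∏< n (λ i → f i * g i) ≡ ∏< n f * ∏< n g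
  ∏<-* zero    f g = refl
  ∏<-* (suc n) f g =
    trans (cong (f 0 * g 0 *_) (∏<-* n (f ∘ suc) (g ∘ suc)))
          (interchange (f 0) (g 0) (∏< n (f ∘ suc)) (∏< n (g ∘ suc)))

  ∏<-1 : ∀ n → ∏< n (λ _ → 1ℚ) ≡ 1ℚ
  ∏<-1 zero    = refl
  ∏<-1 (suc n) = trans (ℚ.*-identityˡ _) (∏<-1 n)

  ∏<-+ : ∀ m n (f : ℕ → ℚ) → ∏< (m ℕ.+ n) f ≡ ∏< m f * ∏< n (λ i → f (m ℕ.+ i))
  ∏<-+ zero    n f = sym (ℚ.*-identityˡ _)
  ∏<-+ (suc m) n f = trans (cong (f 0 *_) (∏<-+ m n (f ∘ suc))) (sym (ℚ.*-assoc (f 0) _ _))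

  ∏<-zero : ∀ n {f : ℕ → ℚ} i → i ℕ.< n → f i ≡ 0ℚ → ∏< n f ≡ 0ℚ
  ∏<-zero (suc n) {f} zero    _           eq = *-zeroˡ-≡ eq
  ∏<-zero (suc n) {f} (suc i) (ℕ.s≤s i<n) eq = *-zeroʳ-≡ {f 0} (∏<-zero n {f ∘ suc} i i<n eq)

  ∏<-≢0 : ∀ n {f : ℕ → ℚ} → (∀ i → i ℕ.< n → f i ≢ 0ℚ) → ∏< n f ≢ 0ℚ
  ∏<-≢0 zero    _   = 1≢0
  ∏<-≢0 (suc n) nz = *-≢0 (nz 0 (ℕ.s≤s ℕ.z≤n)) (∏<-≢0 n (λ i i<n → nz (suc i) (ℕ.s≤s i<n)))

  ∏<-swap : ∀ m n (f : ℕ → ℕ → ℚ) → ∏< m (λ i → ∏< n (f i)) ≡ ∏< n (λ j → ∏< m (λ i → f i j))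
  ∏<-swap zero    n f = sym (∏<-1 n)
  ∏<-swap (suc m) n f =
    trans (cong (∏< n (f 0) *_) (∏<-swap m n (f ∘ suc))) (sym (∏<-* n (f 0) _))

  ∏<-snoc : ∀ n (f : ℕ → ℚ) → ∏< (suc n) f ≡ ∏< n f * f n
  ∏<-snoc zero    f = ℚ.*-comm (f 0) 1ℚ
  ∏<-snoc (suc n) f = trans (cong (f 0 *_) (∏<-snoc n (f ∘ suc))) (sym (ℚ.*-assoc (f 0) _ _))

  ∏-++ : {A : Set} (f : A → ℚ) (xs ys : List A) → ∏ f (xs ++ ys) ≡ ∏ f xs * ∏ f ys
  ∏-++ f []       ys = sym (ℚ.*-identityˡ _)
  ∏-++ f (x ∷ xs) ys = trans (cong (f x *_) (∏-++ f xs ys)) (sym (ℚ.*-assoc (f x) _ _))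

  ∏-map : {A B : Set} (f : B → ℚ) (g : A → B) (xs : List A) → ∏ f (map g xs) ≡ ∏ (f ∘ g) xs
  ∏-map f g []       = refl
  ∏-map f g (x ∷ xs) = cong (f (g x) *_) (∏-map f g xs)

  ∏-concatMap : {A B : Set} (f : B → ℚ) (g : A → List B) (xs : List A) →
                ∏ f (concatMap g xs) ≡ ∏ (λ x → ∏ f (g x)) xs
  ∏-concatMap f g []       = refl
  ∏-concatMap f g (x ∷ xs) = trans (∏-++ f (g x) _) (cong (∏ f (g x) *_) (∏-concatMap f g xs))

  ∏-cong : {A : Set} {f g : A → ℚ} → (∀ x → f x ≡ g x) → ∀ xs → ∏ f xs ≡ ∏ g xs
  ∏-cong eq []       = refl
  ∏-cong eq (x ∷ xs) = cong₂ _*_ (eq x) (∏-cong eq xs)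

  ∏-* : {A : Set} (f g : A → ℚ) (xs : List A) → ∏ (λ x → f x * g x) xs ≡ ∏ f xs * ∏ g xs
  ∏-* f g []       = refl
  ∏-* f g (x ∷ xs) = trans (cong (f x * g x *_) (∏-* f g xs)) (interchange (f x) (g x) _ _)

  ∏-applyUpTo : {A : Set} (f : A → ℚ) (g : ℕ → A) (n : ℕ) → ∏ f (applyUpTo g n) ≡ ∏< n (f ∘ g)
  ∏-applyUpTo f g zero    = refl
  ∏-applyUpTo f g (suc n) = cong (f (g 0) *_) (∏-applyUpTo f (g ∘ suc) n)

  geo : ℕ → ℚ → ℚ
  geo zero    x = 1ℚ
  geo (suc T) x = 1ℚ + x * geo T x

  pow : ℚ → ℕ → ℚ
  pow x zero    = 1ℚ
  pow x (suc n) = x * pow x n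

  geo-sum : ∀ T x → (1ℚ - x) * geo T x ≡ 1ℚ - pow x (suc T)
  geo-sum zero    x = lem x
    where
    lem : ∀ x → (1ℚ - x) * 1ℚ ≡ 1ℚ - x * 1ℚ
    lem = solve-∀ ℚring
  geo-sum (suc T) x = trans (lem₁ x (geo T x)) (trans (cong (λ z → 1ℚ - x + x * z) (geo-sum T x)) (lem₂ x (pow x (suc T))))
    where
    lem₁ : ∀ x g → (1ℚ - x) * (1ℚ + x * g) ≡ 1ℚ - x + x * ((1ℚ - x) * g)
    lem₁ = solve-∀ ℚring
    lem₂ : ∀ x p → 1ℚ - x + x * (1ℚ - p) ≡ 1ℚ - x * p
    lem₂ = solve-∀ ℚring

  -- The character a ↦ q ^ a, for a number q that is not a root of unity.
  record Character : Set where
    field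
      qp    : ℤ → ℚ
      qp-+  : ∀ a b → qp (a ℤ.+ b) ≡ qp a * qp b
      qp-0  : qp 0ℤ ≡ 1ℚ
      qp≢1  : ∀ a → a ≢ 0ℤ → qp a ≢ 1ℚ

    qp-inv : ∀ a → qp a * qp (ℤ.- a) ≡ 1ℚ
    qp-inv a = trans (sym (qp-+ a (ℤ.- a))) (trans (cong qp (ℤ.+-inverseʳ a)) qp-0)

    qp≢0 : ∀ a → qp a ≢ 0ℚ
    qp≢0 a eq = 1≢0 (trans (sym (qp-inv a)) (*-zeroˡ-≡ eq))

    θ : ℤ → ℚ
    θ a = 1ℚ - qp a

    θ≢0 : ∀ a → a ≢ 0ℤ → θ a ≢ 0ℚ
    θ≢0 a a≢0 eq = qp≢1 a a≢0 (sym (a-b≡0⇒a≡b eq))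

    θ-0 : θ 0ℤ ≡ 0ℚ
    θ-0 = a≡b⇒a-b≡0 (sym qp-0)

    pow-qp : ∀ a n → pow (qp a) n ≡ qp (+ n ℤ.* a)
    pow-qp a zero    = sym qp-0
    pow-qp a (suc n) = trans (cong (qp a *_) (pow-qp a n))
      (trans (sym (qp-+ a (+ n ℤ.* a))) (cong qp (lem a n)))
      where
      lem : ∀ a n → a ℤ.+ + n ℤ.* a ≡ + suc n ℤ.* a
      lem a n = sym (ℤ.suc-* (+ n) a)

    qpoch : ℤ → ℕ → ℚ
    qpoch a m = ∏< m (λ l → θ (a ℤ.+ + l))

open Preliminaries

-- Linear combinations of characters with restricted exponents.

module Spans where

  open ℚ₀ using (_+_; _*_; _-_; -_)

  module _ {I X : Set} (χ : I → X → ℚ) where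

    -- An expansion may repeat indices, so sums and products need no normal form. The predicate `P`
    -- on exponents serves for degree bounds and for the absence of a constant term alike.
    data Span (P : I → Set) : (X → ℚ) → Set where
      nil  : ∀ {φ} → (∀ x → φ x ≡ 0ℚ) → Span P φ
      term : ∀ {φ ψ} (α : ℚ) (i : I) → P i → Span P ψ → (∀ x → φ x ≡ α * χ i x + ψ x) → Span P φ

  module _ {I X : Set} {χ : I → X → ℚ} where

    span-ext : ∀ {P φ ψ} → (∀ x → φ x ≡ ψ x) → Span χ P ψ → Span χ P φ
    span-ext eq (nil z)          = nil λ x → trans (eq x) (z x)
    span-ext eq (term α i p s e) = term α i p s λ x → trans (eq x) (e x)

    span-mono : ∀ {P Q : I → Set} {φ} → (∀ i → P i → Q i) → Span χ P φ → Span χ Q φ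
    span-mono f (nil z)          = nil z
    span-mono f (term α i p s e) = term α i (f i p) (span-mono f s) e

    span-+ : ∀ {P φ ψ} → Span χ P φ → Span χ P ψ → Span χ P (λ x → φ x + ψ x)
    span-+ {ψ = ψ} (nil z) t = span-ext (λ x → trans (cong (_+ ψ x) (z x)) (ℚ.+-identityˡ (ψ x))) t
    span-+ {ψ = ψ} (term {ψ = φ′} α i p s e) t =
      term α i p (span-+ s t) λ x → trans (cong (_+ ψ x) (e x)) (ℚ.+-assoc (α * χ i x) (φ′ x) (ψ x))

    span-scale : ∀ {P φ} β → Span χ P φ → Span χ P (λ x → β * φ x)
    span-scale β (nil z)                    = nil λ x → *-zeroʳ-≡ {β} (z x)
    span-scale β (term {ψ = ψ} α i p s e) =
      term (β * α) i p (span-scale β s) λ x → trans (cong (β *_) (e x)) (lem β α (χ i x) (ψ x))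
      where
      lem : ∀ β α c p → β * (α * c + p) ≡ β * α * c + β * p
      lem = solve-∀ ℚring

    span-monomial : ∀ {P} α i → P i → Span χ P (λ x → α * χ i x)
    span-monomial α i p = term {ψ = λ _ → 0ℚ} α i p (nil λ _ → refl) λ x → sym (ℚ.+-identityʳ (α * χ i x))

    span-χ : ∀ {P} i → P i → Span χ P (χ i)
    span-χ i p = span-ext (λ x → sym (ℚ.*-identityˡ (χ i x))) (span-monomial 1ℚ i p)

    span-- : ∀ {P φ ψ} → Span χ P φ → Span χ P ψ → Span χ P (λ x → φ x - ψ x)
    span-- {φ = φ} {ψ} s t = span-ext (λ x → lem (φ x) (ψ x)) (span-+ s (span-scale (- 1ℚ) t))
      where
      lem : ∀ a b → a - b ≡ a + - 1ℚ * b
      lem = solve-∀ ℚring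

  module _ {I X : Set} {χ : I → X → ℚ} (_∙_ : I → I → I)
           (χ-∙ : ∀ i j x → χ (i ∙ j) x ≡ χ i x * χ j x) where

    span-* : ∀ {P Q R : I → Set} → (∀ i j → P i → Q j → R (i ∙ j)) →
             ∀ {φ ψ} → Span χ P φ → Span χ Q ψ → Span χ R (λ x → φ x * ψ x)
    span-* f {ψ = ψ} (nil z) t = nil λ x → *-zeroˡ-≡ (z x)
    span-* {P} {Q} {R} f {φ} {ψ} (term {ψ = φ′} α i p s e) t =
      span-ext (λ x → trans (cong (_* ψ x) (e x)) (lem α (χ i x) (φ′ x) (ψ x)))
        (span-+ (span-scale α (shift t)) (span-* f s t))
      where
      lem : ∀ α c p q → (α * c + p) * q ≡ α * (c * q) + p * q
      lem = solve-∀ ℚring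
      lem′ : ∀ α c d p → c * (α * d + p) ≡ α * (c * d) + c * p
      lem′ = solve-∀ ℚring
      shift : ∀ {ψ} → Span χ Q ψ → Span χ R (λ x → χ i x * ψ x)
      shift (nil z) = nil λ x → *-zeroʳ-≡ {χ i x} (z x)
      shift (term {ψ = ψ′} β j q t e) =
        term β (i ∙ j) (f i j p q) (shift t) λ x →
          trans (cong (χ i x *_) (e x))
            (trans (lem′ β (χ i x) (χ j x) (ψ′ x)) (cong (λ z → β * z + χ i x * ψ′ x) (sym (χ-∙ i j x))))

  span-pull : {I X I′ X′ : Set} {χ : I → X → ℚ} {χ′ : I′ → X′ → ℚ} {P : I → Set} {P′ : I′ → Set}
              (h : X′ → X) →
              (∀ i → P i → Σ ℚ λ β → Σ I′ λ j → P′ j × (∀ x → χ i (h x) ≡ β * χ′ j x)) →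
              ∀ {φ} → Span χ P φ → Span χ′ P′ (φ ∘ h)
  span-pull h m (nil z) = nil (z ∘ h)
  span-pull {χ = χ} {χ′} h m (term {ψ = ψ} α i p s e) with m i p
  ... | β , j , p′ , eq =
    term (α * β) j p′ (span-pull h m s) λ x →
      trans (e (h x)) (cong (_+ ψ (h x)) (trans (cong (α *_) (eq x)) (sym (ℚ.*-assoc α β (χ′ j x)))))

  module _ {I X : Set} {χ : I → X → ℚ} (_∙_ : I → I → I)
           (χ-∙ : ∀ i j x → χ (i ∙ j) x ≡ χ i x * χ j x) (ε : I) (χ-ε : ∀ x → χ ε x ≡ 1ℚ) where

    span-const : ∀ {P : I → Set} κ → P ε → Span χ P (λ _ → κ)
    span-const κ p = span-ext (λ x → trans (sym (ℚ.*-identityʳ κ)) (cong (κ *_) (sym (χ-ε x)))) (span-monomial κ ε p)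

    -- Horner's rule multiplies by `e` once per step, which is exactly the closure asked of `P`;
    -- `P n` stands for a bound on the exponents reached after `n` steps.
    span-geo : (P : ℕ → I → Set) (e : I) → (∀ n → P n ε) → (∀ n i → P n i → P (suc n) (e ∙ i)) →
               ∀ α n → Span χ (P n) (λ x → geo n (α * χ e x))
    span-geo P e p₀ p₊ α zero    = span-const 1ℚ (p₀ 0)
    span-geo P e p₀ p₊ α (suc n) = span-+ (span-const 1ℚ (p₀ (suc n)))
      (span-* _∙_ χ-∙ {P = _≡ e} {Q = P n} (λ { i j refl p → p₊ n j p }) (span-monomial α e refl) (span-geo P e p₀ p₊ α n))

open Spans

-- Exponent vectors and their pairing with points.

module Vectors where

  open ℚ₀ using (_+_; _*_; _-_; -_)

  δ : ℤ → ℚ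
  δ m with m ℤ.≟ 0ℤ
  ... | yes _ = 1ℚ
  ... | no  _ = 0ℚ

  dot : ∀ {k} → Vec ℤ k → Vec ℤ k → ℤ
  dot []      []      = 0ℤ
  dot (m ∷ v) (x ∷ y) = m ℤ.* x ℤ.+ dot v y

  zeros : ∀ {k} → Vec ℤ k
  zeros = Vec.replicate _ 0ℤ

  _⊞_ : ∀ {k} → Vec ℤ k → Vec ℤ k → Vec ℤ k
  _⊞_ = Vec.zipWith ℤ._+_

  dot-⊞ : ∀ {k} (v w x : Vec ℤ k) → dot (v ⊞ w) x ≡ dot v x ℤ.+ dot w x
  dot-⊞ []      []      []      = refl
  dot-⊞ (m ∷ v) (n ∷ w) (x ∷ y) = trans (cong (λ z → (m ℤ.+ n) ℤ.* x ℤ.+ z) (dot-⊞ v w y)) (lem m n x (dot v y) (dot w y))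
    where
    lem : ∀ m n x a b → (m ℤ.+ n) ℤ.* x ℤ.+ (a ℤ.+ b) ≡ (m ℤ.* x ℤ.+ a) ℤ.+ (n ℤ.* x ℤ.+ b)
    lem = ℤR.solve-∀

  dot-zeros : ∀ {k} (x : Vec ℤ k) → dot zeros x ≡ 0ℤ
  dot-zeros []      = refl
  dot-zeros (x ∷ y) = trans (cong (ℤ._+ dot zeros y) (ℤ.*-zeroˡ x)) (trans (ℤ.+-identityˡ _) (dot-zeros y))

  δᵥ : ∀ {k} → Vec ℤ k → ℚ
  δᵥ []      = 1ℚ
  δᵥ (m ∷ v) = δ m * δᵥ v

  zeros? : ∀ {k} (v : Vec ℤ k) → v ≡ zeros ⊎ δᵥ v ≡ 0ℚ
  zeros? [] = inj₁ refl
  zeros? (m ∷ v) with m ℤ.≟ 0ℤ | zeros? v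
  ... | yes refl | inj₁ refl = inj₁ refl
  ... | yes refl | inj₂ e    = inj₂ (*-zeroʳ-≡ {1ℚ} e)
  ... | no _     | _         = inj₂ (*-zeroˡ-≡ {0ℚ} {δᵥ v} refl)

  tabulate-zeros : ∀ k → Vec.tabulate {n = k} (λ _ → 0ℤ) ≡ zeros
  tabulate-zeros zero    = refl
  tabulate-zeros (suc k) = cong (0ℤ ∷_) (tabulate-zeros k)

  neg : ∀ {k} → Vec ℤ k → Vec ℤ k
  neg = Vec.map (ℤ.-_)

  dot-neg : ∀ {k} (v x : Vec ℤ k) → dot (neg v) x ≡ ℤ.- dot v x
  dot-neg []      []      = refl
  dot-neg (m ∷ v) (x ∷ y) = trans (cong (λ z → ℤ.- m ℤ.* x ℤ.+ z) (dot-neg v y)) (lem m x (dot v y))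
    where
    lem : ∀ m x d → ℤ.- m ℤ.* x ℤ.+ ℤ.- d ≡ ℤ.- (m ℤ.* x ℤ.+ d)
    lem = ℤR.solve-∀

open Vectors

-- Constant terms in one variable, and their uniqueness.

module ConstantTerm₁ (C : Character) where

  open ℚ₀ using (_+_; _*_; _-_; -_)
  open Character C

  χ₁ : ℤ → ℤ → ℚ
  χ₁ m x = qp (m ℤ.* x)

  χ₁-+ : ∀ i j x → χ₁ (i ℤ.+ j) x ≡ χ₁ i x * χ₁ j x
  χ₁-+ i j x = trans (cong qp (ℤ.*-distribʳ-+ x i j)) (qp-+ (i ℤ.* x) (j ℤ.* x))

  χ₁-0 : ∀ x → χ₁ 0ℤ x ≡ 1ℚ
  χ₁-0 x = trans (cong qp (ℤ.*-zeroˡ x)) qp-0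

  Laurent : (ℤ → ℚ) → Set
  Laurent = Span χ₁ (λ _ → ⊤)

  -- Δ m annihilates the character of exponent m.
  Δ : ℤ → (ℤ → ℚ) → (ℤ → ℚ)
  Δ m φ x = φ (x ℤ.+ 1ℤ) - qp m * φ x

  Δs : List ℤ → (ℤ → ℚ) → (ℤ → ℚ)
  Δs []       φ = φ
  Δs (m ∷ ms) φ = Δ m (Δs ms φ)

  Δs-cong : ∀ ms {φ ψ} → (∀ x → φ x ≡ ψ x) → ∀ x → Δs ms φ x ≡ Δs ms ψ x
  Δs-cong []       eq x = eq x
  Δs-cong (m ∷ ms) eq x = cong₂ (λ a b → a - qp m * b) (Δs-cong ms eq (x ℤ.+ 1ℤ)) (Δs-cong ms eq x)

  Δs-linear : ∀ ms α φ ψ x → Δs ms (λ y → α * φ y + ψ y) x ≡ α * Δs ms φ x + Δs ms ψ x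
  Δs-linear []       α φ ψ x = refl
  Δs-linear (m ∷ ms) α φ ψ x =
    trans (cong₂ (λ a b → a - qp m * b) (Δs-linear ms α φ ψ (x ℤ.+ 1ℤ)) (Δs-linear ms α φ ψ x))
      (lem α (qp m) (Δs ms φ (x ℤ.+ 1ℤ)) (Δs ms ψ (x ℤ.+ 1ℤ)) (Δs ms φ x) (Δs ms ψ x))
    where
    lem : ∀ α k a b c d → α * a + b - k * (α * c + d) ≡ α * (a - k * c) + (b - k * d)
    lem = solve-∀ ℚring

  χ₁-suc : ∀ i x → χ₁ i (x ℤ.+ 1ℤ) ≡ qp i * χ₁ i x
  χ₁-suc i x = trans (cong qp (lem i x)) (qp-+ i (i ℤ.* x))
    where
    lem : ∀ i x → i ℤ.* (x ℤ.+ 1ℤ) ≡ i ℤ.+ i ℤ.* x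
    lem = ℤR.solve-∀

  Δs-χ : ∀ ms i → Σ ℚ λ ε → ∀ x → Δs ms (χ₁ i) x ≡ ε * χ₁ i x
  Δs-χ []       i = 1ℚ , λ x → sym (ℚ.*-identityˡ (χ₁ i x))
  Δs-χ (m ∷ ms) i with Δs-χ ms i
  ... | ε , eq = (ε * qp i - qp m * ε) , λ x →
    trans (cong₂ (λ a b → a - qp m * b) (trans (eq (x ℤ.+ 1ℤ)) (cong (ε *_) (χ₁-suc i x))) (eq x))
      (lem ε (qp i) (qp m) (χ₁ i x))
    where
    lem : ∀ ε a b c → ε * (a * c) - b * (ε * c) ≡ (ε * a - b * ε) * c
    lem = solve-∀ ℚring

  -- Each operator acts on a character by a scalar. Whatever scalar the earlier operators leave on
  -- the new term, the operator of its own exponent then kills it.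
  annihilator : ∀ {P φ} → Span χ₁ P φ → Σ (List ℤ) λ ms → All P ms × (∀ x → Δs ms φ x ≡ 0ℚ)
  annihilator (nil z) = [] , [] , z
  annihilator {φ = φ} (term {ψ = ψ} α i p s e) with annihilator s
  ... | ms , ps , z with Δs-χ ms i
  ...   | ε , eq = i ∷ ms , p ∷ ps , λ x →
    trans (cong₂ (λ a b → a - qp i * b) (val (x ℤ.+ 1ℤ)) (val x))
      (trans (cong (λ c → α * (ε * c) - qp i * (α * (ε * χ₁ i x))) (χ₁-suc i x)) (lem α ε (qp i) (χ₁ i x)))
    where
    lem : ∀ α ε a c → α * (ε * (a * c)) - a * (α * (ε * c)) ≡ 0ℚ
    lem = solve-∀ ℚring
    val : ∀ x → Δs ms φ x ≡ α * (ε * χ₁ i x)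
    val x = trans (Δs-cong ms e x) (trans (Δs-linear ms α (χ₁ i) ψ x)
      (trans (cong₂ (λ a b → α * a + b) (eq x) (z x)) (ℚ.+-identityʳ (α * (ε * χ₁ i x)))))

  backwards : (φ : ℤ → ℚ) → (∀ x → φ (x ℤ.+ 1ℤ) ≡ 0ℚ → φ x ≡ 0ℚ) →
              ∀ x₀ → (∀ x → x₀ ℤ.≤ x → φ x ≡ 0ℚ) → ∀ x → φ x ≡ 0ℚ
  backwards φ step x₀ h x = go ℤ.∣ x₀ ℤ.- x ∣ x (ℤ.≤-trans (ℤ.≤-reflexive (lem x₀ x)) (ℤ.+-monoʳ-≤ x (i≤∣i∣ (x₀ ℤ.- x))))
    where
    lem : ∀ x₀ x → x₀ ≡ x ℤ.+ (x₀ ℤ.- x)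
    lem = ℤR.solve-∀
    go : ∀ n x → x₀ ℤ.≤ x ℤ.+ + n → φ x ≡ 0ℚ
    go zero    x le = h x (subst (x₀ ℤ.≤_) (ℤ.+-identityʳ x) le)
    go (suc n) x le = step x (go n (x ℤ.+ 1ℤ) (subst (x₀ ℤ.≤_) (sym (ℤ.+-assoc x 1ℤ (+ n))) le))

  -- The hypothesis is a linear recurrence with invertible coefficients `qp m`, so it can be run
  -- backwards from the region where `φ` is known to vanish, one operator at a time.
  Δs-vanish : ∀ ms φ → (∀ x → Δs ms φ x ≡ 0ℚ) → ∀ x₀ → (∀ x → x₀ ℤ.≤ x → φ x ≡ 0ℚ) → ∀ x → φ x ≡ 0ℚ
  Δs-vanish []       φ z x₀ h = z
  Δs-vanish (m ∷ ms) φ z x₀ h = Δs-vanish ms φ (backwards (Δs ms φ) step x₀ (λ x le → eventually ms x le)) x₀ h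
    where
    eventually : ∀ ms x → x₀ ℤ.≤ x → Δs ms φ x ≡ 0ℚ
    eventually []       x le = h x le
    eventually (m ∷ ms) x le = trans (cong₂ (λ a b → a - qp m * b)
        (eventually ms (x ℤ.+ 1ℤ) (ℤ.≤-trans le (ℤ.i≤i+j x 1ℤ))) (eventually ms x le))
      (lem (qp m))
      where
      lem : ∀ a → 0ℚ - a * 0ℚ ≡ 0ℚ
      lem = solve-∀ ℚring
    step : ∀ x → Δs ms φ (x ℤ.+ 1ℤ) ≡ 0ℚ → Δs ms φ x ≡ 0ℚ
    step x eq = cancelˡ (qp m) (qp≢0 m)
      (trans (sym (a-b≡0⇒a≡b (z x))) (trans eq (sym (ℚ.*-zeroʳ (qp m)))))

  -- This replaces the principle that a polynomial with infinitely many roots is zero.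
  laurent-vanish : ∀ {φ} → Laurent φ → ∀ x₀ → (∀ x → x₀ ℤ.≤ x → φ x ≡ 0ℚ) → ∀ x → φ x ≡ 0ℚ
  laurent-vanish {φ} s with annihilator s
  ... | ms , _ , z = Δs-vanish ms φ z

  -- The operators that annihilate the span act on a constant by the product of the `1 - q^m` with
  -- `m ≢ 0`, which is non-zero as `q` is not a root of unity. Uniqueness of constant terms rests on
  -- this.
  span-nonconstant : ∀ {c} → Span χ₁ (_≢ 0ℤ) (λ _ → c) → c ≡ 0ℚ
  span-nonconstant {c} s with annihilator s
  ... | ms , ps , z with eigen ms ps
    where
    eigen : ∀ ms → All (_≢ 0ℤ) ms → Σ ℚ λ ε → (ε ≢ 0ℚ) × (∀ x → Δs ms (λ _ → c) x ≡ ε * c)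
    eigen [] [] = 1ℚ , 1≢0 , λ _ → sym (ℚ.*-identityˡ c)
    eigen (m ∷ ms) (p ∷ ps) with eigen ms ps
    ... | ε , nz , eq = θ m * ε , *-≢0 (θ≢0 m p) nz , λ x →
      trans (cong₂ (λ a b → a - qp m * b) (eq (x ℤ.+ 1ℤ)) (eq x)) (lem (qp m) ε c)
      where
      lem : ∀ a ε c → ε * c - a * (ε * c) ≡ (1ℚ - a) * ε * c
      lem = solve-∀ ℚring
  ... | ε , nz , eq = cancelˡ ε nz (trans (sym (eq 0ℤ)) (trans (z 0ℤ) (sym (ℚ.*-zeroʳ ε))))

  -- HasCT₁ φ κ: φ is a Laurent polynomial in q ^ x with constant term κ.
  record HasCT₁ (φ : ℤ → ℚ) (κ : ℚ) : Set where
    constructor ct₁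
    field remainder : Span χ₁ (_≢ 0ℤ) (λ x → φ x - κ)

  ct₁-unique : ∀ {φ κ κ′} → HasCT₁ φ κ → HasCT₁ φ κ′ → κ ≡ κ′
  ct₁-unique {φ} {κ} {κ′} (ct₁ s) (ct₁ t) = sym (a-b≡0⇒a≡b (span-nonconstant
    (span-ext (λ x → lem (φ x) κ κ′) (span-- s t))))
    where
    lem : ∀ f a b → b - a ≡ (f - a) - (f - b)
    lem = solve-∀ ℚring

  ct₁-ext : ∀ {φ ψ κ} → (∀ x → φ x ≡ ψ x) → HasCT₁ ψ κ → HasCT₁ φ κ
  ct₁-ext {κ = κ} eq (ct₁ s) = ct₁ (span-ext (λ x → cong (_- κ) (eq x)) s)

  ct₁-+ : ∀ {φ ψ κ κ′} → HasCT₁ φ κ → HasCT₁ ψ κ′ → HasCT₁ (λ x → φ x + ψ x) (κ + κ′)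
  ct₁-+ {φ} {ψ} {κ} {κ′} (ct₁ s) (ct₁ t) = ct₁ (span-ext (λ x → lem (φ x) (ψ x) κ κ′) (span-+ s t))
    where
    lem : ∀ a b c d → a + b - (c + d) ≡ (a - c) + (b - d)
    lem = solve-∀ ℚring

  ct₁-scale : ∀ {φ κ} β → HasCT₁ φ κ → HasCT₁ (λ x → β * φ x) (β * κ)
  ct₁-scale {φ} {κ} β (ct₁ s) = ct₁ (span-ext (λ x → lem β (φ x) κ) (span-scale β s))
    where
    lem : ∀ b f k → b * f - b * k ≡ b * (f - k)
    lem = solve-∀ ℚring

  ct₁-const : ∀ κ → HasCT₁ (λ _ → κ) κ
  ct₁-const κ = ct₁ (nil λ _ → ℚ.+-inverseʳ κ)

  ct₁-zero : ∀ {φ} → Span χ₁ (_≢ 0ℤ) φ → HasCT₁ φ 0ℚ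
  ct₁-zero {φ} s = ct₁ (span-ext (λ x → ℚ.+-identityʳ (φ x)) s)

  ct₁-χ : ∀ m → HasCT₁ (χ₁ m) (δ m)
  ct₁-χ m with m ℤ.≟ 0ℤ
  ... | yes refl = ct₁-ext χ₁-0 (ct₁-const 1ℚ)
  ... | no  m≢0  = ct₁-zero (span-χ m m≢0)

  ct₁-shift : ∀ {φ κ} e → HasCT₁ φ κ → HasCT₁ (λ x → φ (x ℤ.+ e)) κ
  ct₁-shift e (ct₁ s) = ct₁ (span-pull (ℤ._+ e) (λ m m≢0 → qp (m ℤ.* e) , m , m≢0 , λ x →
    trans (cong qp (lem m x e)) (qp-+ (m ℤ.* e) (m ℤ.* x))) s)
    where
    lem : ∀ m x e → m ℤ.* (x ℤ.+ e) ≡ m ℤ.* e ℤ.+ m ℤ.* x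
    lem = ℤR.solve-∀

-- Iterated constant terms and their dependence on a parameter.

module ConstantTerm (C : Character) where

  open ℚ₀ using (_+_; _*_)
  open Character C
  open ConstantTerm₁ C
  open import Data.Vec.Properties using (take++drop≡id; ++-injective)

  -- Iterated constant term, the first coordinate being eliminated first.
  data HasCT : ∀ k → (Vec ℤ k → ℚ) → ℚ → Set where
    ct-[] : ∀ {F κ} → F [] ≡ κ → HasCT 0 F κ
    ct-∷  : ∀ {k F κ} (G : Vec ℤ k → ℚ) → (∀ v → HasCT₁ (λ x → F (x ∷ v)) (G v)) →
            HasCT k G κ → HasCT (suc k) F κ

  ct-ext : ∀ {k F F′ κ} → (∀ v → F v ≡ F′ v) → HasCT k F′ κ → HasCT k F κ
  ct-ext eq (ct-[] e)    = ct-[] (trans (eq []) e)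
  ct-ext eq (ct-∷ G h t) = ct-∷ G (λ v → ct₁-ext (λ x → eq (x ∷ v)) (h v)) t

  ct-unique : ∀ {k F κ κ′} → HasCT k F κ → HasCT k F κ′ → κ ≡ κ′
  ct-unique (ct-[] e)    (ct-[] e′)     = trans (sym e) e′
  ct-unique (ct-∷ G h t) (ct-∷ G′ h′ t′) = ct-unique t (ct-ext (λ v → ct₁-unique (h v) (h′ v)) t′)

  ct-+ : ∀ {k F F′ κ κ′} → HasCT k F κ → HasCT k F′ κ′ → HasCT k (λ v → F v + F′ v) (κ + κ′)
  ct-+ (ct-[] e)    (ct-[] e′)     = ct-[] (cong₂ _+_ e e′)
  ct-+ (ct-∷ G h t) (ct-∷ G′ h′ t′) = ct-∷ _ (λ v → ct₁-+ (h v) (h′ v)) (ct-+ t t′)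

  ct-scale : ∀ {k F κ} β → HasCT k F κ → HasCT k (λ v → β * F v) (β * κ)
  ct-scale β (ct-[] e)    = ct-[] (cong (β *_) e)
  ct-scale β (ct-∷ G h t) = ct-∷ _ (λ v → ct₁-scale β (h v)) (ct-scale β t)

  ct-const : ∀ {k} κ → HasCT k (λ _ → κ) κ
  ct-const {zero}  κ = ct-[] refl
  ct-const {suc k} κ = ct-∷ (λ _ → κ) (λ _ → ct₁-const κ) (ct-const κ)

  ct-shift : ∀ {k F κ} e → HasCT k F κ → HasCT k (λ v → F (Vec.map (ℤ._+ e) v)) κ
  ct-shift e (ct-[] p)    = ct-[] p
  ct-shift e (ct-∷ G h t) = ct-∷ _ (λ v → ct₁-shift e (h (Vec.map (ℤ._+ e) v))) (ct-shift e t)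

  ct-++ : ∀ k {l F κ} (G : Vec ℤ l → ℚ) → (∀ v → HasCT k (λ u → F (u Vec.++ v)) (G v)) →
          HasCT l G κ → HasCT (k ℕ.+ l) F κ
  ct-++ zero    G h t = ct-ext (λ v → case h v of λ { (ct-[] e) → e }) t
  ct-++ (suc k) {l} {F} {κ} G h t = ct-∷ G′ first (ct-++ k G rest t)
    where
    inner : ∀ v → Σ (Vec ℤ k → ℚ) λ H → (∀ u → HasCT₁ (λ x → F (x ∷ u Vec.++ v)) (H u)) × HasCT k H (G v)
    inner v with h v
    ... | ct-∷ H p q = H , p , q
    -- The hypothesis yields a separate intermediate function for each `v`, whereas `ct-∷` wants a
    -- single one; they are glued by splitting the argument.
    G′ : Vec ℤ (k ℕ.+ l) → ℚ
    G′ w = proj₁ (inner (Vec.drop k w)) (Vec.take k w)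
    first : ∀ w → HasCT₁ (λ x → F (x ∷ w)) (G′ w)
    first w = subst (λ w′ → HasCT₁ (λ x → F (x ∷ w′)) (G′ w)) (take++drop≡id k w)
                (proj₁ (proj₂ (inner (Vec.drop k w))) (Vec.take k w))
    rest : ∀ v → HasCT k (λ u → G′ (u Vec.++ v)) (G v)
    rest v = ct-ext (λ u → cong₂ (λ v′ u′ → proj₁ (inner v′) u′)
                             (proj₂ (split u)) (proj₁ (split u)))
                    (proj₂ (proj₂ (inner v)))
      where
      split : ∀ (u : Vec ℤ k) → (Vec.take k (u Vec.++ v) ≡ u) × (Vec.drop k (u Vec.++ v) ≡ v)
      split u = ++-injective _ _ (take++drop≡id k (u Vec.++ v))

  χᵥ : ∀ {k} → Vec ℤ k → Vec ℤ k → ℚ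
  χᵥ v x = qp (dot v x)

  χᵥ-⊞ : ∀ {k} (v w x : Vec ℤ k) → χᵥ (v ⊞ w) x ≡ χᵥ v x * χᵥ w x
  χᵥ-⊞ v w x = trans (cong qp (dot-⊞ v w x)) (qp-+ (dot v x) (dot w x))

  ct-χᵥ : ∀ {k} (v : Vec ℤ k) → HasCT k (χᵥ v) (δᵥ v)
  ct-χᵥ []      = ct-[] qp-0
  ct-χᵥ (m ∷ v) = ct-∷ (λ y → δ m * χᵥ v y)
    (λ y → ct₁-ext (λ x → qp-+ (m ℤ.* x) (dot v y))
       (subst (HasCT₁ (λ x → qp (m ℤ.* x) * χᵥ v y)) (ℚ.*-comm (χᵥ v y) (δ m))
         (ct₁-ext (λ x → ℚ.*-comm (χ₁ m x) (χᵥ v y)) (ct₁-scale (χᵥ v y) (ct₁-χ m)))))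
    (ct-scale (δ m) (ct-χᵥ v))

  -- Constant terms depending on a parameter x, the first coordinate of the points of F.
  record Parametric {k} (P : Vec ℤ (suc k) → Set) (F : Vec ℤ (suc k) → ℚ) : Set where
    field
      value     : ℤ → ℚ
      value-ct  : ∀ x → HasCT k (λ v → F (x ∷ v)) (value x)
      value-lau : Span χ₁ (λ m → P (m ∷ zeros)) value
      total     : ℚ
      value-tot : HasCT₁ value total
      total-ct  : HasCT (suc k) F total

  -- A monomial contributes the same number whether the parameter is eliminated first or last, so
  -- `total` is the result of both orders. Only monomials with zero exponent in the other
  -- coordinates reach `value`, which therefore inherits the bound that `P` puts on them.
  parametric : ∀ {k} {P : Vec ℤ (suc k) → Set} {F} → Span χᵥ P F → Parametric P F
  parametric (nil z) = record
    { value     = λ _ → 0ℚ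
    ; value-ct  = λ x → ct-ext (λ v → z (x ∷ v)) (ct-const 0ℚ)
    ; value-lau = nil λ _ → refl
    ; total     = 0ℚ
    ; value-tot = ct₁-const 0ℚ
    ; total-ct  = ct-ext z (ct-const 0ℚ)
    }
  parametric {k} {P} (term {φ = F} {ψ = F′} α (m ∷ v) p s e) = record
    { value     = λ x → α * δᵥ v * χ₁ m x + value x
    ; value-ct  = λ x → ct-ext (λ u → e (x ∷ u))
        (ct-+ (ct-ext (λ u → trans (cong (α *_) (qp-+ (m ℤ.* x) (dot v u))) (sym (ℚ.*-assoc α (χ₁ m x) (χᵥ v u))))
                 (subst (HasCT k _) (lem α (χ₁ m x) (δᵥ v)) (ct-scale (α * χ₁ m x) (ct-χᵥ v))))
              (value-ct x))
    ; value-lau = span-+ monomial value-lau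
    ; total     = α * δᵥ v * δ m + total
    ; value-tot = ct₁-+ (ct₁-scale (α * δᵥ v) (ct₁-χ m)) value-tot
    ; total-ct  = ct-ext e (ct-+ (subst (HasCT (suc k) _) (lem′ α (δᵥ v) (δ m)) (ct-scale α (ct-χᵥ (m ∷ v)))) total-ct)
    }
    where
    open Parametric (parametric s)
    lem : ∀ α c d → α * c * d ≡ α * d * c
    lem = solve-∀ ℚring
    lem′ : ∀ α d e → α * (e * d) ≡ α * d * e
    lem′ = solve-∀ ℚring
    monomial : Span χ₁ (λ m → P (m ∷ zeros)) (λ x → α * δᵥ v * χ₁ m x)
    monomial with zeros? v
    ... | inj₁ refl = span-monomial (α * δᵥ v) m p
    ... | inj₂ z    = nil λ x → *-zeroˡ-≡ {b = χ₁ m x} (*-zeroʳ-≡ {α} z)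

-- Lagrange interpolation for constant terms against truncated geometric series.

module Interpolation (C : Character) where

  open ℚ₀ using (_+_; _*_; _-_; -_)
  open Character C
  open ConstantTerm₁ C
  open ConstantTerm C
  import Data.Vec.Relation.Unary.All as VAll
  open VAll using (_∷_; [])
  open import Data.Vec.Properties using (≡-dec)
  open import Data.List.Properties using (++-assoc)
  open import Data.List.Relation.Unary.All.Properties using (++⁻ˡ; ++⁻ʳ)

  -- The upper bound is strict because it is compared with the number of nodes; the lower bound is
  -- compared with the truncation order `T`.
  Bounded : ℕ → ℕ → ℤ → Set
  Bounded lo N m = (ℤ.- + lo ℤ.≤ m) × (m ℤ.< + N)

  qp-diff : ∀ u ν → qp (u ℤ.- ν) ≡ qp (ℤ.- ν) * χ₁ 1ℤ u
  qp-diff u ν = trans (cong qp (lem u ν)) (qp-+ (ℤ.- ν) (1ℤ ℤ.* u))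
    where
    lem : ∀ u ν → u ℤ.- ν ≡ ℤ.- ν ℤ.+ 1ℤ ℤ.* u
    lem = ℤR.solve-∀

  qp-diff⁻ : ∀ u ν → qp (ν ℤ.- u) ≡ qp ν * χ₁ ℤ.-1ℤ u
  qp-diff⁻ u ν = trans (cong qp (lem u ν)) (qp-+ ν (ℤ.-1ℤ ℤ.* u))
    where
    lem : ∀ u ν → ν ℤ.- u ≡ ν ℤ.+ ℤ.-1ℤ ℤ.* u
    lem = ℤR.solve-∀

  -- The quotient (x^m - 1) / (1 - x) at x = q ^ (u - ν).
  quotient-χ : ∀ lo N ν m → Bounded lo (suc N) m → Σ (ℤ → ℚ) λ h → Span χ₁ (Bounded lo N) h ×
               (∀ u → qp (m ℤ.* (u ℤ.- ν)) ≡ 1ℚ + θ (u ℤ.- ν) * h u)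
  quotient-χ lo N ν (+ zero) _ = (λ _ → 0ℚ) , nil (λ _ → refl) , λ u →
    trans (χ₁-0 (u ℤ.- ν)) (lem (θ (u ℤ.- ν)))
    where
    lem : ∀ t → 1ℚ ≡ 1ℚ + t * 0ℚ
    lem = solve-∀ ℚring
  quotient-χ lo N ν (+ suc n) (_ , ℤ.+<+ (ℕ.s≤s n<N)) =
    (λ u → - 1ℚ * geo n (qp (u ℤ.- ν))) ,
    span-scale (- 1ℚ) (span-mono bound (span-ext (λ u → cong (geo n) (qp-diff u ν))
      (span-geo ℤ._+_ χ₁-+ 0ℤ χ₁-0 (λ n i → (0ℤ ℤ.≤ i) × (i ℤ.≤ + n)) 1ℤ
         (λ n → ℤ.≤-refl , ℤ.+≤+ ℕ.z≤n)
         (λ { n (+ i) (_ , ℤ.+≤+ h) → ℤ.+≤+ ℕ.z≤n , ℤ.+≤+ (ℕ.s≤s h) })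
         (qp (ℤ.- ν)) n))) ,
    λ u → trans (sym (pow-qp (u ℤ.- ν) (suc n))) (lem (pow (qp (u ℤ.- ν)) (suc n)) (qp (u ℤ.- ν)) (geo n (qp (u ℤ.- ν))) (geo-sum n (qp (u ℤ.- ν))))
    where
    lem₁ : ∀ p → p ≡ 1ℚ - (1ℚ - p)
    lem₁ = solve-∀ ℚring
    lem₂ : ∀ x g → 1ℚ - (1ℚ - x) * g ≡ 1ℚ + (1ℚ - x) * (- 1ℚ * g)
    lem₂ = solve-∀ ℚring
    lem : ∀ p x g → (1ℚ - x) * g ≡ 1ℚ - p → p ≡ 1ℚ + (1ℚ - x) * (- 1ℚ * g)
    lem p x g eq = trans (lem₁ p) (trans (cong (λ z → 1ℚ - z) (sym eq)) (lem₂ x g))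
    bound : ∀ i → (0ℤ ℤ.≤ i) × (i ℤ.≤ + n) → Bounded lo N i
    bound i (p , r) = ℤ.≤-trans ℤ.neg-≤-pos p , ℤ.≤-<-trans r (ℤ.+<+ n<N)
  -- With `w = q^(ν-u)` one has `1 - w = - w (1 - q^(u-ν))`. The quotient `w + ... + w^(n+1)` has
  -- exponents from `-(n+1)` to `-1`, so the lower bound is kept.
  quotient-χ lo N ν -[1+ n ] (lo≤ , _) =
    (λ u → qp (ν ℤ.- u) * geo n (qp (ν ℤ.- u))) ,
    span-ext (λ u → cong₂ (λ a b → a * geo n b) (qp-diff⁻ u ν) (qp-diff⁻ u ν))
      (span-* ℤ._+_ χ₁-+ {P = _≡ ℤ.-1ℤ} bound (span-monomial (qp ν) ℤ.-1ℤ refl)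
        (span-geo ℤ._+_ χ₁-+ 0ℤ χ₁-0 (λ n i → (ℤ.- + n ℤ.≤ i) × (i ℤ.≤ 0ℤ)) ℤ.-1ℤ
         (λ n → ℤ.neg-≤-pos , ℤ.≤-refl)
         (λ n i (p , r) → subst (ℤ._≤ ℤ.-1ℤ ℤ.+ i) (sym (ℤ.neg-distrib-+ 1ℤ (+ n))) (ℤ.+-monoʳ-≤ ℤ.-1ℤ p)
                        , ℤ.≤-trans (ℤ.+-monoʳ-≤ ℤ.-1ℤ r) ℤ.-≤+)
         (qp ν) n)) ,
    λ u → trans (cong qp (eq₁ n ν u)) (trans (sym (pow-qp (ν ℤ.- u) (suc n)))
      (lem (pow (qp (ν ℤ.- u)) (suc n)) (qp (ν ℤ.- u)) (qp (u ℤ.- ν)) (geo n (qp (ν ℤ.- u))) (geo-sum n (qp (ν ℤ.- u)))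
        (trans (sym (qp-+ (u ℤ.- ν) (ν ℤ.- u))) (trans (cong qp (eq₂ u ν)) qp-0))))
    where
    eq₁ : ∀ n ν u → -[1+ n ] ℤ.* (u ℤ.- ν) ≡ + suc n ℤ.* (ν ℤ.- u)
    eq₁ n ν u = lem (+ suc n) ν u
      where
      lem : ∀ s ν u → (ℤ.- s) ℤ.* (u ℤ.- ν) ≡ s ℤ.* (ν ℤ.- u)
      lem = ℤR.solve-∀
    eq₂ : ∀ u ν → (u ℤ.- ν) ℤ.+ (ν ℤ.- u) ≡ 0ℤ
    eq₂ = ℤR.solve-∀
    lem₁ : ∀ p → p ≡ 1ℚ - (1ℚ - p)
    lem₁ = solve-∀ ℚring
    lem₂ : ∀ w x g → 1ℚ - (1ℚ - w) * g ≡ 1ℚ + (1ℚ - x) * (w * g) + (x * w - 1ℚ) * g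
    lem₂ = solve-∀ ℚring
    lem₃ : ∀ a g → a + (1ℚ - 1ℚ) * g ≡ a
    lem₃ = solve-∀ ℚring
    lem : ∀ p w x g → (1ℚ - w) * g ≡ 1ℚ - p → x * w ≡ 1ℚ → p ≡ 1ℚ + (1ℚ - x) * (w * g)
    lem p w x g eq xw = trans (lem₁ p) (trans (cong (λ z → 1ℚ - z) (sym eq)) (trans (lem₂ w x g)
      (trans (cong (λ z → 1ℚ + (1ℚ - x) * (w * g) + (z - 1ℚ) * g) xw) (lem₃ (1ℚ + (1ℚ - x) * (w * g)) g))))
    bound : ∀ i j → i ≡ ℤ.-1ℤ → (ℤ.- + n ℤ.≤ j) × (j ℤ.≤ 0ℤ) → Bounded lo N (i ℤ.+ j)
    bound i j refl (p , r) =
      ℤ.≤-trans lo≤ (subst (ℤ._≤ ℤ.-1ℤ ℤ.+ j) (sym (ℤ.neg-distrib-+ 1ℤ (+ n))) (ℤ.+-monoʳ-≤ ℤ.-1ℤ p)) ,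
      ℤ.≤-<-trans (ℤ.+-monoʳ-≤ ℤ.-1ℤ r) ℤ.-<+

  quotient : ∀ {lo N g} ν → Span χ₁ (Bounded lo (suc N)) g → Σ (ℤ → ℚ) λ h → Span χ₁ (Bounded lo N) h ×
             (∀ u → g u ≡ g ν + θ (u ℤ.- ν) * h u)
  quotient {g = g} ν (nil z) = (λ _ → 0ℚ) , nil (λ _ → refl) , λ u →
    trans (z u) (trans (lem (θ (u ℤ.- ν))) (cong (_+ θ (u ℤ.- ν) * 0ℚ) (sym (z ν))))
    where
    lem : ∀ t → 0ℚ ≡ 0ℚ + t * 0ℚ
    lem = solve-∀ ℚring
  quotient {lo} {N} {g} ν (term {ψ = ψ} α m p s e) with quotient-χ lo N ν m p | quotient {g = ψ} ν s
  ... | h , hs , hq | h′ , hs′ , hq′ =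
    (λ u → α * qp (m ℤ.* ν) * h u + h′ u) , span-+ (span-scale (α * qp (m ℤ.* ν)) hs) hs′ , λ u →
    trans (e u) (trans (cong₂ (λ a b → α * a + b)
      (trans (cong qp (lem₁ m u ν)) (trans (qp-+ (m ℤ.* ν) (m ℤ.* (u ℤ.- ν))) (cong (qp (m ℤ.* ν) *_) (hq u)))) (hq′ u))
      (trans (lem₂ α (qp (m ℤ.* ν)) (θ (u ℤ.- ν)) (h u) (ψ ν) (h′ u))
             (cong (_+ θ (u ℤ.- ν) * (α * qp (m ℤ.* ν) * h u + h′ u)) (sym (e ν)))))
    where
    lem₁ : ∀ m u ν → m ℤ.* u ≡ m ℤ.* ν ℤ.+ m ℤ.* (u ℤ.- ν)
    lem₁ = ℤR.solve-∀
    lem₂ : ∀ α c t h p h′ → α * (c * (1ℚ + t * h)) + (p + t * h′) ≡ (α * c + p) + t * (α * c * h + h′)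
    lem₂ = solve-∀ ℚring

  -- The series with constant term 1 and otherwise positive exponents: the class is closed under
  -- products, so a product of truncated geometric series has constant term 1 without any expansion.
  record Unitary (φ : ℤ → ℚ) : Set where
    constructor unitary
    field remainder : Span χ₁ (0ℤ ℤ.<_) (λ x → φ x - 1ℚ)

  unitary-1 : Unitary (λ _ → 1ℚ)
  unitary-1 = unitary (nil λ _ → refl)

  unitary-* : ∀ {φ ψ} → Unitary φ → Unitary ψ → Unitary (λ x → φ x * ψ x)
  unitary-* {φ} {ψ} (unitary s) (unitary t) = unitary (span-ext (λ x → lem (φ x) (ψ x))
    (span-+ (span-* ℤ._+_ χ₁-+ (λ _ _ p r → ℤ.+-mono-< p r) s t) (span-+ s t)))
    where
    lem : ∀ a b → a * b - 1ℚ ≡ (a - 1ℚ) * (b - 1ℚ) + ((a - 1ℚ) + (b - 1ℚ))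
    lem = solve-∀ ℚring

  unitary-∏ : {A : Set} (φ : A → ℤ → ℚ) → (∀ a → Unitary (φ a)) → ∀ as → Unitary (λ x → ∏ (λ a → φ a x) as)
  unitary-∏ φ h []       = unitary-1
  unitary-∏ φ h (a ∷ as) = unitary-* (h a) (unitary-∏ φ h as)

  unitary-geo : ∀ T ν → Unitary (λ u → geo T (qp (u ℤ.- ν)))
  unitary-geo zero    ν = unitary-1
  unitary-geo (suc T) ν = unitary (span-ext (λ u → trans (lem (qp (u ℤ.- ν)) (geo T (qp (u ℤ.- ν)))) (cong₂ (λ a b → a * geo T b) (qp-diff u ν) (qp-diff u ν)))
    (span-* ℤ._+_ χ₁-+ {P = _≡ 1ℤ} (λ { i j refl p → ℤ.<-≤-trans (ℤ.+<+ (ℕ.s≤s ℕ.z≤n)) (ℤ.+-monoʳ-≤ 1ℤ p) })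
      (span-monomial (qp (ℤ.- ν)) 1ℤ refl)
      (span-geo ℤ._+_ χ₁-+ 0ℤ χ₁-0 (λ _ i → 0ℤ ℤ.≤ i) 1ℤ (λ _ → ℤ.≤-refl)
         (λ _ i p → ℤ.≤-trans p (ℤ.i≤j+i i 1ℤ)) (qp (ℤ.- ν)) T)))
    where
    lem : ∀ x g → 1ℚ + x * g - 1ℚ ≡ x * g
    lem = solve-∀ ℚring

  unitary-ct : ∀ {φ} → Unitary φ → HasCT₁ φ 1ℚ
  unitary-ct (unitary s) = ct₁ (span-mono (λ { i p refl → ℤ.<-irrefl refl p }) s)

  unitary-span : ∀ {φ} → Unitary φ → Span χ₁ (0ℤ ℤ.≤_) φ
  unitary-span {φ} (unitary s) = span-ext (λ x → lem (φ x))
    (span-+ (span-mono (λ i p → ℤ.<⇒≤ p) s) (span-const ℤ._+_ χ₁-+ 0ℤ χ₁-0 1ℚ ℤ.≤-refl))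
    where
    lem : ∀ a → a ≡ a - 1ℚ + 1ℚ
    lem = solve-∀ ℚring

  geos : ℕ → List ℤ → ℤ → ℚ
  geos T νs u = ∏ (λ ν → geo T (qp (u ℤ.- ν))) νs

  pow-χ : ∀ n ν u → pow (qp (u ℤ.- ν)) n ≡ qp (+ n ℤ.* ℤ.- ν) * χ₁ (+ n) u
  pow-χ n ν u = trans (pow-qp (u ℤ.- ν) n) (trans (cong qp (lem (+ n) u ν)) (qp-+ _ (+ n ℤ.* u)))
    where
    lem : ∀ n u ν → n ℤ.* (u ℤ.- ν) ≡ n ℤ.* ℤ.- ν ℤ.+ n ℤ.* u
    lem = ℤR.solve-∀

  weighted : List (ℤ × ℚ) → (ℤ → ℚ) → ℚ
  weighted []             g = 0ℚ
  weighted ((ν , w) ∷ ws) g = w * g ν + weighted ws g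

  -- The value 0 at the zero exponent is a mere default: the argument is always a difference of
  -- distinct nodes.
  invθ : ℤ → ℚ
  invθ a with a ℤ.≟ 0ℤ
  ... | yes _   = 0ℚ
  ... | no a≢0 = proj₁ (inverse (θ a) (θ≢0 a a≢0))

  invθ-* : ∀ a → a ≢ 0ℤ → invθ a * θ a ≡ 1ℚ
  invθ-* a a≢0 with a ℤ.≟ 0ℤ
  ... | yes a≡0  = ⊥-elim (a≢0 a≡0)
  ... | no a≢0′ = proj₂ (inverse (θ a) (θ≢0 a a≢0′))

  Interpolates : ℕ → ℕ → List ℤ → List (ℤ × ℚ) → Set
  Interpolates lo T νs ws =
    ∀ g → Span χ₁ (Bounded lo (length νs)) g → HasCT₁ (λ u → g u * geos T νs u) (weighted ws g)

  -- Dividing g - g(ν) by 1 - q^(u-ν) removes the node ν: the factor 1 - q^(u-ν) turns the truncated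
  -- geometric series into 1 - q^((T+1)(u-ν)), whose second term is too large to contribute.
  interpolate-step : ∀ lo T → lo ℕ.≤ T → ∀ ν νs ws → Interpolates lo T νs ws →
    ∀ (g h : ℤ → ℚ) → Span χ₁ (Bounded lo (length νs)) h → (∀ u → g u ≡ g ν + θ (u ℤ.- ν) * h u) →
    HasCT₁ (λ u → g u * geos T (ν ∷ νs) u) (g ν + weighted ws h)
  interpolate-step lo T lo≤T ν νs ws interp g h hs eq =
    subst (HasCT₁ (λ u → g u * geos T (ν ∷ νs) u)) (cong (_+ weighted ws h) (ℚ.*-identityʳ (g ν)))
    (ct₁-ext expand (ct₁-+ {λ u → g ν * geos T (ν ∷ νs) u} {φ} (ct₁-scale (g ν) (unitary-ct (unitary-∏ (λ ν u → geo T (qp (u ℤ.- ν))) (unitary-geo T) (ν ∷ νs))))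
      (subst (HasCT₁ φ) (lem₀ (weighted ws h)) (ct₁-+ (interp h hs) (ct₁-scale (- 1ℚ) (ct₁-zero tail))))))
    where
    φ : ℤ → ℚ
    φ u = h u * geos T νs u + - 1ℚ * (pow (qp (u ℤ.- ν)) (suc T) * (h u * geos T νs u))
    lem₀ : ∀ a → a + - 1ℚ * 0ℚ ≡ a
    lem₀ = solve-∀ ℚring
    lem₁ : ∀ a t h y G → (a + t * h) * (y * G) ≡ a * (y * G) + (t * y) * (h * G)
    lem₁ = solve-∀ ℚring
    lem₂ : ∀ a p z → a + (1ℚ - p) * z ≡ a + (z + - 1ℚ * (p * z))
    lem₂ = solve-∀ ℚring
    expand : ∀ u → g u * geos T (ν ∷ νs) u ≡
      g ν * geos T (ν ∷ νs) u + (h u * geos T νs u + - 1ℚ * (pow (qp (u ℤ.- ν)) (suc T) * (h u * geos T νs u)))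
    expand u = trans (cong (_* geos T (ν ∷ νs) u) (eq u)) (trans (lem₁ (g ν) (θ (u ℤ.- ν)) (h u) (geo T (qp (u ℤ.- ν))) (geos T νs u))
      (trans (cong (λ z → g ν * geos T (ν ∷ νs) u + z * (h u * geos T νs u)) (geo-sum T (qp (u ℤ.- ν))))
             (lem₂ (g ν * geos T (ν ∷ νs) u) (pow (qp (u ℤ.- ν)) (suc T)) (h u * geos T νs u))))
    positive : ∀ i j → i ≡ + suc T → (ℤ.- + lo ℤ.≤ j) → i ℤ.+ j ≢ 0ℤ
    positive i j refl p eq′ = ℤ.<-irrefl (sym eq′) (ℤ.<-≤-trans {0ℤ} {+ suc T ℤ.+ ℤ.- + lo} pos (ℤ.+-monoʳ-≤ (+ suc T) p))
      where
      pos : 0ℤ ℤ.< + suc T ℤ.+ ℤ.- + lo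
      pos = subst (ℤ._< + suc T ℤ.+ ℤ.- + lo) (ℤ.+-inverseʳ (+ lo)) (ℤ.+-monoˡ-< (ℤ.- + lo) (ℤ.+<+ (ℕ.s≤s lo≤T)))
    tail : Span χ₁ (_≢ 0ℤ) (λ u → pow (qp (u ℤ.- ν)) (suc T) * (h u * geos T νs u))
    tail = span-* ℤ._+_ χ₁-+ positive
      (span-ext (pow-χ (suc T) ν) (span-monomial (qp (+ suc T ℤ.* ℤ.- ν)) (+ suc T) refl))
      (span-* ℤ._+_ χ₁-+ (λ i j (p , _) r → subst (ℤ._≤ i ℤ.+ j) (ℤ.+-identityʳ _) (ℤ.+-mono-≤ p r)) hs
        (unitary-span (unitary-∏ (λ ν u → geo T (qp (u ℤ.- ν))) (unitary-geo T) νs)))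

  -- Newton's divided differences: the weights for the remaining nodes are applied to
  -- `h(μ) = (g(μ) - g(ν)) / (1 - q^(μ-ν))`, and the weight of `ν` gathers the coefficients of
  -- `g(ν)`. No closed form is carried along; `weight` recovers it where it is wanted.
  interpolate : ∀ lo T → lo ℕ.≤ T → ∀ νs → AllPairs _≢_ νs →
                Σ (List (ℤ × ℚ)) λ ws → map proj₁ ws ≡ νs × Interpolates lo T νs ws
  -- With no nodes the bound leaves only negative exponents, so the constant term is 0.
  interpolate lo T lo≤T [] [] = [] , refl , λ g gs →
    ct₁-zero (span-ext (λ u → ℚ.*-identityʳ (g u)) (span-mono (λ { i (_ , i<0) refl → ℤ.<-irrefl refl i<0 }) gs))
  interpolate lo T lo≤T (ν ∷ νs) (ν≢ ∷ ds) with interpolate lo T lo≤T νs ds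
  ... | ws , refl , interp = (ν , 1ℚ - total ws) ∷ reweight ws , cong (ν ∷_) (nodes ws) , λ g gs →
    let h , hs , eq = quotient {g = g} ν gs in
    subst (HasCT₁ (λ u → g u * geos T (ν ∷ νs) u)) (agree g h eq) (interpolate-step lo T lo≤T ν νs ws interp g h hs eq)
    where
    reweight : List (ℤ × ℚ) → List (ℤ × ℚ)
    reweight []             = []
    reweight ((μ , w) ∷ ws) = (μ , w * invθ (μ ℤ.- ν)) ∷ reweight ws
    total : List (ℤ × ℚ) → ℚ
    total []             = 0ℚ
    total ((μ , w) ∷ ws) = w * invθ (μ ℤ.- ν) + total ws
    nodes : ∀ ws → map proj₁ (reweight ws) ≡ map proj₁ ws
    nodes []             = refl
    nodes ((μ , w) ∷ ws) = cong (μ ∷_) (nodes ws)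
    agree : ∀ (g h : ℤ → ℚ) → (∀ u → g u ≡ g ν + θ (u ℤ.- ν) * h u) →
            g ν + weighted ws h ≡ (1ℚ - total ws) * g ν + weighted (reweight ws) g
    agree g h eq = trans (cong (λ z → g ν + z) (go ws ν≢)) (lem (g ν) (total ws) (weighted (reweight ws) g))
      where
      lem : ∀ a t b → a + (b - t * a) ≡ (1ℚ - t) * a + b
      lem = solve-∀ ℚring
      lem₁ : ∀ w i h a t b θ → w * (i * θ * h) + (b - t * a) ≡ (w * i * (a + θ * h) + b) - (w * i + t) * a
      lem₁ = solve-∀ ℚring
      go : ∀ ws → All (ν ≢_) (map proj₁ ws) → weighted ws h ≡ weighted (reweight ws) g - total ws * g ν
      go []             []        = sym (lem₂ (g ν))
        where
        lem₂ : ∀ a → 0ℚ - 0ℚ * a ≡ 0ℚ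
        lem₂ = solve-∀ ℚring
      go ((μ , w) ∷ ws) (ν≢μ ∷ n) = trans
        (cong₂ (λ a b → w * a + b)
          (trans (sym (ℚ.*-identityˡ (h μ))) (cong (_* h μ) (sym (invθ-* (μ ℤ.- ν) (λ e → ν≢μ (sym (ℤ.i-j≡0⇒i≡j μ ν e)))))))
          (go ws n))
        (trans (lem₁ w (invθ (μ ℤ.- ν)) (h μ) (g ν) (total ws) (weighted (reweight ws) g) (θ (μ ℤ.- ν)))
          (cong (λ z → (w * invθ (μ ℤ.- ν) * z + weighted (reweight ws) g) - (w * invθ (μ ℤ.- ν) + total ws) * g ν)
                (sym (eq μ))))

  weighted-vanish : ∀ ws {g} → All (λ p → g (proj₁ p) ≡ 0ℚ) ws → weighted ws g ≡ 0ℚ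
  weighted-vanish []             []       = refl
  weighted-vanish ((ν , w) ∷ ws) (p ∷ ps) = cong₂ _+_ (*-zeroʳ-≡ {w} p) (weighted-vanish ws ps)

  weighted-single : ∀ pre ν w post {g} → All (λ p → g (proj₁ p) ≡ 0ℚ) pre → All (λ p → g (proj₁ p) ≡ 0ℚ) post →
                    weighted (pre ++ (ν , w) ∷ post) g ≡ w * g ν
  weighted-single [] ν w post {g} [] z = trans (cong (λ a → w * g ν + a) (weighted-vanish post z)) (ℚ.+-identityʳ (w * g ν))
  weighted-single ((μ , w′) ∷ pre) ν w post {g} (p ∷ ps) z =
    trans (cong₂ _+_ (*-zeroʳ-≡ {w′} p) (weighted-single pre ν w post ps z)) (ℚ.+-identityˡ (w * g ν))

  -- Each variable is treated with all the others fixed at points; no joint expansion is required,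
  -- since the interpolation eliminates one variable at a time.
  EachLaurent : ∀ lo N k → (Vec ℤ k → ℚ) → Set
  EachLaurent lo N zero    F = ⊤
  EachLaurent lo N (suc k) F = (∀ v → Span χ₁ (Bounded lo N) (λ x → F (x ∷ v))) ×
                               (∀ x → EachLaurent lo N k (λ v → F (x ∷ v)))

  each-zero : ∀ {lo N} k {F} → (∀ v → F v ≡ 0ℚ) → EachLaurent lo N k F
  each-zero zero    z = tt
  each-zero (suc k) z = (λ v → nil λ x → z (x ∷ v)) , λ x → each-zero k (λ v → z (x ∷ v))

  each-+ : ∀ {lo N} k {F F′} → EachLaurent lo N k F → EachLaurent lo N k F′ → EachLaurent lo N k (λ v → F v + F′ v)
  each-+ zero    _       _         = tt
  each-+ (suc k) (s , t) (s′ , t′) = (λ v → span-+ (s v) (s′ v)) , λ x → each-+ k (t x) (t′ x)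

  each-scale : ∀ {lo N} k {F} β → EachLaurent lo N k F → EachLaurent lo N k (λ v → β * F v)
  each-scale zero    β _       = tt
  each-scale (suc k) β (s , t) = (λ v → span-scale β (s v)) , λ x → each-scale k β (t x)

  each-weighted : ∀ {lo N} k ws {F : Vec ℤ (suc k) → ℚ} → (∀ x → EachLaurent lo N k (λ v → F (x ∷ v))) →
                  EachLaurent lo N k (λ v → weighted ws (λ x → F (x ∷ v)))
  each-weighted k []             h = each-zero k (λ _ → refl)
  each-weighted k ((ν , w) ∷ ws) {F} h = each-+ k (each-scale k w (h ν)) (each-weighted k ws {F} h)

  ∏ᵥ : ∀ {k} → (ℤ → ℚ) → Vec ℤ k → ℚ
  ∏ᵥ f []      = 1ℚ
  ∏ᵥ f (x ∷ v) = f x * ∏ᵥ f v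

  -- The sum of `F` over all `k`-tuples of nodes, each tuple weighted by the product of its weights,
  -- nested in the order of elimination.
  weightedₖ : List (ℤ × ℚ) → ∀ k → (Vec ℤ k → ℚ) → ℚ
  weightedₖ ws zero    F = F []
  weightedₖ ws (suc k) F = weightedₖ ws k (λ v → weighted ws (λ x → F (x ∷ v)))

  interpolateₖ : ∀ {lo T νs ws} → Interpolates lo T νs ws → ∀ k F → EachLaurent lo (length νs) k F →
                 HasCT k (λ v → F v * ∏ᵥ (geos T νs) v) (weightedₖ ws k F)
  interpolateₖ interp zero    F _ = ct-[] (ℚ.*-identityʳ (F []))
  interpolateₖ {lo} {T} {νs} {ws} interp (suc k) F (s , t) = ct-∷ _
    (λ v → subst (HasCT₁ (λ x → F (x ∷ v) * ∏ᵥ (geos T νs) (x ∷ v))) (ℚ.*-comm (∏ᵥ (geos T νs) v) _)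
      (ct₁-ext (λ x → lem (F (x ∷ v)) (geos T νs x) (∏ᵥ (geos T νs) v)) (ct₁-scale (∏ᵥ (geos T νs) v) (interp _ (s v)))))
    (interpolateₖ {lo} {T} {νs} {ws} interp k _ (each-weighted k ws {F} t))
    where
    lem : ∀ a b c → a * (b * c) ≡ c * (a * b)
    lem = solve-∀ ℚring

  module _ {S : ℤ → Set} {ws : List (ℤ × ℚ)} (inS : All (S ∘ proj₁) ws) where

    weightedₖ-vanish : ∀ k F → (∀ v → VAll.All S v → F v ≡ 0ℚ) → weightedₖ ws k F ≡ 0ℚ
    weightedₖ-vanish zero    F z = z [] []
    weightedₖ-vanish (suc k) F z = weightedₖ-vanish k _ λ v sv → weighted-vanish ws (All.map (λ s → z _ (s ∷ sv)) inS)

    IsolatedNode : ℤ × ℚ → Set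
    IsolatedNode (ν , w) = Σ (List (ℤ × ℚ)) λ pre → Σ (List (ℤ × ℚ)) λ post →
      (ws ≡ pre ++ (ν , w) ∷ post) × All (λ p → proj₁ p ≢ ν) (pre ++ post)

    isolated-in : ∀ p → IsolatedNode p → S (proj₁ p)
    isolated-in p (pre , post , eq , _) = All.head (++⁻ʳ pre (subst (All (S ∘ proj₁)) eq inS))

    weightedₖ-single : ∀ {k} (t : Vec (ℤ × ℚ) k) F → VAll.All IsolatedNode t →
      (∀ v → VAll.All S v → v ≡ Vec.map proj₁ t ⊎ F v ≡ 0ℚ) →
      weightedₖ ws k F ≡ Vec.foldr _ (λ p z → proj₂ p * z) (F (Vec.map proj₁ t)) t
    weightedₖ-single []            F []       z = refl
    weightedₖ-single ((ν , w) ∷ t) F ((pre , post , eq , others) ∷ iso) z =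
      trans (weightedₖ-single t _ iso z′) (trans (cong (λ a → Vec.foldr _ (λ p z → proj₂ p * z) a t) first) (pull w _ t))
      where
      F₁ : Vec ℤ _ → ℚ
      F₁ v = weighted ws (λ x → F (x ∷ v))
      pull : ∀ {k} w a (t : Vec (ℤ × ℚ) k) → Vec.foldr (λ _ → ℚ) (λ p z → proj₂ p * z) (w * a) t ≡
                         w * Vec.foldr (λ _ → ℚ) (λ p z → proj₂ p * z) a t
      pull w a []            = refl
      pull w a ((_ , b) ∷ t) = trans (cong (b *_) (pull w a t)) (lem b w (Vec.foldr (λ _ → ℚ) (λ p z → proj₂ p * z) a t))
        where
        lem : ∀ b w z → b * (w * z) ≡ w * (b * z)
        lem = solve-∀ ℚring
      z′ : ∀ v → VAll.All S v → v ≡ Vec.map proj₁ t ⊎ F₁ v ≡ 0ℚ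
      z′ v sv with ≡-dec ℤ._≟_ v (Vec.map proj₁ t)
      ... | yes eq = inj₁ eq
      ... | no neq = inj₂ (weighted-vanish ws (All.map (λ {p} s → case z (proj₁ p ∷ v) (s ∷ sv) of λ
          { (inj₁ refl) → ⊥-elim (neq refl) ; (inj₂ e) → e }) inS))
      tail-in : ∀ {k} {t : Vec (ℤ × ℚ) k} → VAll.All IsolatedNode t → VAll.All S (Vec.map proj₁ t)
      tail-in []             = []
      tail-in (_∷_ {x = p} i is) = isolated-in p i ∷ tail-in is
      zero-at : ∀ {μ} → S μ → μ ≢ ν → F (μ ∷ Vec.map proj₁ t) ≡ 0ℚ
      zero-at {μ} s μ≢ν = case z (μ ∷ Vec.map proj₁ t) (s ∷ tail-in iso) of λ
        { (inj₁ refl) → ⊥-elim (μ≢ν refl) ; (inj₂ e) → e }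
      first : F₁ (Vec.map proj₁ t) ≡ w * F (ν ∷ Vec.map proj₁ t)
      first =
        trans (cong (λ ws → weighted ws (λ x → F (x ∷ Vec.map proj₁ t))) eq)
          (weighted-single pre ν w post (zeros-on (++⁻ˡ pre inS′) (++⁻ˡ pre others))
                                        (zeros-on (All.tail (++⁻ʳ pre inS′)) (++⁻ʳ pre others)))
        where
        inS′ : All (S ∘ proj₁) (pre ++ (ν , w) ∷ post)
        inS′ = subst (All (S ∘ proj₁)) eq inS
        zeros-on : ∀ {ps} → All (S ∘ proj₁) ps → All (λ p → proj₁ p ≢ ν) ps → All (λ p → F (proj₁ p ∷ Vec.map proj₁ t) ≡ 0ℚ) ps
        zeros-on []       []       = []
        zeros-on (s ∷ ss) (n ∷ ns) = zero-at s n ∷ zeros-on ss ns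

  -- The weight of a node is read off the polynomial vanishing at all the other nodes.
  weight : ∀ {lo T pre ν w post} → Interpolates lo T (map proj₁ pre ++ ν ∷ map proj₁ post) (pre ++ (ν , w) ∷ post) →
           w * ∏ (λ μ → θ (ν ℤ.- μ)) (map proj₁ pre ++ map proj₁ post) ≡ 1ℚ
  weight {lo} {T} {pre} {ν} {w} {post} interp = trans (sym val)
    (ct₁-unique (interp g gs) (ct₁-ext regroup (unitary-ct (unitary-* (unitary-geo T ν)
       (unitary-∏ (λ μ u → θ (u ℤ.- μ) * geo T (qp (u ℤ.- μ))) unit others)))))
    where
    others : List ℤ
    others = map proj₁ pre ++ map proj₁ post
    g : ℤ → ℚ
    g u = ∏ (λ μ → θ (u ℤ.- μ)) others
    θ-span : ∀ μ → Span χ₁ (Bounded 0 2) (λ u → θ (u ℤ.- μ))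
    θ-span μ = span-- (span-const ℤ._+_ χ₁-+ 0ℤ χ₁-0 1ℚ (ℤ.≤-refl , ℤ.+<+ (ℕ.s≤s ℕ.z≤n)))
      (span-ext (λ u → qp-diff u μ) (span-monomial (qp (ℤ.- μ)) 1ℤ (ℤ.+≤+ ℕ.z≤n , ℤ.+<+ (ℕ.s≤s (ℕ.s≤s ℕ.z≤n)))))
    deg : ∀ μs → Span χ₁ (Bounded 0 (suc (length μs))) (λ u → ∏ (λ μ → θ (u ℤ.- μ)) μs)
    deg []       = span-const ℤ._+_ χ₁-+ 0ℤ χ₁-0 1ℚ (ℤ.≤-refl , ℤ.+<+ (ℕ.s≤s ℕ.z≤n))
    deg (μ ∷ μs) = span-* ℤ._+_ χ₁-+ bound (θ-span μ) (deg μs)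
      where
      bound : ∀ i j → Bounded 0 2 i → Bounded 0 (suc (length μs)) j → Bounded 0 (suc (suc (length μs))) (i ℤ.+ j)
      bound (+ i) (+ j) (_ , ℤ.+<+ (ℕ.s≤s p)) (_ , ℤ.+<+ (ℕ.s≤s r)) = ℤ.+≤+ ℕ.z≤n , ℤ.+<+ (ℕ.s≤s (ℕ.+-mono-≤ p r))
    gs : Span χ₁ (Bounded lo (length (map proj₁ pre ++ ν ∷ map proj₁ post))) g
    gs = span-mono (λ i (p , r) → ℤ.≤-trans ℤ.neg-≤-pos p , subst (λ n → i ℤ.< + n) (sym (len (map proj₁ pre))) r) (deg others)
      where
      len : ∀ xs → length (xs ++ ν ∷ map proj₁ post) ≡ suc (length (xs ++ map proj₁ post))
      len []       = refl
      len (_ ∷ xs) = cong suc (len xs)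
    val : weighted (pre ++ (ν , w) ∷ post) g ≡ w * g ν
    val = weighted-single pre ν w post (zero-pre pre (map proj₁ post)) (zero-post (map proj₁ pre) post)
      where
      θ-self : ∀ μ → θ (μ ℤ.- μ) ≡ 0ℚ
      θ-self μ = trans (cong θ (ℤ.+-inverseʳ μ)) θ-0
      zero-at : ∀ μ xs ys → ∏ (λ ρ → θ (μ ℤ.- ρ)) (xs ++ μ ∷ ys) ≡ 0ℚ
      zero-at μ []       ys = *-zeroˡ-≡ (θ-self μ)
      zero-at μ (x ∷ xs) ys = *-zeroʳ-≡ {θ (μ ℤ.- x)} (zero-at μ xs ys)
      zero-post : ∀ xs ps → All {A = ℤ × ℚ} (λ p → ∏ (λ μ → θ (proj₁ p ℤ.- μ)) (xs ++ map proj₁ ps) ≡ 0ℚ) ps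
      zero-post xs []             = []
      zero-post xs ((μ , _) ∷ ps) = zero-at μ xs (map proj₁ ps) ∷
        subst (λ l → All {A = ℤ × ℚ} (λ p → ∏ (λ μ → θ (proj₁ p ℤ.- μ)) l ≡ 0ℚ) ps) (++-assoc xs (μ ∷ []) (map proj₁ ps)) (zero-post (xs ++ μ ∷ []) ps)
      zero-pre′ : ∀ zs ps ys → All {A = ℤ × ℚ} (λ p → ∏ (λ μ → θ (proj₁ p ℤ.- μ)) (zs ++ map proj₁ ps ++ ys) ≡ 0ℚ) ps
      zero-pre′ zs []             ys = []
      zero-pre′ zs ((μ , _) ∷ ps) ys = zero-at μ zs (map proj₁ ps ++ ys) ∷
        subst (λ l → All {A = ℤ × ℚ} (λ p → ∏ (λ μ → θ (proj₁ p ℤ.- μ)) l ≡ 0ℚ) ps) (++-assoc zs (μ ∷ []) (map proj₁ ps ++ ys)) (zero-pre′ (zs ++ μ ∷ []) ps ys)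
      zero-pre : ∀ ps ys → All {A = ℤ × ℚ} (λ p → ∏ (λ μ → θ (proj₁ p ℤ.- μ)) (map proj₁ ps ++ ys) ≡ 0ℚ) ps
      zero-pre = zero-pre′ []
    -- The factor of `g` at `μ` cancels the geometric series of `μ` up to a term of degree `T + 1`,
    -- so the whole product keeps constant term 1.
    unit : ∀ μ → Unitary (λ u → θ (u ℤ.- μ) * geo T (qp (u ℤ.- μ)))
    unit μ = unitary (span-ext (λ u → trans (cong (_- 1ℚ) (trans (geo-sum T (qp (u ℤ.- μ))) (cong (λ z → 1ℚ - z) (pow-χ (suc T) μ u)))) (lem (qp (+ suc T ℤ.* ℤ.- μ)) (χ₁ (+ suc T) u)))
      (span-monomial (- 1ℚ * qp (+ suc T ℤ.* ℤ.- μ)) (+ suc T) (ℤ.+<+ (ℕ.s≤s ℕ.z≤n))))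
      where
      lem : ∀ a b → 1ℚ - a * b - 1ℚ ≡ - 1ℚ * a * b
      lem = solve-∀ ℚring
    regroup : ∀ u → g u * geos T (map proj₁ pre ++ ν ∷ map proj₁ post) u ≡
              geo T (qp (u ℤ.- ν)) * ∏ (λ μ → θ (u ℤ.- μ) * geo T (qp (u ℤ.- μ))) others
    regroup u = trans (cong (g u *_) (trans (∏-++ γ (map proj₁ pre) (ν ∷ map proj₁ post))
        (trans (lem₁ (∏ γ (map proj₁ pre)) (γ ν) (∏ γ (map proj₁ post))) (cong (γ ν *_) (sym (∏-++ γ (map proj₁ pre) (map proj₁ post)))))))
      (trans (lem₂ (g u) (γ ν) (∏ γ others)) (cong (γ ν *_) (sym (∏-* (λ μ → θ (u ℤ.- μ)) γ others))))
      where
      γ : ℤ → ℚ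
      γ μ = geo T (qp (u ℤ.- μ))
      lem₁ : ∀ a b c → a * (b * c) ≡ b * (a * c)
      lem₁ = solve-∀ ℚring
      lem₂ : ∀ a b c → a * (b * c) ≡ b * (a * c)
      lem₂ = solve-∀ ℚring

-- The integrand `f`, its zeros and its degree in each variable.

module Kernel (C : Character) (c′ : ℕ) where

  open ℚ₀ using (_+_; _*_; _-_; -_)
  open Character C
  open ConstantTerm₁ C
  open ConstantTerm C
  open Interpolation C

  c : ℕ
  c = suc c′

  factor₁ : ℕ → ℤ → ℚ
  factor₁ A u = qpoch (ℤ.- u) A * qpoch (1ℤ ℤ.+ u) c′

  pair : ℤ → ℤ → ℚ
  pair u u′ = qpoch (u ℤ.- u′) c * qpoch (1ℤ ℤ.+ (u′ ℤ.- u)) c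

  pairs : ∀ {k} → Vec ℤ k → ℚ
  pairs []      = 1ℚ
  pairs (u ∷ v) = ∏ᵥ (pair u) v * pairs v

  integrand : ∀ {k} → ℕ → Vec ℤ k → ℚ
  integrand A v = ∏ᵥ (factor₁ A) v * pairs v

  ∏ᵥ-cong : ∀ {k} {f g : ℤ → ℚ} → (∀ x → f x ≡ g x) → (v : Vec ℤ k) → ∏ᵥ f v ≡ ∏ᵥ g v
  ∏ᵥ-cong eq []      = refl
  ∏ᵥ-cong eq (x ∷ v) = cong₂ _*_ (eq x) (∏ᵥ-cong eq v)

  ∏ᵥ-* : ∀ {k} (f g : ℤ → ℚ) (v : Vec ℤ k) → ∏ᵥ (λ x → f x * g x) v ≡ ∏ᵥ f v * ∏ᵥ g v
  ∏ᵥ-* f g []      = refl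
  ∏ᵥ-* f g (x ∷ v) = trans (cong (f x * g x *_) (∏ᵥ-* f g v)) (interchange (f x) (g x) _ _)

  ∏ᵥ-1 : ∀ {k} (v : Vec ℤ k) → ∏ᵥ (λ _ → 1ℚ) v ≡ 1ℚ
  ∏ᵥ-1 []      = refl
  ∏ᵥ-1 (x ∷ v) = trans (ℚ.*-identityˡ _) (∏ᵥ-1 v)

  ∏ᵥ-zero : ∀ {k} (f : ℤ → ℚ) (v : Vec ℤ k) i → f (Vec.lookup v i) ≡ 0ℚ → ∏ᵥ f v ≡ 0ℚ
  ∏ᵥ-zero f (x ∷ v) Fin.zero    eq = *-zeroˡ-≡ eq
  ∏ᵥ-zero f (x ∷ v) (Fin.suc i) eq = *-zeroʳ-≡ {f x} (∏ᵥ-zero f v i eq)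

  pairs-zero : ∀ {k} (v : Vec ℤ k) i j → i Fin.< j → pair (Vec.lookup v i) (Vec.lookup v j) ≡ 0ℚ → pairs v ≡ 0ℚ
  pairs-zero (x ∷ v) Fin.zero    (Fin.suc j) _         eq = *-zeroˡ-≡ (∏ᵥ-zero (pair x) v j eq)
  pairs-zero (x ∷ v) (Fin.suc i) (Fin.suc j) (ℕ.s≤s p) eq = *-zeroʳ-≡ {∏ᵥ (pair x) v} (pairs-zero v i j p eq)

  qpoch-zero : ∀ a m l → l ℕ.< m → a ℤ.+ + l ≡ 0ℤ → qpoch a m ≡ 0ℚ
  qpoch-zero a m l l<m eq = ∏<-zero m {λ l → θ (a ℤ.+ + l)} l l<m (trans (cong θ eq) θ-0)

  qpoch-≢0 : ∀ a m → (∀ l → l ℕ.< m → a ℤ.+ + l ≢ 0ℤ) → qpoch a m ≢ 0ℚ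
  qpoch-≢0 a m nz = ∏<-≢0 m (λ l l<m → θ≢0 (a ℤ.+ + l) (nz l l<m))

  -- The first Pochhammer symbol vanishes for `0 ≤ u′ - u < c`, the second for `0 < u - u′ ≤ c`.
  -- Writing the difference as `l - l′` covers both ranges and fits variables at poles of one
  -- parameter.
  pair-zero : ∀ u u′ l l′ → l ℕ.< c → l′ ℕ.≤ c → u ℤ.+ + l ≡ u′ ℤ.+ + l′ → pair u u′ ≡ 0ℚ
  pair-zero u u′ l l′ l<c l′≤c eq with l′ ℕ.≤? l
  ... | yes l′≤l = *-zeroˡ-≡ (qpoch-zero (u ℤ.- u′) c (l ℕ.∸ l′) (ℕ.≤-<-trans (ℕ.m∸n≤m l l′) l<c)
      (trans (cong (λ z → u ℤ.- u′ ℤ.+ z) (sym (ℤ.⊖-≥ l′≤l)))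
        (trans (cong (λ z → u ℤ.- u′ ℤ.+ z) (sym (ℤ.m-n≡m⊖n l l′))) (lem u u′ (+ l) (+ l′) eq))))
    where
    lem₁ : ∀ u u′ l l′ → u ℤ.- u′ ℤ.+ (l ℤ.- l′) ≡ (u ℤ.+ l) ℤ.- (u′ ℤ.+ l′)
    lem₁ = ℤR.solve-∀
    lem : ∀ u u′ l l′ → u ℤ.+ l ≡ u′ ℤ.+ l′ → u ℤ.- u′ ℤ.+ (l ℤ.- l′) ≡ 0ℤ
    lem u u′ l l′ eq = trans (lem₁ u u′ l l′) (ℤ.i≡j⇒i-j≡0 eq)
  ... | no l′≰l = *-zeroʳ-≡ {qpoch (u ℤ.- u′) c} (qpoch-zero (1ℤ ℤ.+ (u′ ℤ.- u)) c (l′ ℕ.∸ suc l)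
      (ℕ.<-≤-trans (ℕ.∸-monoʳ-< {l′} {suc l} {0} (ℕ.s≤s ℕ.z≤n) (ℕ.≰⇒> l′≰l)) l′≤c)
      (trans (cong (λ z → 1ℤ ℤ.+ (u′ ℤ.- u) ℤ.+ z) (sym (ℤ.⊖-≥ (ℕ.≰⇒> l′≰l))))
        (trans (cong (λ z → 1ℤ ℤ.+ (u′ ℤ.- u) ℤ.+ z) (sym (ℤ.m-n≡m⊖n l′ (suc l)))) (lem u u′ (+ l) (+ l′) eq))))
    where
    lem₁ : ∀ u u′ l l′ → 1ℤ ℤ.+ (u′ ℤ.- u) ℤ.+ (l′ ℤ.- (1ℤ ℤ.+ l)) ≡ (u′ ℤ.+ l′) ℤ.- (u ℤ.+ l)
    lem₁ = ℤR.solve-∀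
    lem : ∀ u u′ l l′ → u ℤ.+ l ≡ u′ ℤ.+ l′ → 1ℤ ℤ.+ (u′ ℤ.- u) ℤ.+ (l′ ℤ.- (1ℤ ℤ.+ l)) ≡ 0ℤ
    lem u u′ l l′ eq = trans (lem₁ u u′ l l′) (ℤ.i≡j⇒i-j≡0 (sym eq))

  factor₁-zero : ∀ A u → ℤ.- + c′ ℤ.≤ u → u ℤ.< + A → factor₁ A u ≡ 0ℚ
  factor₁-zero A (+ n) _ (ℤ.+<+ n<A) = *-zeroˡ-≡ (qpoch-zero (ℤ.- + n) A n n<A (ℤ.+-inverseˡ (+ n)))
  factor₁-zero A -[1+ n ] low _ = *-zeroʳ-≡ {qpoch (+ suc n) A} (qpoch-zero (1ℤ ℤ.+ -[1+ n ]) c′ n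
    (ℤ.drop‿+≤+ (ℤ.neg-cancel-≤ {+ c′} {+ suc n} low)) (lem (+ n)))
    where
    lem : ∀ n → 1ℤ ℤ.+ ℤ.- (1ℤ ℤ.+ n) ℤ.+ n ≡ 0ℤ
    lem = ℤR.solve-∀

  -- Closed at both ends, so that bounds add up under products; `Bounded` is the half-open form that
  -- the interpolation expects.
  record Range (lo hi : ℕ) (i : ℤ) : Set where
    constructor range
    field
      lower : ℤ.- + lo ℤ.≤ i
      upper : i ℤ.≤ + hi

  range-* : ∀ {a b a′ b′ φ ψ} → Span χ₁ (Range a b) φ → Span χ₁ (Range a′ b′) ψ →
            Span χ₁ (Range (a ℕ.+ a′) (b ℕ.+ b′)) (λ x → φ x * ψ x)
  range-* {a} {a′ = a′} = span-* ℤ._+_ χ₁-+ λ i j (range p r) (range p′ r′) →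
    range (subst (ℤ._≤ i ℤ.+ j) (sym (ℤ.neg-distrib-+ (+ a) (+ a′))) (ℤ.+-mono-≤ p p′)) (ℤ.+-mono-≤ r r′)

  range-1 : ∀ κ {a b} → Span χ₁ (Range a b) (λ _ → κ)
  range-1 κ = span-const ℤ._+_ χ₁-+ 0ℤ χ₁-0 κ (range ℤ.neg-≤-pos (ℤ.+≤+ ℕ.z≤n))

  range-∏< : ∀ {a b} (φ : ℕ → ℤ → ℚ) → (∀ l → Span χ₁ (Range a b) (φ l)) → ∀ m →
             Span χ₁ (Range (m ℕ.* a) (m ℕ.* b)) (λ x → ∏< m (λ l → φ l x))
  range-∏< φ h zero    = range-1 1ℚ
  range-∏< φ h (suc m) = range-* (h 0) (range-∏< (φ ∘ suc) (h ∘ suc) m)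

  range-∏ : ∀ {X : Set} {a b} (φ : X → ℤ → ℚ) → (∀ l → Span χ₁ (Range a b) (φ l)) → ∀ ls →
            Span χ₁ (Range (length ls ℕ.* a) (length ls ℕ.* b)) (λ x → ∏ (λ l → φ l x) ls)
  range-∏ φ h []       = range-1 1ℚ
  range-∏ φ h (l ∷ ls) = range-* (h l) (range-∏ φ h ls)

  range-∏ᵥ : ∀ {k a b} (φ : ℤ → ℤ → ℚ) → (∀ u → Span χ₁ (Range a b) (φ u)) → (v : Vec ℤ k) →
             Span χ₁ (Range (k ℕ.* a) (k ℕ.* b)) (λ x → ∏ᵥ (λ u → φ u x) v)
  range-∏ᵥ φ h []      = range-1 1ℚ
  range-∏ᵥ φ h (l ∷ v) = range-* (h l) (range-∏ᵥ φ h v)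

  range-θ⁺ : ∀ a → Span χ₁ (Range 0 1) (λ x → θ (a ℤ.+ x))
  range-θ⁺ a = span-- (range-1 1ℚ) (span-ext (λ x → trans (cong qp (lem a x)) (qp-+ a (1ℤ ℤ.* x)))
      (span-monomial (qp a) 1ℤ (range (ℤ.+≤+ ℕ.z≤n) ℤ.≤-refl)))
    where
    lem : ∀ a x → a ℤ.+ x ≡ a ℤ.+ 1ℤ ℤ.* x
    lem = ℤR.solve-∀

  range-θ⁻ : ∀ a → Span χ₁ (Range 1 0) (λ x → θ (a ℤ.- x))
  range-θ⁻ a = span-- (range-1 1ℚ) (span-ext (λ x → trans (cong qp (lem a x)) (qp-+ a (ℤ.-1ℤ ℤ.* x)))
      (span-monomial (qp a) ℤ.-1ℤ (range ℤ.≤-refl ℤ.-≤+)))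
    where
    lem : ∀ a x → a ℤ.- x ≡ a ℤ.+ ℤ.-1ℤ ℤ.* x
    lem = ℤR.solve-∀

  range-cast : ∀ {a b a′ b′ φ} → a ≡ a′ → b ≡ b′ → Span χ₁ (Range a b) φ → Span χ₁ (Range a′ b′) φ
  range-cast refl refl s = s

  range-qpoch⁺ : ∀ a m → Span χ₁ (Range 0 m) (λ x → qpoch (a ℤ.+ x) m)
  range-qpoch⁺ a m = range-cast (ℕ.*-zeroʳ m) (ℕ.*-identityʳ m)
    (range-∏< (λ l x → θ (a ℤ.+ x ℤ.+ + l)) (λ l → span-ext (λ x → cong θ (lem a x (+ l))) (range-θ⁺ (a ℤ.+ + l))) m)
    where
    lem : ∀ a x l → a ℤ.+ x ℤ.+ l ≡ a ℤ.+ l ℤ.+ x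
    lem = ℤR.solve-∀

  range-qpoch⁻ : ∀ a m → Span χ₁ (Range m 0) (λ x → qpoch (a ℤ.- x) m)
  range-qpoch⁻ a m = range-cast (ℕ.*-identityʳ m) (ℕ.*-zeroʳ m)
    (range-∏< (λ l x → θ (a ℤ.- x ℤ.+ + l)) (λ l → span-ext (λ x → cong θ (lem a x (+ l))) (range-θ⁻ (a ℤ.+ + l))) m)
    where
    lem : ∀ a x l → a ℤ.- x ℤ.+ l ≡ a ℤ.+ l ℤ.- x
    lem = ℤR.solve-∀

  range-factor₁ : ∀ A → Span χ₁ (Range A c′) (factor₁ A)
  range-factor₁ A = range-cast (ℕ.+-identityʳ A) refl
    (range-* (span-ext (λ x → cong (λ z → qpoch z A) (sym (ℤ.+-identityˡ (ℤ.- x)))) (range-qpoch⁻ 0ℤ A)) (range-qpoch⁺ 1ℤ c′))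

  range-pairʳ : ∀ u → Span χ₁ (Range c c) (pair u)
  range-pairʳ u = range-cast (ℕ.+-identityʳ c) refl (range-* (range-qpoch⁻ u c)
    (span-ext (λ x → cong (λ z → qpoch z c) (lem u x)) (range-qpoch⁺ (1ℤ ℤ.- u) c)))
    where
    lem : ∀ u x → 1ℤ ℤ.+ (x ℤ.- u) ≡ 1ℤ ℤ.- u ℤ.+ x
    lem = ℤR.solve-∀

  range-pairˡ : ∀ u → Span χ₁ (Range c c) (λ x → pair x u)
  range-pairˡ u = range-cast refl (ℕ.+-identityʳ c) (range-* (span-ext (λ x → cong (λ z → qpoch z c) (ℤ.+-comm x (ℤ.- u))) (range-qpoch⁺ (ℤ.- u) c))
    (span-ext (λ x → cong (λ z → qpoch z c) (lem u x)) (range-qpoch⁻ (1ℤ ℤ.+ u) c)))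
    where
    lem : ∀ u x → 1ℤ ℤ.+ (u ℤ.- x) ≡ 1ℤ ℤ.+ u ℤ.- x
    lem = ℤR.solve-∀

  each-ext : ∀ {lo N} k {F F′ : Vec ℤ k → ℚ} → (∀ v → F v ≡ F′ v) → EachLaurent lo N k F′ → EachLaurent lo N k F
  each-ext zero    eq _       = tt
  each-ext (suc k) eq (s , t) = (λ v → span-ext (λ x → eq (x ∷ v)) (s v)) , λ x → each-ext k (λ v → eq (x ∷ v)) (t x)

  -- In one variable the factor `(q u)_{c-1}` has degree `c - 1` and each of the `k - 1` pairs has
  -- degree `c`, in total `k c - 1`: just below the number of poles of `k` parameters.
  each-integrand : ∀ A k → EachLaurent (A ℕ.+ k ℕ.* c) (k ℕ.* c) k (integrand A)
  each-integrand A k = each-ext k (λ v → cong (_* pairs v) (∏ᵥ-cong (λ u → sym (ℚ.*-identityʳ (factor₁ A u))) v)) (go k [] refl)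
    where
    -- The list `es` holds the leading variables already fixed; their pairs with the remaining
    -- variables are moved into the one-variable factors.
    go : ∀ k′ es → length es ℕ.+ k′ ≡ k →
         EachLaurent (A ℕ.+ k ℕ.* c) (k ℕ.* c) k′ (λ v → ∏ᵥ (λ u → factor₁ A u * ∏ (λ e → pair e u) es) v * pairs v)
    go zero     es eq = tt
    go (suc k′) es eq = (λ v → span-ext (λ x → lem (factor₁ A x) (∏ (λ e → pair e x) es) (∏ᵥ (f es) v) (∏ᵥ (pair x) v) (pairs v))
                           (span-scale (∏ᵥ (f es) v * pairs v) (span-mono (λ i (range p r) →
                              ℤ.≤-trans (ℤ.neg-mono-≤ (ℤ.+≤+ lo)) p , ℤ.≤-<-trans r (ℤ.+<+ hi)) (head-range v))))
                      , λ x → each-ext k′ (λ v → step x v) (each-scale k′ (f es x) (go k′ (x ∷ es) (trans (sym (ℕ.+-suc (length es) k′)) eq)))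
      where
      f : List ℤ → ℤ → ℚ
      f es u = factor₁ A u * ∏ (λ e → pair e u) es
      lem : ∀ a b c d e → a * b * c * (d * e) ≡ c * e * (a * b * d)
      lem = solve-∀ ℚring
      head-range : (v : Vec ℤ k′) → Span χ₁ (Range (A ℕ.+ length es ℕ.* c ℕ.+ k′ ℕ.* c) (c′ ℕ.+ length es ℕ.* c ℕ.+ k′ ℕ.* c))
                        (λ x → factor₁ A x * ∏ (λ e → pair e x) es * ∏ᵥ (pair x) v)
      head-range v = range-* (range-* (range-factor₁ A) (range-∏ pair range-pairʳ es)) (range-∏ᵥ (λ u x → pair x u) range-pairˡ v)
      size : k ℕ.* c ≡ c ℕ.+ (length es ℕ.* c ℕ.+ k′ ℕ.* c)
      size = trans (cong (ℕ._* c) (trans (sym eq) (ℕ.+-suc (length es) k′))) (cong (c ℕ.+_) (ℕ.*-distribʳ-+ c (length es) k′))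
      lo : A ℕ.+ length es ℕ.* c ℕ.+ k′ ℕ.* c ℕ.≤ A ℕ.+ k ℕ.* c
      lo = subst₂ ℕ._≤_ (sym (ℕ.+-assoc A (length es ℕ.* c) (k′ ℕ.* c))) (cong (A ℕ.+_) (sym size)) (ℕ.+-monoʳ-≤ A (ℕ.m≤n+m _ c))
      hi : c′ ℕ.+ length es ℕ.* c ℕ.+ k′ ℕ.* c ℕ.< k ℕ.* c
      hi = ℕ.≤-reflexive (trans (cong suc (ℕ.+-assoc c′ (length es ℕ.* c) (k′ ℕ.* c))) (sym size))
      step : ∀ x (v : Vec ℤ k′) → ∏ᵥ (f es) (x ∷ v) * pairs (x ∷ v) ≡ f es x * (∏ᵥ (f (x ∷ es)) v * pairs v)
      step x v = trans (lem₁ (f es x) (∏ᵥ (f es) v) (∏ᵥ (pair x) v) (pairs v))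
        (cong (λ z → f es x * (z * pairs v)) (trans (sym (∏ᵥ-* (f es) (pair x) v))
          (∏ᵥ-cong (λ u → lem₂ (factor₁ A u) (∏ (λ e → pair e u) es) (pair x u)) v)))
        where
        lem₁ : ∀ a b c d → a * b * (c * d) ≡ a * (b * c * d)
        lem₁ = solve-∀ ℚring
        lem₂ : ∀ a b c → a * b * c ≡ a * (c * b)
        lem₂ = solve-∀ ℚring

  grid : List ℤ → ℕ → List ℤ
  grid y m = concatMap (λ η → applyUpTo (λ l → η ℤ.+ + l) m) y

  Γ : ℕ → List ℤ → ℤ → ℚ
  Γ T y u = ∏ (λ g → geo T (qp (u ℤ.+ g))) (grid y c)

-- Deformation of the parameters along powers of `q^x`, and the degree in `q^x`.

module Families (C : Character) (c′ : ℕ) where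

  open ℚ₀ using (_+_; _*_; _-_; -_)
  open Character C
  open ConstantTerm₁ C
  open ConstantTerm C
  open Interpolation C
  open Kernel C c′
  import Data.Vec.Relation.Unary.All as VAll
  open VAll using (_∷_; [])
  open import Data.Vec.Properties using (map-∘; map-lookup-allFin)

  total : ∀ {k} → Vec ℤ k → ℤ
  total []      = 0ℤ
  total (m ∷ v) = m ℤ.+ total v

  total-⊞ : ∀ {k} (v w : Vec ℤ k) → total (v ⊞ w) ≡ total v ℤ.+ total w
  total-⊞ []      []      = refl
  total-⊞ (m ∷ v) (n ∷ w) = trans (cong (λ z → m ℤ.+ n ℤ.+ z) (total-⊞ v w)) (lem m n (total v) (total w))
    where
    lem : ∀ a b c d → a ℤ.+ b ℤ.+ (c ℤ.+ d) ≡ a ℤ.+ c ℤ.+ (b ℤ.+ d)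
    lem = ℤR.solve-∀

  total-zeros : ∀ k → total (zeros {k}) ≡ 0ℤ
  total-zeros zero    = refl
  total-zeros (suc k) = trans (ℤ.+-identityˡ _) (total-zeros k)

  total-neg : ∀ {k} (v : Vec ℤ k) → total (neg v) ≡ ℤ.- total v
  total-neg []      = refl
  total-neg (m ∷ v) = trans (cong (λ z → ℤ.- m ℤ.+ z) (total-neg v)) (sym (ℤ.neg-distrib-+ m (total v)))

  basis : ∀ {k} → Fin k → Vec ℤ k
  basis Fin.zero    = 1ℤ ∷ zeros
  basis (Fin.suc i) = 0ℤ ∷ basis i

  dot-basis : ∀ {k} (i : Fin k) x → dot (basis i) x ≡ Vec.lookup x i
  dot-basis Fin.zero    (x ∷ y) = trans (cong₂ ℤ._+_ (ℤ.*-identityˡ x) (dot-zeros y)) (ℤ.+-identityʳ x)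
  dot-basis (Fin.suc i) (x ∷ y) = trans (ℤ.+-identityˡ _) (dot-basis i y)

  total-basis : ∀ {k} (i : Fin k) → total (basis i) ≡ 1ℤ
  total-basis {suc k} Fin.zero    = cong (λ z → 1ℤ ℤ.+ z) (total-zeros k)
  total-basis         (Fin.suc i) = trans (ℤ.+-identityˡ _) (total-basis i)

  -- With q^x as parameter, the coefficient of q^(v·u) has degree at most b + ω |v| in q^x: this is a
  -- grading in which each variable u_i has degree ω, and b bounds the contribution of its inverses.
  record Weighted (ω b : ℕ) {k} (i : Vec ℤ (suc k)) : Set where
    constructor weigh
    field
      nonneg : 0ℤ ℤ.≤ Vec.head i
      bound  : Vec.head i ℤ.≤ + b ℤ.+ + ω ℤ.* total (Vec.tail i)

  module _ (ω : ℕ) {k : ℕ} where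

    Y : Set
    Y = Vec ℤ (suc k)

    WSpan : ℕ → (Y → ℚ) → Set
    WSpan b = Span χᵥ (Weighted ω b)

    weighted-⊞ : ∀ {b b′} (i j : Y) → Weighted ω b i → Weighted ω b′ j → Weighted ω (b ℕ.+ b′) (i ⊞ j)
    weighted-⊞ {b} {b′} (m ∷ v) (n ∷ w) (weigh p r) (weigh p′ r′) = weigh (ℤ.+-mono-≤ p p′)
      (ℤ.≤-trans (ℤ.+-mono-≤ r r′) (ℤ.≤-reflexive (trans (lem (+ b) (+ b′) (+ ω) (total v) (total w))
        (cong (λ z → + (b ℕ.+ b′) ℤ.+ + ω ℤ.* z) (sym (total-⊞ v w))))))
      where
      lem : ∀ b b′ o s t → (b ℤ.+ o ℤ.* s) ℤ.+ (b′ ℤ.+ o ℤ.* t) ≡ (b ℤ.+ b′) ℤ.+ o ℤ.* (s ℤ.+ t)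
      lem = ℤR.solve-∀

    weighted-zeros : ∀ {b} → Weighted ω b (zeros {suc k})
    weighted-zeros {b} = weigh ℤ.≤-refl (subst (λ z → 0ℤ ℤ.≤ + b ℤ.+ z)
      (sym (trans (cong (+ ω ℤ.*_) (total-zeros k)) (ℤ.*-zeroʳ (+ ω)))) (ℤ.+≤+ ℕ.z≤n))

    w-* : ∀ {b b′ φ ψ} → WSpan b φ → WSpan b′ ψ → WSpan (b ℕ.+ b′) (λ y → φ y * ψ y)
    w-* = span-* _⊞_ χᵥ-⊞ weighted-⊞

    χᵥ-zeros : ∀ (y : Y) → χᵥ zeros y ≡ 1ℚ
    χᵥ-zeros y = trans (cong qp (dot-zeros y)) qp-0

    w-const : ∀ κ {b} → WSpan b (λ _ → κ)
    w-const κ = span-const _⊞_ χᵥ-⊞ zeros χᵥ-zeros κ weighted-zeros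

    record Affine (b : ℕ) (g : Y → ℤ) : Set where
      constructor affine
      field
        offset : ℤ
        index  : Y
        small  : Weighted ω b index
        value  : ∀ y → g y ≡ offset ℤ.+ dot index y

    affine-+ : ∀ {b b′ g h} → Affine b g → Affine b′ h → Affine (b ℕ.+ b′) (λ y → g y ℤ.+ h y)
    affine-+ (affine a i p e) (affine a′ i′ p′ e′) = affine (a ℤ.+ a′) (i ⊞ i′) (weighted-⊞ i i′ p p′) λ y →
      trans (cong₂ ℤ._+_ (e y) (e′ y)) (trans (lem a a′ (dot i y) (dot i′ y)) (cong (λ z → a ℤ.+ a′ ℤ.+ z) (sym (dot-⊞ i i′ y))))
      where
      lem : ∀ a b c d → a ℤ.+ c ℤ.+ (b ℤ.+ d) ≡ a ℤ.+ b ℤ.+ (c ℤ.+ d)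
      lem = ℤR.solve-∀

    affine-const : ∀ a {b} → Affine b (λ _ → a)
    affine-const a = affine a zeros weighted-zeros λ y → sym (trans (cong (λ z → a ℤ.+ z) (dot-zeros y)) (ℤ.+-identityʳ a))

    affine-ext : ∀ {b g h} → (∀ y → g y ≡ h y) → Affine b h → Affine b g
    affine-ext eq (affine a i p e) = affine a i p λ y → trans (eq y) (e y)

    w-qp : ∀ {b g} → Affine b g → WSpan b (qp ∘ g)
    w-qp (affine a i p e) = span-ext (λ y → trans (cong qp (e y)) (qp-+ a (dot i y))) (span-monomial (qp a) i p)

    w-θ : ∀ {b g} → Affine b g → WSpan b (θ ∘ g)
    w-θ p = span-- (w-const 1ℚ) (w-qp p)

    w-∏< : ∀ {b} (φ : ℕ → Y → ℚ) → (∀ l → WSpan b (φ l)) → ∀ m → WSpan (m ℕ.* b) (λ y → ∏< m (λ l → φ l y))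
    w-∏< φ h zero    = w-const 1ℚ
    w-∏< φ h (suc m) = w-* (h 0) (w-∏< (φ ∘ suc) (h ∘ suc) m)

    w-cast : ∀ {b b′ φ} → b ≡ b′ → WSpan b φ → WSpan b′ φ
    w-cast refl s = s

    affine-cast : ∀ {b b′ g} → b ≡ b′ → Affine b g → Affine b′ g
    affine-cast refl s = s

    w-qpoch : ∀ {b g} → Affine b g → ∀ m → WSpan (m ℕ.* b) (λ y → qpoch (g y) m)
    w-qpoch {b} p = w-∏< _ (λ l → w-θ (affine-cast (ℕ.+-identityʳ b) (affine-+ p (affine-const (+ l) {0}))))

    w-geo : ∀ {g} T → Affine 0 g → WSpan 0 (λ y → geo T (qp (g y)))
    w-geo T (affine a i p e) = span-ext (λ y → cong (geo T) (trans (cong qp (e y)) (qp-+ a (dot i y))))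
      (span-geo _⊞_ χᵥ-⊞ zeros χᵥ-zeros (λ _ → Weighted ω 0) i (λ _ → weighted-zeros) (λ _ j q → weighted-⊞ i j p q) (qp a) T)

    Coordinate : (Y → ℤ) → Set
    Coordinate ℓ = Σ (Fin k) λ i → ∀ y → ℓ y ≡ Vec.lookup (Vec.tail y) i

    -- In `u_i q^(β x)` the degree `β` in `q^x` is paid for by the degree `ω` of `u_i`. Hence the
    -- geometric factors of the kernel do not raise the bound `b`, however far they are expanded.
    affine-coordinate : ∀ {ℓ} → Coordinate ℓ → ∀ β → β ℕ.≤ ω → Affine 0 (λ y → ℓ y ℤ.+ + β ℤ.* Vec.head y)
    affine-coordinate {ℓ} (i , e) β β≤ω = affine 0ℤ (+ β ∷ basis i)
      (weigh (ℤ.+≤+ ℕ.z≤n) (ℤ.≤-trans (ℤ.+≤+ β≤ω) (ℤ.≤-reflexive (sym (trans (ℤ.+-identityˡ _) (trans (cong (+ ω ℤ.*_) (total-basis i)) (ℤ.*-identityʳ (+ ω))))))))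
      λ { (x ∷ u) → trans (cong (λ z → z ℤ.+ + β ℤ.* x) (trans (e (x ∷ u)) (sym (dot-basis i u)))) (lem (dot (basis i) u) (+ β ℤ.* x)) }
      where
      lem : ∀ a b → a ℤ.+ b ≡ 0ℤ ℤ.+ (b ℤ.+ a)
      lem = ℤR.solve-∀

    affine-coordinate₀ : ∀ {ℓ} → Coordinate ℓ → Affine 0 ℓ
    affine-coordinate₀ {ℓ} p = affine-ext (λ { (x ∷ u) → sym (trans (cong (λ z → ℓ (x ∷ u) ℤ.+ z) (ℤ.*-zeroˡ x)) (ℤ.+-identityʳ _)) })
      (affine-coordinate p 0 ℕ.z≤n)

    -- The inverse of a variable has degree `-ω`, which has to be compensated by `b`; this is the
    -- only source of a positive bound.
    affine-neg : ∀ {ℓ} → Coordinate ℓ → Affine ω (λ y → ℤ.- ℓ y)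
    affine-neg {ℓ} (i , e) = affine 0ℤ (0ℤ ∷ neg (basis i))
      (weigh ℤ.≤-refl (ℤ.≤-reflexive (sym (trans (cong (λ z → + ω ℤ.+ + ω ℤ.* z) (trans (total-neg (basis i)) (cong ℤ.-_ (total-basis i)))) (lem′ (+ ω))))))
      λ { (x ∷ u) → trans (cong ℤ.-_ (trans (e (x ∷ u)) (sym (dot-basis i u)))) (trans (sym (dot-neg (basis i) u)) (lem x (dot (neg (basis i)) u))) }
      where
      lem : ∀ x a → a ≡ 0ℤ ℤ.+ (0ℤ ℤ.* x ℤ.+ a)
      lem = ℤR.solve-∀
      lem′ : ∀ o → o ℤ.+ o ℤ.* (ℤ.- 1ℤ) ≡ 0ℤ
      lem′ = ℤR.solve-∀

    affine-diff : ∀ {ℓ ℓ′} → Coordinate ℓ → Coordinate ℓ′ → Affine 0 (λ y → ℓ y ℤ.- ℓ′ y)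
    affine-diff {ℓ} {ℓ′} (i , e) (j , e′) = affine 0ℤ (0ℤ ∷ basis i ⊞ neg (basis j))
      (weigh ℤ.≤-refl (ℤ.≤-reflexive (sym (trans (cong (λ z → 0ℤ ℤ.+ + ω ℤ.* z)
         (trans (total-⊞ (basis i) (neg (basis j))) (cong₂ ℤ._+_ (total-basis i) (trans (total-neg (basis j)) (cong ℤ.-_ (total-basis j)))))) (lem′ (+ ω))))))
      λ { (x ∷ u) → trans (cong₂ ℤ._-_ (trans (e (x ∷ u)) (sym (dot-basis i u))) (trans (e′ (x ∷ u)) (sym (dot-basis j u))))
            (trans (lem x (dot (basis i) u) (dot (basis j) u))
              (cong (λ z → 0ℤ ℤ.+ (0ℤ ℤ.* x ℤ.+ z)) (sym (trans (dot-⊞ (basis i) (neg (basis j)) u) (cong (λ z → dot (basis i) u ℤ.+ z) (dot-neg (basis j) u)))))) }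
      where
      lem : ∀ x a b → a ℤ.- b ≡ 0ℤ ℤ.+ (0ℤ ℤ.* x ℤ.+ (a ℤ.+ ℤ.- b))
      lem = ℤR.solve-∀
      lem′ : ∀ o → 0ℤ ℤ.+ o ℤ.* (1ℤ ℤ.+ ℤ.- 1ℤ) ≡ 0ℤ
      lem′ = ℤR.solve-∀

    w-∏ : ∀ {X : Set} {Q : X → Set} (φ : X → Y → ℚ) → (∀ a → Q a → WSpan 0 (φ a)) → ∀ as → All Q as → WSpan 0 (λ y → ∏ (λ a → φ a y) as)
    w-∏ φ h []       []       = w-const 1ℚ
    w-∏ φ h (a ∷ as) (q ∷ qs) = w-* (h a q) (w-∏ φ h as qs)

    w-∏ᵥ : ∀ {b l} (φ : ℤ → Y → ℚ) → (∀ ℓ → Coordinate ℓ → WSpan b (λ y → φ (ℓ y) y)) → (ℓs : Vec (Y → ℤ) l) → VAll.All Coordinate ℓs →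
           WSpan (l ℕ.* b) (λ y → ∏ᵥ (λ u → φ u y) (Vec.map (λ ℓ → ℓ y) ℓs))
    w-∏ᵥ φ h []       []       = w-const 1ℚ
    w-∏ᵥ φ h (ℓ ∷ ℓs) (p ∷ ps) = w-* (h ℓ p) (w-∏ᵥ φ h ℓs ps)

    w-pair : ∀ {ℓ ℓ′} → Coordinate ℓ → Coordinate ℓ′ → WSpan 0 (λ y → pair (ℓ y) (ℓ′ y))
    w-pair p p′ = w-cast (cong₂ ℕ._+_ (ℕ.*-zeroʳ c) (ℕ.*-zeroʳ c))
      (w-* (w-qpoch (affine-diff p p′) c) (w-qpoch (affine-+ (affine-const 1ℤ {0}) (affine-diff p′ p)) c))

    w-pairs : ∀ {l} (ℓs : Vec (Y → ℤ) l) → VAll.All Coordinate ℓs → WSpan 0 (λ y → pairs (Vec.map (λ ℓ → ℓ y) ℓs))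
    w-pairs []               []       = w-const 1ℚ
    w-pairs {suc l} (ℓ ∷ ℓs) (p ∷ ps) = w-* (w-cast (ℕ.*-zeroʳ l) (w-∏ᵥ (λ u y → pair (ℓ y) u) (λ ℓ′ p′ → w-pair p p′) ℓs ps)) (w-pairs ℓs ps)

    w-factor₁ : ∀ A {ℓ} → Coordinate ℓ → WSpan (A ℕ.* ω) (λ y → factor₁ A (ℓ y))
    w-factor₁ A p = w-cast (trans (cong (A ℕ.* ω ℕ.+_) (ℕ.*-zeroʳ c′)) (ℕ.+-identityʳ (A ℕ.* ω)))
      (w-* (w-qpoch (affine-neg p) A) (w-qpoch (affine-+ (affine-const 1ℤ {0}) (affine-coordinate₀ p)) c′))

  at : ℤ → List (ℤ × ℕ) → List ℤ
  at x = map (λ p → proj₁ p ℤ.+ + proj₂ p ℤ.* x)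

  -- The kernel with its j-th parameter equal to q^(η_j + β_j x).
  family : ∀ {k} → ℕ → ℕ → List (ℤ × ℕ) → Vec ℤ (suc k) → ℚ
  family A T ys (x ∷ v) = integrand A v * ∏ᵥ (Γ T (at x ys)) v

  Γ-∏ : ∀ T y u → Γ T y u ≡ ∏ (λ η → ∏< c (λ l → geo T (qp (u ℤ.+ (η ℤ.+ + l))))) y
  Γ-∏ T y u = trans (∏-concatMap (λ g → geo T (qp (u ℤ.+ g))) (λ η → applyUpTo (λ l → η ℤ.+ + l) c) y)
    (∏-cong (λ η → ∏-applyUpTo (λ g → geo T (qp (u ℤ.+ g))) (λ l → η ℤ.+ + l) c) y)

  -- Ratios of variables have degree 0 and positive powers cost nothing, so the bound is that of the
  -- `k A` factors of the symbols `(1/u_i)_A`, at `ω` each. For terms free of `u` it bounds the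
  -- degree in `q^x` itself.
  family-span : ∀ ω {k} A T ys → All (λ p → proj₂ p ℕ.≤ ω) ys →
                Span χᵥ (Weighted ω (k ℕ.* (A ℕ.* ω))) (family {k} A T ys)
  family-span ω {k} A T ys ≤ω = w-cast ω (trans (cong₂ ℕ._+_ (ℕ.+-identityʳ _) (ℕ.*-zeroʳ k)) (ℕ.+-identityʳ _))
    (span-ext eq (w-* ω (w-* ω (w-∏ᵥ ω (λ u _ → factor₁ A u) (λ ℓ → w-factor₁ ω A) coords all) (w-pairs ω coords all))
      (w-∏ᵥ ω (λ u y → ∏ (λ p → ∏< c (λ l → geo T (qp (u ℤ.+ (proj₁ p ℤ.+ + proj₂ p ℤ.* Vec.head y ℤ.+ + l))))) ys)
        (λ ℓ q → w-∏ ω (λ p y → ∏< c (λ l → geo T (qp (ℓ y ℤ.+ (proj₁ p ℤ.+ + proj₂ p ℤ.* Vec.head y ℤ.+ + l)))))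
           (λ p β≤ω → w-cast ω (ℕ.*-zeroʳ c) (w-∏< ω (λ l y → geo T (qp (ℓ y ℤ.+ (proj₁ p ℤ.+ + proj₂ p ℤ.* Vec.head y ℤ.+ + l)))) (λ l →
              w-geo ω T (affine-ext ω (λ y → lem (ℓ y) (proj₁ p) (+ proj₂ p ℤ.* Vec.head y) (+ l))
                (affine-+ ω (affine-const ω (proj₁ p ℤ.+ + l) {0}) (affine-coordinate ω q (proj₂ p) β≤ω)))) c)) ys ≤ω)
        coords all)))
    where
    lem : ∀ u η b l → u ℤ.+ (η ℤ.+ b ℤ.+ l) ≡ η ℤ.+ l ℤ.+ (u ℤ.+ b)
    lem = ℤR.solve-∀
    coords : Vec (Vec ℤ (suc k) → ℤ) k
    coords = Vec.map (λ i y → Vec.lookup (Vec.tail y) i) (Vec.allFin k)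
    all : VAll.All (Coordinate ω) coords
    all = go (Vec.allFin k)
      where
      go : ∀ {l} (is : Vec (Fin k) l) → VAll.All (Coordinate ω) (Vec.map (λ i y → Vec.lookup (Vec.tail y) i) is)
      go []       = []
      go (i ∷ is) = (i , λ _ → refl) ∷ go is
    eval : ∀ x v → Vec.map (λ ℓ → ℓ (x ∷ v)) coords ≡ v
    eval x v = trans (sym (map-∘ (λ ℓ → ℓ (x ∷ v)) (λ i y → Vec.lookup (Vec.tail y) i) (Vec.allFin k))) (map-lookup-allFin v)
    eq : ∀ y → family A T ys y ≡ ∏ᵥ (factor₁ A) (Vec.map (λ ℓ → ℓ y) coords) * pairs (Vec.map (λ ℓ → ℓ y) coords) *
      ∏ᵥ (λ u → ∏ (λ p → ∏< c (λ l → geo T (qp (u ℤ.+ (proj₁ p ℤ.+ + proj₂ p ℤ.* Vec.head y ℤ.+ + l))))) ys) (Vec.map (λ ℓ → ℓ y) coords)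
    eq (x ∷ v) rewrite eval x v = cong (integrand A v *_) (∏ᵥ-cong (λ u →
      trans (Γ-∏ T (at x ys) u) (∏-map (λ η → ∏< c (λ l → geo T (qp (u ℤ.+ (η ℤ.+ + l))))) (λ p → proj₁ p ℤ.+ + proj₂ p ℤ.* x) ys)) v)

  family-parametric : ∀ ω {k} A T ys → All (λ p → proj₂ p ℕ.≤ ω) ys → Parametric (Weighted ω (k ℕ.* (A ℕ.* ω))) (family {k} A T ys)
  family-parametric ω A T ys ≤ω = parametric (family-span ω A T ys ≤ω)

-- Vanishing of the constant term for spaced parameters, and polynomials with known roots.

module Vanishing (C : Character) (c′ : ℕ) where

  open ℚ₀ using (_+_; _*_; _-_; -_)
  open Character C
  open ConstantTerm₁ C
  open ConstantTerm C
  open Interpolation C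
  open Kernel C c′
  open Families C c′ hiding (total)
  import Data.Vec.Relation.Unary.All as VAll
  import Data.Vec.Relation.Unary.All.Properties as VAll⁺
  open VAll using (_∷_; [])
  open import Data.List.Properties using (length-map; length-++; length-applyUpTo)
  import Data.List.Relation.Unary.All.Properties as All
  import Data.List.Relation.Unary.AllPairs.Properties as AllPairs
  open import Data.Vec.Properties using (length-toList)

  -- It is applied with `D = A + c`, which separates both the `c` poles and the `A` roots belonging
  -- to different parameters.
  Spaced : ℕ → List ℤ → Set
  Spaced D = AllPairs (λ a b → a ℤ.+ + D ℤ.≤ b)

  grid-all : ∀ {P Q : ℤ → Set} m → (∀ η → Q η → ∀ l → l ℕ.< m → P (η ℤ.+ + l)) → ∀ y → All Q y → All P (grid y m)
  grid-all m f []      []       = []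
  grid-all m f (η ∷ y) (q ∷ qs) = All.++⁺ (All.applyUpTo⁺₁ _ m (λ {l} l<m → f η q l l<m)) (grid-all m f y qs)

  grid-distinct : ∀ {D m} → m ℕ.≤ D → ∀ y → Spaced D y → AllPairs _≢_ (grid y m)
  grid-distinct         m≤D []      []       = []
  grid-distinct {D} {m} m≤D (η ∷ y) (p ∷ ps) = AllPairs.++⁺
    (AllPairs.applyUpTo⁺₁ _ m (λ i<j _ eq → ℕ.<⇒≢ i<j (ℤ.+-injective (∸-cancel η eq))))
    (grid-distinct m≤D y ps)
    (All.applyUpTo⁺₁ _ m (λ {i} i<m → grid-all m (λ η′ le l _ eq →
       ℤ.<-irrefl eq (ℤ.<-≤-trans (ℤ.+-monoʳ-< η (ℤ.+<+ (ℕ.<-≤-trans i<m m≤D))) (ℤ.≤-trans le (ℤ.i≤i+j η′ (+ l))))) y p))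
    where
    ∸-cancel : ∀ η {i j} → η ℤ.+ i ≡ η ℤ.+ j → i ≡ j
    ∸-cancel η {i} {j} eq = trans (lem η i) (trans (cong (λ z → ℤ.- η ℤ.+ z) eq) (sym (lem η j)))
      where
      lem : ∀ η i → i ≡ ℤ.- η ℤ.+ (η ℤ.+ i)
      lem = ℤR.solve-∀

  grid-length : ∀ y m → length (grid y m) ≡ length y ℕ.* m
  grid-length []      m = refl
  grid-length (η ∷ y) m = trans (length-++ (applyUpTo (λ l → η ℤ.+ + l) m)) (cong₂ ℕ._+_ (length-applyUpTo (λ l → η ℤ.+ + l) m) (grid-length y m))

  InGrid : ∀ {k} → Vec ℤ k → ℕ → ℤ → Set
  InGrid {k} y m g = Σ (Fin k) λ j → Σ ℕ λ l → l ℕ.< m × g ≡ Vec.lookup y j ℤ.+ + l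

  toList-all : ∀ {k} (y : Vec ℤ k) → All (λ η → Σ (Fin k) λ j → η ≡ Vec.lookup y j) (Vec.toList y)
  toList-all []      = []
  toList-all (η ∷ y) = (Fin.zero , refl) ∷ All.map (λ (j , e) → Fin.suc j , e) (toList-all y)

  grid-index : ∀ {k} (y : Vec ℤ k) m → All (InGrid y m) (grid (Vec.toList y) m)
  grid-index y m = grid-all m (λ { η (j , refl) l l<m → j , l , l<m , refl }) (Vec.toList y) (toList-all y)

  nodes : List ℤ → List ℤ
  nodes y = map (ℤ.-_) (grid y c)

  Γ-nodes : ∀ T y u → Γ T y u ≡ geos T (nodes y) u
  Γ-nodes T y u = sym (trans (∏-map (λ ν → geo T (qp (u ℤ.- ν))) (ℤ.-_) (grid y c))
    (∏-cong (λ g → cong (λ z → geo T (qp (u ℤ.+ z))) (ℤ.neg-involutive g)) (grid y c)))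

  nodes-length : ∀ {k} (y : Vec ℤ k) → length (nodes (Vec.toList y)) ≡ k ℕ.* c
  nodes-length y = trans (length-map (ℤ.-_) (grid (Vec.toList y) c)) (trans (grid-length (Vec.toList y) c) (cong (ℕ._* c) (length-toList y)))

  nodes-distinct : ∀ {D} → c ℕ.≤ D → ∀ y → Spaced D y → AllPairs _≢_ (nodes y)
  nodes-distinct c≤D y sp = AllPairs.map⁺ (AllPairs.map (λ ne eq → ne (ℤ.neg-injective eq)) (grid-distinct c≤D y sp))

  InNodes : ∀ {k} → Vec ℤ k → ℤ → Set
  InNodes {k} y u = Σ (Fin k) λ j → Σ ℕ λ l → l ℕ.< c × u ℤ.+ + l ≡ ℤ.- Vec.lookup y j

  nodes-index : ∀ {k} (y : Vec ℤ k) → All (InNodes y) (nodes (Vec.toList y))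
  nodes-index y = All.map⁺ (All.map (λ { (j , l , l<c , refl) → j , l , l<c , lem (Vec.lookup y j) (+ l) }) (grid-index y c))
    where
    lem : ∀ a l → ℤ.- (a ℤ.+ l) ℤ.+ l ≡ ℤ.- a
    lem = ℤR.solve-∀

  kernel : ∀ {k} → ℕ → ℕ → List ℤ → Vec ℤ k → ℚ
  kernel A T y v = integrand A v * ∏ᵥ (Γ T y) v

  between : ∀ {u l l′} → l′ ℕ.≤ c′ → u ℤ.+ + l′ ≡ + l → ℤ.- + c′ ℤ.≤ u
  between {u} {l} {l′} l′≤c′ eq = ℤ.≤-trans (ℤ.neg-mono-≤ (ℤ.+≤+ l′≤c′))
    (ℤ.≤-trans (ℤ.i≤j+i (ℤ.- + l′) (+ l)) (ℤ.≤-reflexive (trans (cong (ℤ._- + l′) (sym eq)) (lem u (+ l′)))))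
    where
    lem : ∀ u l → u ℤ.+ l ℤ.- l ≡ u
    lem = ℤR.solve-∀

  -- Two variables at nodes of the same parameter make the pair product vanish. Otherwise each parameter
  -- is used by exactly one variable, and the variable at a node of q^(-l) kills its own factor.
  kernel-zero : ∀ A {k} (y : Vec ℤ k) (j : Fin k) l → l ℕ.< A → Vec.lookup y j ≡ ℤ.- + l →
                ∀ (v : Vec ℤ k) → VAll.All (InNodes y) v → integrand A v ≡ 0ℚ
  kernel-zero A {suc k} y j l l<A yj v inN with Fin.any? (λ i → f i Fin.≟ j)
    where
    f : Fin (suc k) → Fin (suc k)
    f i = proj₁ (VAll⁺.lookup⁺ inN i)
  ... | yes (i , fi≡j) = let _ , l′ , l′<c , eq = VAll⁺.lookup⁺ inN i
                             eq′ = trans eq (trans (cong (λ z → ℤ.- Vec.lookup y z) fi≡j) (trans (cong ℤ.-_ yj) (ℤ.neg-involutive (+ l)))) in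
    *-zeroˡ-≡ (∏ᵥ-zero (factor₁ A) v i (factor₁-zero A (Vec.lookup v i) (between (ℕ.≤-pred l′<c) eq′)
      (ℤ.≤-<-trans (ℤ.≤-trans (ℤ.i≤i+j (Vec.lookup v i) (+ l′)) (ℤ.≤-reflexive eq′)) (ℤ.+<+ l<A))))
  kernel-zero A {suc k} y j l l<A yj v inN | no avoid = *-zeroʳ-≡ {∏ᵥ (factor₁ A) v} collide
    where
    f : Fin (suc k) → Fin (suc k)
    f i = proj₁ (VAll⁺.lookup⁺ inN i)
    g : Fin (suc k) → Fin k
    g i = Fin.punchOut {i = j} {j = f i} (λ eq → avoid (i , sym eq))
    collide : pairs v ≡ 0ℚ
    collide with Fin.pigeonhole (ℕ.n<1+n k) g
    ... | i , i′ , i<i′ , eq with Fin.punchOut-injective (λ eq → avoid (i , sym eq)) (λ eq → avoid (i′ , sym eq)) eq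
    ...   | eq′ = let _ , a , a<c , ea = VAll⁺.lookup⁺ inN i
                      _ , b , b<c , eb = VAll⁺.lookup⁺ inN i′ in
      pairs-zero v i i′ i<i′ (pair-zero (Vec.lookup v i) (Vec.lookup v i′) a b a<c (ℕ.<⇒≤ b<c)
        (trans ea (trans (cong (λ z → ℤ.- Vec.lookup y z) eq′) (sym eb))))

  interpolate-kernel : ∀ A T k → A ℕ.+ k ℕ.* c ℕ.≤ T → (y : Vec ℤ k) → AllPairs _≢_ (nodes (Vec.toList y)) →
    Σ (List (ℤ × ℚ)) λ ws → (map proj₁ ws ≡ nodes (Vec.toList y)) × Interpolates (A ℕ.+ k ℕ.* c) T (nodes (Vec.toList y)) ws ×
      HasCT k (kernel A T (Vec.toList y)) (weightedₖ ws k (integrand A))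
  interpolate-kernel A T k T≥ y ds with interpolate (A ℕ.+ k ℕ.* c) T T≥ (nodes (Vec.toList y)) ds
  ... | ws , eq , interp = ws , eq , interp ,
    ct-ext (λ v → cong (integrand A v *_) (∏ᵥ-cong (Γ-nodes T (Vec.toList y)) v))
      (interpolateₖ {A ℕ.+ k ℕ.* c} {T} {nodes (Vec.toList y)} {ws} interp k (integrand A)
        (subst (λ N → EachLaurent (A ℕ.+ k ℕ.* c) N k (integrand A)) (sym (nodes-length y)) (each-integrand A k)))

  kernel-vanish : ∀ A T k → A ℕ.+ k ℕ.* c ℕ.≤ T → (y : Vec ℤ k) → Spaced (A ℕ.+ c) (Vec.toList y) →
                  ∀ j l → l ℕ.< A → Vec.lookup y j ≡ ℤ.- + l → HasCT k (kernel A T (Vec.toList y)) 0ℚ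
  kernel-vanish A T k T≥ y sp j l l<A yj with interpolate-kernel A T k T≥ y (nodes-distinct (ℕ.m≤n+m c A) (Vec.toList y) sp)
  ... | ws , eq , _ , ct = subst (HasCT k _)
    (weightedₖ-vanish {S = InNodes y} (All.map⁻ (subst (All (InNodes y)) (sym eq) (nodes-index y))) k (integrand A)
      (kernel-zero A y j l l<A yj)) ct

  -- The roots are divided out one at a time. The polynomial is normalised by its constant term
  -- instead of its leading coefficient, because the factors `1 - q^(x+ρ)` have constant term 1.
  product-of-roots : ∀ ρs p → AllPairs _≢_ ρs → Span χ₁ (Bounded 0 (suc (length ρs))) p →
    All (λ ρ → p (ℤ.- ρ) ≡ 0ℚ) ρs → ∀ {κ} → HasCT₁ p κ → ∀ x → p x ≡ κ * ∏ (λ ρ → θ (x ℤ.+ ρ)) ρs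
  product-of-roots [] p [] s [] {κ} ct x = trans (const s x) (trans (ct₁-unique (ct₁-ext (const s) (ct₁-const (p 0ℤ))) ct) (sym (ℚ.*-identityʳ κ)))
    where
    const : ∀ {φ} → Span χ₁ (Bounded 0 1) φ → ∀ x → φ x ≡ φ 0ℤ
    const (nil z) x = trans (z x) (sym (z 0ℤ))
    const (term {ψ = ψ} α (+ zero)  _ s e) x = trans (e x) (trans (cong₂ (λ a b → α * a + b) (trans (χ₁-0 x) (sym (χ₁-0 0ℤ))) (const s x)) (sym (e 0ℤ)))
    const (term α (+ suc n) (_ , ℤ.+<+ (ℕ.s≤s ())) s e) x
  product-of-roots (ρ ∷ ρs) p (n ∷ ds) s (z ∷ zs) {κ} ct x with quotient {lo = 0} {g = p} (ℤ.- ρ) s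
  ... | h , hs , eq = trans (pθ x) (trans (cong (θ (x ℤ.+ ρ) *_) (product-of-roots ρs h ds hs (roots ρs n zs) ct-h x))
      (lem (θ (x ℤ.+ ρ)) κ (∏ (λ ρ → θ (x ℤ.+ ρ)) ρs)))
    where
    lem : ∀ a b c → a * (b * c) ≡ b * (a * c)
    lem = solve-∀ ℚring
    pθ : ∀ u → p u ≡ θ (u ℤ.+ ρ) * h u
    pθ u = trans (eq u) (trans (cong₂ (λ a b → a + θ (u ℤ.+ b) * h u) z (ℤ.neg-involutive ρ)) (ℚ.+-identityˡ _))
    roots : ∀ ρs → All (ρ ≢_) ρs → All (λ ρ → p (ℤ.- ρ) ≡ 0ℚ) ρs → All (λ ρ → h (ℤ.- ρ) ≡ 0ℚ) ρs
    roots []        []       []       = []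
    roots (ρ′ ∷ ρs) (n ∷ ns) (z ∷ zs) = cancelˡ (θ (ℤ.- ρ′ ℤ.+ ρ))
        (θ≢0 (ℤ.- ρ′ ℤ.+ ρ) (λ e → n (ℤ.i-j≡0⇒i≡j ρ ρ′ (trans (ℤ.+-comm ρ (ℤ.- ρ′)) e))))
        (trans (sym (pθ (ℤ.- ρ′))) (trans z (sym (ℚ.*-zeroʳ (θ (ℤ.- ρ′ ℤ.+ ρ)))))) ∷ roots ρs ns zs
    -- From `h = p + q^(x+ρ) h`, where the last term has only positive exponents.
    ct-h : HasCT₁ h κ
    ct-h = subst (HasCT₁ h) (ℚ.+-identityʳ κ) (ct₁-ext (λ u → trans (lem₁ (qp (u ℤ.+ ρ)) (h u)) (cong (_+ qp (u ℤ.+ ρ) * h u) (sym (pθ u))))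
      (ct₁-+ ct (ct₁-zero (span-* ℤ._+_ χ₁-+ {P = _≡ 1ℤ} positive
        (span-ext (λ u → trans (cong qp (lem₂ u ρ)) (qp-+ ρ (1ℤ ℤ.* u))) (span-monomial (qp ρ) 1ℤ refl)) hs))))
      where
      lem₁ : ∀ a h → h ≡ (1ℚ - a) * h + a * h
      lem₁ = solve-∀ ℚring
      lem₂ : ∀ u ρ → u ℤ.+ ρ ≡ ρ ℤ.+ 1ℤ ℤ.* u
      lem₂ = ℤR.solve-∀
      positive : ∀ i j → i ≡ 1ℤ → Bounded 0 (suc (length ρs)) j → i ℤ.+ j ≢ 0ℤ
      positive _ (+ j) refl _ ()

-- The product formula, from spaced parameters to arbitrary ones.

module ProductFormula (C : Character) (c′ : ℕ) where

  open ℚ₀ using (_+_; _*_; _-_; -_)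
  open Character C
  open ConstantTerm₁ C
  open ConstantTerm C
  open Interpolation C
  open Kernel C c′
  open Families C c′ hiding (total)
  open Vanishing C c′
  open import Data.List.Properties using (length-map; map-++; map-cong; map-id; length-++; length-replicate)
  import Data.List as List
  import Data.List.Relation.Unary.All.Properties as All
  import Data.List.Relation.Unary.AllPairs.Properties as AllPairs
  open import Data.Vec.Properties using (toList∘fromList; lookup-map; toList-map)

  fixed : List ℤ → List (ℤ × ℕ)
  fixed = map (_, 0)

  moving : List ℤ → List (ℤ × ℕ)
  moving = map (_, 1)

  at-++ : ∀ x ps qs → at x (ps ++ qs) ≡ at x ps ++ at x qs
  at-++ x = map-++ _

  at-fixed : ∀ x y → at x (fixed y) ≡ y
  at-fixed x []      = refl
  at-fixed x (η ∷ y) = cong₂ _∷_ (trans (cong (λ z → η ℤ.+ z) (ℤ.*-zeroˡ x)) (ℤ.+-identityʳ η)) (at-fixed x y)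

  at-moving : ∀ x y → at x (moving y) ≡ map (ℤ._+ x) y
  at-moving x []      = refl
  at-moving x (η ∷ y) = cong₂ _∷_ (cong (λ z → η ℤ.+ z) (ℤ.*-identityˡ x)) (at-moving x y)

  Γ-++ : ∀ T y y′ u → Γ T (y ++ y′) u ≡ Γ T y u * Γ T y′ u
  Γ-++ T y y′ u = trans (Γ-∏ T (y ++ y′) u) (trans (∏-++ _ y y′) (sym (cong₂ _*_ (Γ-∏ T y u) (Γ-∏ T y′ u))))

  unitary-ext : ∀ {φ ψ} → (∀ x → φ x ≡ ψ x) → Unitary ψ → Unitary φ
  unitary-ext eq (unitary s) = unitary (span-ext (λ x → cong (_- 1ℚ) (eq x)) s)

  unitary-∏< : ∀ (φ : ℕ → ℤ → ℚ) → (∀ l → Unitary (φ l)) → ∀ m → Unitary (λ x → ∏< m (λ l → φ l x))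
  unitary-∏< φ h zero    = unitary-1
  unitary-∏< φ h (suc m) = unitary-* (h 0) (unitary-∏< (φ ∘ suc) (h ∘ suc) m)

  unitary-∏ᵥ : ∀ {k} (φ : ℤ → ℤ → ℚ) → (∀ u → Unitary (φ u)) → (v : Vec ℤ k) → Unitary (λ x → ∏ᵥ (λ u → φ u x) v)
  unitary-∏ᵥ φ h []      = unitary-1
  unitary-∏ᵥ φ h (u ∷ v) = unitary-* (h u) (unitary-∏ᵥ φ h v)

  unitary-Γ : ∀ T y u → Unitary (λ x → Γ T (map (ℤ._+ x) y) u)
  unitary-Γ T y u = unitary-ext (λ x → trans (Γ-∏ T (map (ℤ._+ x) y) u) (∏-map _ (ℤ._+ x) y))
    (unitary-∏ (λ η x → ∏< c (λ l → geo T (qp (u ℤ.+ (η ℤ.+ x ℤ.+ + l)))))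
      (λ η → unitary-∏< (λ l x → geo T (qp (u ℤ.+ (η ℤ.+ x ℤ.+ + l)))) (λ l →
        unitary-ext (λ x → cong (λ z → geo T (qp z)) (lem u η x (+ l))) (unitary-geo T (ℤ.- (u ℤ.+ η ℤ.+ + l)))) c) y)
    where
    lem : ∀ u η x l → u ℤ.+ (η ℤ.+ x ℤ.+ l) ≡ x ℤ.- (ℤ.- (u ℤ.+ η ℤ.+ l))
    lem = ℤR.solve-∀

  unitary-qpoch : ∀ η A → Unitary (λ x → qpoch (η ℤ.+ x) A)
  unitary-qpoch η A = unitary-∏< (λ l x → θ (η ℤ.+ x ℤ.+ + l)) (λ l → unitary (span-ext (λ x →
      trans (cong (λ z → 1ℚ - z - 1ℚ) (trans (cong qp (lem η x (+ l))) (qp-+ (η ℤ.+ + l) (1ℤ ℤ.* x)))) (lem′ (qp (η ℤ.+ + l)) (χ₁ 1ℤ x)))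
    (span-monomial (- 1ℚ * qp (η ℤ.+ + l)) 1ℤ (ℤ.+<+ (ℕ.s≤s ℕ.z≤n))))) A
    where
    lem : ∀ η x l → η ℤ.+ x ℤ.+ l ≡ η ℤ.+ l ℤ.+ 1ℤ ℤ.* x
    lem = ℤR.solve-∀
    lem′ : ∀ a b → 1ℚ - a * b - 1ℚ ≡ - 1ℚ * a * b
    lem′ = solve-∀ ℚring

  small-weights : ∀ y y′ → All (λ p → proj₂ p ℕ.≤ 1) (fixed y ++ moving y′)
  small-weights y y′ = All.++⁺ (All.map⁺ (All.universal (λ _ → ℕ.z≤n) y)) (All.map⁺ (All.universal (λ _ → ℕ.≤-refl) y′))

  -- Letting the moving parameters q^(η+x) tend to 0, that is, taking the constant term in x.
  family-limit : ∀ {k} A T y y′ {κ} → HasCT k (kernel A T y) κ →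
    HasCT₁ (Parametric.value (family-parametric 1 {k} A T (fixed y ++ moving y′) (small-weights y y′))) κ
  -- Both orders of elimination are compared. Eliminating `x` first leaves the kernel of the fixed
  -- parameters, as the moving geometric factors have constant term 1 in `q^x`.
  family-limit {k} A T y y′ {κ} ct = subst (HasCT₁ R.value) (ct-unique R.total-ct (ct-∷ (kernel A T y) limit ct)) R.value-tot
    where
    module R = Parametric (family-parametric 1 {k} A T (fixed y ++ moving y′) (small-weights y y′))
    limit : ∀ v → HasCT₁ (λ x → family A T (fixed y ++ moving y′) (x ∷ v)) (kernel A T y v)
    limit v = subst (HasCT₁ _) (ℚ.*-identityʳ (kernel A T y v)) (ct₁-ext (λ x → trans
        (cong (integrand A v *_) (trans (∏ᵥ-cong (λ u → trans (cong (λ z → Γ T z u) (trans (at-++ x (fixed y) (moving y′)) (cong₂ _++_ (at-fixed x y) (at-moving x y′))))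
           (Γ-++ T y (map (ℤ._+ x) y′) u)) v) (∏ᵥ-* (Γ T y) (Γ T (map (ℤ._+ x) y′)) v)))
        (sym (ℚ.*-assoc (integrand A v) (∏ᵥ (Γ T y) v) (∏ᵥ (Γ T (map (ℤ._+ x) y′)) v))))
      (ct₁-scale (kernel A T y v) (unitary-ct (unitary-∏ᵥ (λ u x → Γ T (map (ℤ._+ x) y′) u) (unitary-Γ T y′) v))))

  plain-kernel : ∀ {k} A T κ → HasCT k (integrand A) κ → HasCT k (kernel A T []) κ
  plain-kernel A T κ = ct-ext (λ v → trans (cong (integrand A v *_) (∏ᵥ-1 v)) (ℚ.*-identityʳ (integrand A v)))

  poles : ℕ → List ℤ → ℚ
  poles A = ∏ (λ η → qpoch η A)

  ∏-grid : ∀ A y (f : ℤ → ℚ) → ∏ f (grid y A) ≡ ∏ (λ η → ∏< A (λ l → f (η ℤ.+ + l))) y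
  ∏-grid A y f = trans (∏-concatMap f (λ η → applyUpTo (λ l → η ℤ.+ + l) A) y) (∏-cong (λ η → ∏-applyUpTo f (λ l → η ℤ.+ + l) A) y)

  spaced-shift : ∀ {D} x y → Spaced D y → Spaced D (map (ℤ._+ x) y)
  spaced-shift {D} x y sp = AllPairs.map⁺ (AllPairs.map (λ {a} {b} le → ℤ.≤-trans (ℤ.≤-reflexive (lem a x (+ D))) (ℤ.+-monoˡ-≤ x le)) sp)
    where
    lem : ∀ a x d → a ℤ.+ x ℤ.+ d ≡ a ℤ.+ d ℤ.+ x
    lem = ℤR.solve-∀

  -- Along the line q^x y the constant term is a polynomial of degree k A in q^x, all of whose roots
  -- are provided by kernel-vanish.
  kernel-spaced : ∀ A T k → A ℕ.+ k ℕ.* c ℕ.≤ T → ∀ {κ} → HasCT k (integrand A) κ → (y : Vec ℤ k) →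
                  Spaced (A ℕ.+ c) (Vec.toList y) → HasCT k (kernel A T (Vec.toList y)) (κ * poles A (Vec.toList y))
  kernel-spaced A T k T≥ {κ} ct y sp = subst₂ (HasCT k) refl value₀ (ct-ext (λ v → sym (family₀ v)) (R.value-ct 0ℤ))
    where
    ys : List ℤ
    ys = Vec.toList y
    module R = Parametric (family-parametric 1 {k} A T (moving ys) (small-weights [] ys))
    family-at : ∀ x (v : Vec ℤ k) → family A T (moving ys) (x ∷ v) ≡ kernel A T (Vec.toList (Vec.map (ℤ._+ x) y)) v
    family-at x v = cong (λ z → kernel A T z v) (trans (at-moving x ys) (sym (toList-map (ℤ._+ x) y)))
    family₀ : ∀ v → family A T (moving ys) (0ℤ ∷ v) ≡ kernel A T ys v
    family₀ v = cong (λ z → kernel A T z v) (trans (at-moving 0ℤ ys) (trans (map-cong ℤ.+-identityʳ ys) (map-id ys)))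
    roots : All (λ ρ → R.value (ℤ.- ρ) ≡ 0ℚ) (grid ys A)
    roots = All.map root (grid-index y A)
      where
      root : ∀ {ρ} → InGrid y A ρ → R.value (ℤ.- ρ) ≡ 0ℚ
      root {ρ} (j , l , l<A , refl) = ct-unique (R.value-ct (ℤ.- ρ)) (ct-ext (family-at (ℤ.- ρ))
        (kernel-vanish A T k T≥ (Vec.map (ℤ._+ ℤ.- ρ) y) (subst (Spaced (A ℕ.+ c)) (sym (toList-map (ℤ._+ ℤ.- ρ) y)) (spaced-shift (ℤ.- ρ) ys sp))
          j l l<A (trans (lookup-map j (ℤ._+ ℤ.- ρ) y) (lem (Vec.lookup y j) (+ l)))))
        where
        lem : ∀ a l → a ℤ.+ ℤ.- (a ℤ.+ l) ≡ ℤ.- l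
        lem = ℤR.solve-∀
    degree : ∀ m → Weighted 1 (k ℕ.* (A ℕ.* 1)) (m ∷ zeros {k}) → Bounded 0 (suc (length (grid ys A))) m
    degree m (weigh p r) = p , ℤ.≤-<-trans r (ℤ.≤-<-trans (ℤ.≤-reflexive (trans (cong (λ z → + (k ℕ.* (A ℕ.* 1)) ℤ.+ 1ℤ ℤ.* z) (total-zeros k))
        (trans (ℤ.+-identityʳ _) (cong +_ (trans (cong (k ℕ.*_) (ℕ.*-identityʳ A)) (sym (trans (grid-length ys A) (cong (ℕ._* A) (length-toList y)))))))))
      (ℤ.+<+ (ℕ.n<1+n _)))
      where open import Data.Vec.Properties using (length-toList)
    value₀ : R.value 0ℤ ≡ κ * poles A ys
    -- The constant term in `q^x` is `κ`: with all parameters tending to 0 only the integrand is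
    -- left.
    value₀ = trans (product-of-roots (grid ys A) R.value (grid-distinct (ℕ.m≤m+n A c) ys sp) (span-mono degree R.value-lau) roots
        (family-limit A T [] ys (plain-kernel A T κ ct)) 0ℤ)
      (cong (κ *_) (trans (∏-cong (λ g → cong θ (ℤ.+-identityˡ g)) (grid ys A)) (∏-grid A ys θ)))

  kernel-spacedₗ : ∀ A T y → A ℕ.+ length y ℕ.* c ℕ.≤ T → ∀ {κ} → HasCT (length y) (integrand A) κ →
                   Spaced (A ℕ.+ c) y → HasCT (length y) (kernel A T y) (κ * poles A y)
  kernel-spacedₗ A T y T≥ {κ} ct sp = subst (λ z → HasCT (length y) (kernel A T z) (κ * poles A z)) (toList∘fromList y)
    (kernel-spaced A T (length y) T≥ ct (Vec.fromList y) (subst (Spaced (A ℕ.+ c)) (sym (toList∘fromList y)) sp))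

  spread : ℕ → List ℤ → List (ℤ × ℕ)
  spread j []      = []
  spread j (η ∷ y) = (η , j) ∷ spread (suc j) y

  spread-≤ : ∀ j y → All (λ p → proj₂ p ℕ.≤ j ℕ.+ length y) (spread j y)
  spread-≤ j []      = []
  spread-≤ j (η ∷ y) = ℕ.m≤m+n j _ ∷ All.map (λ le → ℕ.≤-trans le (ℕ.≤-reflexive (sym (ℕ.+-suc j (length y))))) (spread-≤ (suc j) y)

  spread-> : ∀ i j y → i ℕ.< j → All (λ p → i ℕ.< proj₂ p) (spread j y)
  spread-> i j []      i<j = []
  spread-> i j (η ∷ y) i<j = i<j ∷ spread-> i (suc j) y (ℕ.m<n⇒m<1+n i<j)

  length-at-spread : ∀ x j y → length (at x (spread j y)) ≡ length y
  length-at-spread x j []      = refl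
  length-at-spread x j (η ∷ y) = cong suc (length-at-spread x (suc j) y)

  at-spread-0 : ∀ j y → at 0ℤ (spread j y) ≡ y
  at-spread-0 j []      = refl
  at-spread-0 j (η ∷ y) = cong₂ _∷_ (trans (cong (λ z → η ℤ.+ z) (ℤ.*-zeroʳ (+ j))) (ℤ.+-identityʳ η)) (at-spread-0 (suc j) y)

  eventually-above : ∀ D η j ps → All (λ p → j ℕ.< proj₂ p) ps →
    Σ ℕ λ N → ∀ x → + N ℤ.≤ x → All (λ b → η ℤ.+ + j ℤ.* x ℤ.+ + D ℤ.≤ b) (at x ps)
  eventually-above D η j []       []       = 0 , λ _ _ → []
  eventually-above D η j ((η′ , j′) ∷ ps) (j<j′ ∷ js) with eventually-above D η j ps js
  -- Speeds are integers with `j < j′`, so for `x ≥ 0` the gap grows by at least `x`; it suffices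
  -- that `x` be at least `η + D - η′`.
  ... | N , h = N ℕ.⊔ ℤ.∣ η ℤ.+ + D ℤ.- η′ ∣ , λ x x≥ →
    single x (ℤ.≤-trans (ℤ.+≤+ ℕ.z≤n) x≥) (ℤ.≤-trans (i≤∣i∣ (η ℤ.+ + D ℤ.- η′)) (ℤ.≤-trans (ℤ.+≤+ (ℕ.m≤n⊔m N _)) x≥)) ∷
    h x (ℤ.≤-trans (ℤ.+≤+ (ℕ.m≤m⊔n N _)) x≥)
    where
    d : ℕ
    d = proj₁ (ℕ.m≤n⇒∃[o]m+o≡n j<j′)
    lem₁ : ∀ η D η′ t → η ℤ.+ t ℤ.+ D ≡ η′ ℤ.+ (t ℤ.+ (η ℤ.+ D ℤ.- η′) ℤ.+ 0ℤ)
    lem₁ = ℤR.solve-∀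
    lem₂ : ∀ j d x → j ℤ.* x ℤ.+ x ℤ.+ d ℤ.* x ≡ (1ℤ ℤ.+ j ℤ.+ d) ℤ.* x
    lem₂ = ℤR.solve-∀
    single : ∀ x → 0ℤ ℤ.≤ x → η ℤ.+ + D ℤ.- η′ ℤ.≤ x → η ℤ.+ + j ℤ.* x ℤ.+ + D ℤ.≤ η′ ℤ.+ + j′ ℤ.* x
    single (+ x) _ le = ℤ.≤-trans (ℤ.≤-reflexive (lem₁ η (+ D) η′ (+ j ℤ.* + x))) (ℤ.+-monoʳ-≤ η′
      (ℤ.≤-trans (ℤ.+-mono-≤ (ℤ.+-monoʳ-≤ (+ j ℤ.* + x) le) (subst (0ℤ ℤ.≤_) (ℤ.pos-* d x) (ℤ.+≤+ ℕ.z≤n)))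
        (ℤ.≤-reflexive (trans (lem₂ (+ j) (+ d) (+ x)) (cong (λ z → + z ℤ.* + x) (proj₂ (ℕ.m≤n⇒∃[o]m+o≡n j<j′)))))))

  eventually-spaced : ∀ D j y → Σ ℕ λ N → ∀ x → + N ℤ.≤ x → Spaced D (at x (spread j y))
  eventually-spaced D j []      = 0 , λ _ _ → []
  eventually-spaced D j (η ∷ y) with eventually-above D η j (spread (suc j) y) (spread-> j (suc j) y (ℕ.n<1+n j)) | eventually-spaced D (suc j) y
  ... | N , h | N′ , h′ = N ℕ.⊔ N′ , λ x x≥ →
    h x (ℤ.≤-trans (ℤ.+≤+ (ℕ.m≤m⊔n N N′)) x≥) ∷ h′ x (ℤ.≤-trans (ℤ.+≤+ (ℕ.m≤n⊔m N N′)) x≥)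

  laurent-* : ∀ {φ ψ} → Laurent φ → Laurent ψ → Laurent (λ x → φ x * ψ x)
  laurent-* = span-* ℤ._+_ χ₁-+ (λ _ _ _ _ → tt)

  laurent-const : ∀ κ → Laurent (λ _ → κ)
  laurent-const κ = span-const ℤ._+_ χ₁-+ 0ℤ χ₁-0 κ tt

  laurent-poles : ∀ A ps → Laurent (λ x → poles A (at x ps))
  laurent-poles A []             = laurent-const 1ℚ
  laurent-poles A ((η , β) ∷ ps) = laurent-* (go A 0) (laurent-poles A ps)
    where
    go : ∀ m s → Laurent (λ x → ∏< m (λ l → θ (η ℤ.+ + β ℤ.* x ℤ.+ + (s ℕ.+ l))))
    go zero    s = laurent-const 1ℚ
    go (suc m) s = laurent-* (span-- (laurent-const 1ℚ) (span-ext (λ x → trans (cong qp (lem η (+ β ℤ.* x) (+ (s ℕ.+ 0)))) (qp-+ (η ℤ.+ + (s ℕ.+ 0)) (+ β ℤ.* x)))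
                                                           (span-monomial (qp (η ℤ.+ + (s ℕ.+ 0))) (+ β) tt)))
      (span-ext (λ x → ∏<-cong m (λ l _ → cong (λ z → θ (η ℤ.+ + β ℤ.* x ℤ.+ + z)) (ℕ.+-suc s l))) (go m (suc s)))
      where
      lem : ∀ η b l → η ℤ.+ b ℤ.+ l ≡ η ℤ.+ l ℤ.+ b
      lem = ℤR.solve-∀

  -- Any parameters are the value at x = 0 of a family whose parameters q^(η_j + j x) are spaced for large x.
  kernel-full : ∀ A T y → A ℕ.+ length y ℕ.* c ℕ.≤ T → ∀ {κ} → HasCT (length y) (integrand A) κ →
                HasCT (length y) (kernel A T y) (κ * poles A y)
  kernel-full A T y T≥ {κ} ct = subst₂ (λ z w → HasCT k (kernel A T z) w) (at-spread-0 0 y)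
      (trans (a-b≡0⇒a≡b (everywhere 0ℤ)) (cong (λ z → κ * poles A z) (at-spread-0 0 y))) (R.value-ct 0ℤ)
    where
    k : ℕ
    k = length y
    module R = Parametric (family-parametric k {k} A T (spread 0 y) (spread-≤ 0 y))
    N : ℕ
    N = proj₁ (eventually-spaced (A ℕ.+ c) 0 y)
    agree : ∀ x → + N ℤ.≤ x → R.value x ≡ κ * poles A (at x (spread 0 y))
    agree x x≥ = ct-unique (R.value-ct x) (subst (λ l → HasCT l (kernel A T yx) (κ * poles A yx)) len
        (kernel-spacedₗ A T yx (subst (λ l → A ℕ.+ l ℕ.* c ℕ.≤ T) (sym len) T≥) (subst (λ l → HasCT l (integrand A) κ) (sym len) ct)
          (proj₂ (eventually-spaced (A ℕ.+ c) 0 y) x x≥)))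
      where
      yx : List ℤ
      yx = at x (spread 0 y)
      len : length yx ≡ k
      len = length-at-spread x 0 y
    everywhere : ∀ x → R.value x - κ * poles A (at x (spread 0 y)) ≡ 0ℚ
    everywhere = laurent-vanish (span-- (span-mono (λ _ _ → tt) R.value-lau) (span-scale κ (laurent-poles A (spread 0 y))))
      (+ N) (λ x x≥ → a≡b⇒a-b≡0 (agree x x≥))

  -- The missing parameters are supplied as copies of `q^x`. The full formula holds for every `x`,
  -- and the constant term in `q^x` removes them on both sides, since `(q^x)_A` has constant term 1.
  kernel-ct : ∀ k A T y → length y ℕ.≤ k → A ℕ.+ k ℕ.* c ℕ.≤ T → ∀ {κ} → HasCT k (integrand A) κ →
              HasCT k (kernel A T y) (κ * poles A y)
  kernel-ct k A T y y≤k T≥ {κ} ct = subst (HasCT k (kernel A T y)) (ct₁-unique (family-limit A T y extra ctκ) limit) ctκ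
    where
    extra : List ℤ
    extra = List.replicate (k ℕ.∸ length y) 0ℤ
    -- A family in which nothing moves: it only provides the existence of the constant term.
    module E = Parametric (family-parametric 0 {k} A T (fixed y) (All.map⁺ (All.universal (λ _ → ℕ.z≤n) y)))
    ctκ : HasCT k (kernel A T y) (E.value 0ℤ)
    ctκ = ct-ext (λ v → cong (λ z → kernel A T z v) (sym (at-fixed 0ℤ y))) (E.value-ct 0ℤ)
    module R = Parametric (family-parametric 1 {k} A T (fixed y ++ moving extra) (small-weights y extra))
    point : ∀ x → at x (fixed y ++ moving extra) ≡ y ++ map (ℤ._+ x) extra
    point x = trans (at-++ x (fixed y) (moving extra)) (cong₂ _++_ (at-fixed x y) (at-moving x extra))
    len : ∀ x → length (y ++ map (ℤ._+ x) extra) ≡ k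
    len x = trans (length-++ y) (trans (cong (length y ℕ.+_) (trans (length-map (ℤ._+ x) extra) (length-replicate (k ℕ.∸ length y)))) (ℕ.m+[n∸m]≡n y≤k))
    value : ∀ x → R.value x ≡ κ * poles A y * ∏ (λ η → qpoch (η ℤ.+ x) A) extra
    value x = trans (ct-unique (R.value-ct x) (ct-ext (λ v → cong (λ z → kernel A T z v) (point x))
        (subst (λ l → HasCT l (kernel A T yx) (κ * poles A yx)) (len x)
          (kernel-full A T yx (subst (λ l → A ℕ.+ l ℕ.* c ℕ.≤ T) (sym (len x)) T≥) (subst (λ l → HasCT l (integrand A) κ) (sym (len x)) ct)))))
      (trans (cong (κ *_) (∏-++ (λ η → qpoch η A) y (map (ℤ._+ x) extra)))
        (trans (sym (ℚ.*-assoc κ _ _)) (cong (κ * poles A y *_) (∏-map (λ η → qpoch η A) (ℤ._+ x) extra))))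
      where
      yx : List ℤ
      yx = y ++ map (ℤ._+ x) extra
    limit : HasCT₁ R.value (κ * poles A y)
    limit = subst (HasCT₁ R.value) (ℚ.*-identityʳ (κ * poles A y)) (ct₁-ext value (ct₁-scale (κ * poles A y)
      (unitary-ct (unitary-∏ (λ η x → qpoch (η ℤ.+ x) A) (λ η → unitary-qpoch η A) extra))))

  integrand-ct : ∀ k A → Σ ℚ (HasCT k (integrand A))
  integrand-ct k A = E.value 0ℤ , ct-ext (λ v → sym (trans (cong (integrand A v *_) (∏ᵥ-1 v)) (ℚ.*-identityʳ (integrand A v)))) (E.value-ct 0ℤ)
    where module E = Parametric (family-parametric 0 {k} A 0 [] [])

-- A packing argument for integers with forbidden differences.

module Packing (c′ : ℕ) where

  open ℚ₀ using (_+_; _*_; _-_; -_)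
  open import Data.Vec.Properties using (lookup-map)
  open import Data.Nat.DivMod using (_/_; m<n*o⇒m/o<n; /-monoˡ-≤; m≡m%n+[m/n]*n; m%n<n; m/n*n≤m)

  c : ℕ
  c = suc c′

  -- The ordered pairs at which the pair product vanishes: -c < a - b ≤ c.
  Clash : ℕ → ℕ → Set
  Clash a b = Σ ℕ λ l → Σ ℕ λ l′ → l ℕ.< c × l′ ℕ.≤ c × a ℕ.+ l ≡ b ℕ.+ l′

  multiples : ∀ j → ℕ → Vec ℕ j
  multiples zero    i = []
  multiples (suc j) i = i ℕ.* c ∷ multiples j (suc i)

  HasClash : ∀ {k} → Vec ℕ k → Set
  HasClash {k} d = Σ (Fin k) λ i → Σ (Fin k) λ j → i Fin.< j × Clash (Vec.lookup d i) (Vec.lookup d j)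

  same-bin : ∀ x y → x / c ≡ y / c → x ℕ.≤ y → y ℕ.∸ x ℕ.< c
  same-bin x y eq x≤y = ℕ.≤-<-trans (ℕ.m≤n+o⇒m∸n≤o y x (ℕ.≤-trans (ℕ.≤-reflexive (m≡m%n+[m/n]*n y c))
     (ℕ.≤-trans (ℕ.≤-reflexive (ℕ.+-comm _ (y / c ℕ.* c))) (ℕ.+-monoˡ-≤ _ (subst (λ z → z ℕ.* c ℕ.≤ x) eq (m/n*n≤m x c)))))) (m%n<n y c)

  near-clash : ∀ x y → x / c ≡ y / c → Clash x y
  near-clash x y eq with ℕ.≤-total x y
  ... | inj₁ x≤y = y ℕ.∸ x , 0 , same-bin x y eq x≤y , ℕ.z≤n , trans (ℕ.m+[n∸m]≡n x≤y) (sym (ℕ.+-identityʳ y))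
  ... | inj₂ y≤x = 0 , x ℕ.∸ y , ℕ.s≤s ℕ.z≤n , ℕ.<⇒≤ (same-bin y x (sym eq) y≤x) , trans (ℕ.+-identityʳ x) (sym (ℕ.m+[n∸m]≡n y≤x))

  clash-suc : ∀ {a b} → Clash a b → Clash (suc a) (suc b)
  clash-suc (l , l′ , p , r , e) = l , l′ , p , r , cong suc e

  module _ {k : ℕ} (e : ℕ) (ds : Vec ℕ k) (e<kc : e ℕ.< k ℕ.* c) (small : ∀ i → Vec.lookup ds i ℕ.≤ k ℕ.* c) where

    private
      d : Vec ℕ (suc k)
      d = suc e ∷ ds

      -- The bin of an entry: those above the first entry are moved down by one.
      bin : ℕ → ℕ
      bin x with x ℕ.≤? e
      ... | yes _ = x / c
      ... | no  _ = ℕ.pred x / c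

      bin< : ∀ i → bin (Vec.lookup d i) ℕ.< k
      bin< i with Vec.lookup d i ℕ.≤? e | bound i
        where
        bound : ∀ i → Vec.lookup d i ℕ.≤ k ℕ.* c
        bound Fin.zero    = e<kc
        bound (Fin.suc i) = small i
      ... | yes x≤e | _  = m<n*o⇒m/o<n (ℕ.≤-<-trans x≤e e<kc)
      ... | no  x≰e | le = m<n*o⇒m/o<n (ℕ.<-≤-trans (pred< (ℕ.<-≤-trans (ℕ.s≤s ℕ.z≤n) (ℕ.≰⇒> x≰e))) le)
        where
        pred< : ∀ {x} → 0 ℕ.< x → ℕ.pred x ℕ.< x
        pred< {suc x} _ = ℕ.n<1+n x

      -- Since `x ≤ e ≤ y - 1`, the entry `x` shares the bin of `e`, and the clash is with the first
      -- entry `1 + e` in place of `y`. The gap may be exactly `c`; the closed end of the range in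
      -- `Clash` allows it.
      across : ∀ x y → x ℕ.≤ e → e ℕ.< y → x / c ≡ ℕ.pred y / c → Clash (suc e) x
      across x (suc y) x≤e (ℕ.s≤s e≤y) eq = 0 , suc e ℕ.∸ x , ℕ.s≤s ℕ.z≤n ,
        ℕ.≤-trans (ℕ.≤-reflexive (ℕ.+-∸-assoc 1 x≤e)) (same-bin x e bins x≤e) ,
        trans (ℕ.+-identityʳ (suc e)) (sym (ℕ.m+[n∸m]≡n (ℕ.m≤n⇒m≤1+n x≤e)))
        where
        bins : x / c ≡ e / c
        bins = ℕ.≤-antisym (/-monoˡ-≤ c x≤e) (ℕ.≤-trans (/-monoˡ-≤ c e≤y) (ℕ.≤-reflexive (sym eq)))

      first : ∀ i → Vec.lookup d i ℕ.≤ e → Clash (suc e) (Vec.lookup d i) → HasClash d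
      first Fin.zero    le _  = ⊥-elim (ℕ.1+n≰n le)
      first (Fin.suc i) _  cl = Fin.zero , Fin.suc i , ℕ.s≤s ℕ.z≤n , cl

      clash : ∀ i j → i Fin.< j → bin (Vec.lookup d i) ≡ bin (Vec.lookup d j) → HasClash d
      clash i j i<j eq with Vec.lookup d i ℕ.≤? e in ei | Vec.lookup d j ℕ.≤? e in ej
      ... | yes _ | yes _ = i , j , i<j , near-clash _ _ eq
      ... | yes p | no  q = first i p (across _ _ p (ℕ.≰⇒> q) eq)
      ... | no  p | yes q = first j q (across _ _ q (ℕ.≰⇒> p) (sym eq))
      ... | no  p | no  q = i , j , i<j , shifted (ℕ.≰⇒> p) (ℕ.≰⇒> q) eq
        where
        shifted : ∀ {x y} → e ℕ.< x → e ℕ.< y → ℕ.pred x / c ≡ ℕ.pred y / c → Clash x y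
        shifted {suc x} {suc y} _ _ eq = clash-suc (near-clash x y eq)

    -- There are `k + 1` entries among the `k c + 1` integers from 0 to `k c`, one too many for `k`
    -- bins of size `c`. Identifying `1 + e` with `e` makes the bins fit; two entries in one bin
    -- then clash directly or, if they lie on both sides of the seam, through the first entry.
    positive-clash : HasClash d
    positive-clash with Fin.pigeonhole (ℕ.n<1+n k) (λ i → Fin.fromℕ< (bin< i))
    ... | i , j , i<j , eq = clash i j i<j (trans (sym (Fin.toℕ-fromℕ< (bin< i))) (trans (cong toℕ eq) (Fin.toℕ-fromℕ< (bin< j))))

  shift-multiples : ∀ j i → Vec.map (c ℕ.+_) (multiples j i) ≡ multiples j (suc i)
  shift-multiples zero    i = refl
  shift-multiples (suc j) i = cong (c ℕ.+ i ℕ.* c ∷_) (shift-multiples j (suc i))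

  unshift : ∀ {k} (d : Vec ℕ k) → (∀ i → c ℕ.≤ Vec.lookup d i) → Vec.map (c ℕ.+_) (Vec.map (ℕ._∸ c) d) ≡ d
  unshift []      le = refl
  unshift (x ∷ d) le = cong₂ _∷_ (ℕ.m+[n∸m]≡n (le Fin.zero)) (unshift d (le ∘ Fin.suc))

  clash-+ : ∀ {a b} → Clash a b → Clash (c ℕ.+ a) (c ℕ.+ b)
  clash-+ {a} {b} (l , l′ , p , r , e) = l , l′ , p , r ,
    trans (ℕ.+-assoc c a l) (trans (cong (c ℕ.+_) e) (sym (ℕ.+-assoc c b l′)))

  -- If the first entry is positive, `positive-clash` applies. If it is 0, a later entry below `c`
  -- clashes with it; otherwise subtracting `c` from the later entries gives the same problem with
  -- one entry fewer.
  packing : ∀ k (d : Vec ℕ k) → (∀ i → Vec.lookup d i ℕ.≤ ℕ.pred k ℕ.* c) → d ≡ multiples k 0 ⊎ HasClash d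
  packing zero    []           bound = inj₁ refl
  packing (suc k) (suc e ∷ ds) bound = inj₂ (positive-clash e ds (bound Fin.zero) (bound ∘ Fin.suc))
  packing (suc k) (zero ∷ ds)  bound with Fin.any? (λ i → Vec.lookup ds i ℕ.<? c)
  ... | yes (i , lt) = inj₂ (Fin.zero , Fin.suc i , ℕ.s≤s ℕ.z≤n , Vec.lookup ds i , 0 , lt , ℕ.z≤n , sym (ℕ.+-identityʳ _))
  ... | no none with packing k (Vec.map (ℕ._∸ c) ds) bound′
    where
    bound′ : ∀ i → Vec.lookup (Vec.map (ℕ._∸ c) ds) i ℕ.≤ ℕ.pred k ℕ.* c
    bound′ i = subst₂ ℕ._≤_ (sym (lookup-map i (ℕ._∸ c) ds)) (pred-* k) (ℕ.∸-monoˡ-≤ c (bound (Fin.suc i)))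
      where
      pred-* : ∀ k → k ℕ.* c ℕ.∸ c ≡ ℕ.pred k ℕ.* c
      pred-* zero    = refl
      pred-* (suc k) = ℕ.m+n∸m≡n c (k ℕ.* c)
  ...   | inj₁ eq = inj₁ (cong (0 ∷_) (trans (sym (unshift ds far)) (trans (cong (Vec.map (c ℕ.+_)) eq) (shift-multiples k 0))))
    where
    far : ∀ i → c ℕ.≤ Vec.lookup ds i
    far i = ℕ.≮⇒≥ (λ lt → none (i , lt))
  ...   | inj₂ (i , j , i<j , cl) = inj₂ (Fin.suc i , Fin.suc j , ℕ.s≤s i<j , subst₂ Clash (restore i) (restore j) (clash-+ cl))
    where
    restore : ∀ i → c ℕ.+ Vec.lookup (Vec.map (ℕ._∸ c) ds) i ≡ Vec.lookup ds i
    restore i = trans (cong (c ℕ.+_) (lookup-map i (ℕ._∸ c) ds)) (ℕ.m+[n∸m]≡n (ℕ.≮⇒≥ (λ lt → none (i , lt))))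

-- Interpolation weights at consecutive nodes.

module IntervalWeights (C : Character) where

  open ℚ₀ using (_+_; _*_; _-_; -_)
  open Character C
  open ConstantTerm₁ C
  open ConstantTerm C
  open Interpolation C
  open import Data.List.Properties using (∷-injective)
  import Data.List.Relation.Unary.All.Properties as All
  open import Data.List.Relation.Unary.AllPairs.Properties using (applyUpTo⁺₁)

  applyUpTo-++ : {X : Set} (f : ℕ → X) → ∀ m n → applyUpTo f (m ℕ.+ n) ≡ applyUpTo f m ++ applyUpTo (λ i → f (m ℕ.+ i)) n
  applyUpTo-++ f zero    n = refl
  applyUpTo-++ f (suc m) n = cong (f 0 ∷_) (applyUpTo-++ (f ∘ suc) m n)

  splitAt-map : (ws : List (ℤ × ℚ)) (xs : List ℤ) (ν : ℤ) (ys : List ℤ) → map proj₁ ws ≡ xs ++ ν ∷ ys →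
    Σ (List (ℤ × ℚ)) λ pre → Σ ℚ λ w → Σ (List (ℤ × ℚ)) λ post →
      ws ≡ pre ++ (ν , w) ∷ post × map proj₁ pre ≡ xs × map proj₁ post ≡ ys
  splitAt-map ((ν , w) ∷ ws) []       .ν ys refl = [] , w , ws , refl , refl , refl
  splitAt-map (p ∷ ws)       (x ∷ xs) ν  ys eq with ∷-injective eq
  ... | refl , eq′ with splitAt-map ws xs ν ys eq′
  ...   | pre , w , post , refl , refl , refl = p ∷ pre , w , post , refl , refl , refl

  interval : ℤ → ℕ → List ℤ
  interval top = applyUpTo (λ τ → top ℤ.- + τ)

  module _ (top : ℤ) where

    private
      node : ℕ → ℤ
      node τ = top ℤ.- + τ

      node-diff : ∀ τ σ → node τ ℤ.- node σ ≡ + σ ℤ.- + τ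
      node-diff τ σ = lem top (+ τ) (+ σ)
        where
        lem : ∀ a t s → a ℤ.- t ℤ.- (a ℤ.- s) ≡ s ℤ.- t
        lem = ℤR.solve-∀

      node-injective : ∀ s t → node s ≡ node t → s ≡ t
      node-injective s t eq = sym (ℤ.+-injective (ℤ.i-j≡0⇒i≡j (+ t) (+ s) (trans (sym (node-diff s t)) (ℤ.i≡j⇒i-j≡0 eq))))

    interval-distinct : ∀ n → AllPairs _≢_ (interval top n)
    interval-distinct n = applyUpTo⁺₁ node n (λ {i} {j} i<j _ eq → ℕ.<⇒≢ i<j (node-injective i j eq))

    module _ (τ r : ℕ) where

      private
        before after : List ℤ
        before = applyUpTo node τ
        after  = applyUpTo (λ s → node (τ ℕ.+ suc s)) r

      interval-split : interval top (τ ℕ.+ suc r) ≡ before ++ node τ ∷ after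
      interval-split = trans (applyUpTo-++ node τ (suc r)) (cong (λ z → before ++ node z ∷ after) (ℕ.+-identityʳ τ))

      others-before : All (_≢ node τ) before
      others-before = All.applyUpTo⁺₁ node τ (λ {s} s<τ eq → ℕ.<⇒≢ s<τ (node-injective s τ eq))

      others-after : All (_≢ node τ) after
      others-after = All.applyUpTo⁺₁ (λ s → node (τ ℕ.+ suc s)) r (λ {s} _ eq → ℕ.m+1+n≢m τ (node-injective (τ ℕ.+ suc s) τ eq))

      -- Nodes are listed downwards: the `τ` nodes above contribute `(q^(-τ))_τ`, the `r` nodes
      -- below contribute `(q)_r`.
      differences : ∏ (λ μ → θ (node τ ℤ.- μ)) (before ++ after) ≡ qpoch (ℤ.- + τ) τ * qpoch 1ℤ r
      differences = trans (∏-++ f before after) (cong₂ _*_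
          (trans (∏-applyUpTo f node τ) (∏<-cong τ (λ s _ → cong θ (trans (node-diff τ s) (ℤ.+-comm (+ s) (ℤ.- + τ))))))
          (trans (∏-applyUpTo f (λ s → node (τ ℕ.+ suc s)) r) (∏<-cong r (λ s _ → cong θ (trans (node-diff τ (τ ℕ.+ suc s)) (lem (+ τ) (+ s)))))))
        where
        f : ℤ → ℚ
        f μ = θ (node τ ℤ.- μ)
        lem : ∀ t s → t ℤ.+ (1ℤ ℤ.+ s) ℤ.- t ≡ 1ℤ ℤ.+ s
        lem = ℤR.solve-∀

      interval-weight : ∀ {lo T ws} → map proj₁ ws ≡ interval top (τ ℕ.+ suc r) →
        Interpolates lo T (interval top (τ ℕ.+ suc r)) ws →
        Σ ℚ λ w → (Σ (List (ℤ × ℚ)) λ pre → Σ (List (ℤ × ℚ)) λ post →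
          (ws ≡ pre ++ (node τ , w) ∷ post) × All (λ p → proj₁ p ≢ node τ) (pre ++ post)) ×
          w * (qpoch (ℤ.- + τ) τ * qpoch 1ℤ r) ≡ 1ℚ
      interval-weight {lo} {T} {ws} eq interp with splitAt-map ws before (node τ) after (trans eq interval-split)
      ... | pre , w , post , ws≡ , pre≡ , post≡ = w ,
        (pre , post , ws≡ , All.++⁺ (All.map⁻ (subst (All (_≢ node τ)) (sym pre≡) others-before))
                                    (All.map⁻ (subst (All (_≢ node τ)) (sym post≡) others-after))) ,
        trans (cong (w *_) (sym (trans (cong₂ (λ x y → ∏ (λ μ → θ (node τ ℤ.- μ)) (x ++ y)) pre≡ post≡) differences)))
          (weight {lo} {T} {pre} {node τ} {w} {post}
            (subst₂ (Interpolates lo T) (trans interval-split (cong₂ (λ x y → x ++ node τ ∷ y) (sym pre≡) (sym post≡))) ws≡ interp))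

-- The product of the weights at the points `q^(A+ic)`.

module SurvivorWeights (C : Character) (c′ : ℕ) where

  open ℚ₀ using (_+_; _*_; _-_; -_)
  open Character C
  open Interpolation C
  open IntervalWeights C
  import Data.Vec.Relation.Unary.All as VAll
  open VAll using (_∷_; [])

  c : ℕ
  c = suc c′

  survivors : ∀ A j → ℕ → Vec ℤ j
  survivors A zero    i = []
  survivors A (suc j) i = + (A ℕ.+ i ℕ.* c) ∷ survivors A j (suc i)

  module _ (A k : ℕ) where

    -- The survivor + (A + i c) is the node of index τ = (k - i) c, with i c + c′ nodes after it.
    index : ℕ → ℕ
    index i = (k ℕ.∸ i) ℕ.* c

    denominator : ℕ → ℚ
    denominator i = qpoch (ℤ.- + index i) (index i) * qpoch 1ℤ (c′ ℕ.+ i ℕ.* c)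

    index-size : ∀ i → i ℕ.≤ k → index i ℕ.+ suc (c′ ℕ.+ i ℕ.* c) ≡ suc k ℕ.* c
    index-size i i≤k = trans (ℕ.+-comm (index i) (suc (c′ ℕ.+ i ℕ.* c))) (trans (ℕ.+-assoc c (i ℕ.* c) (index i)) (cong (c ℕ.+_)
          (trans (sym (ℕ.*-distribʳ-+ c i (k ℕ.∸ i))) (cong (ℕ._* c) (ℕ.m+[n∸m]≡n i≤k)))))

    index-node : ∀ i → i ℕ.≤ k → + (A ℕ.+ k ℕ.* c) ℤ.- + index i ≡ + (A ℕ.+ i ℕ.* c)
    index-node i i≤k = trans (cong (λ z → + (A ℕ.+ z) ℤ.- + index i) (trans (cong (ℕ._* c) (sym (ℕ.m+[n∸m]≡n i≤k))) (ℕ.*-distribʳ-+ c i (k ℕ.∸ i))))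
      (lem (+ A) (+ (i ℕ.* c)) (+ index i))
      where
      lem : ∀ a i t → a ℤ.+ (i ℤ.+ t) ℤ.- t ≡ a ℤ.+ i
      lem = ℤR.solve-∀

    module _ {S : ℤ → Set} {ws : List (ℤ × ℚ)} (inS : All (S ∘ proj₁) ws) {lo T N : ℕ} (N≡ : suc k ℕ.* c ≡ N)
             (eq : map proj₁ ws ≡ interval (+ (A ℕ.+ k ℕ.* c)) N)
             (interp : Interpolates lo T (interval (+ (A ℕ.+ k ℕ.* c)) N) ws) where

      survivor-weight : ∀ i → i ℕ.≤ k → Σ ℚ λ w → IsolatedNode {S} {ws} inS (+ (A ℕ.+ i ℕ.* c) , w) × w * denominator i ≡ 1ℚ
      survivor-weight i i≤k = subst (λ ν → Σ ℚ λ w → IsolatedNode {S} {ws} inS (ν , w) × w * denominator i ≡ 1ℚ) (index-node i i≤k)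
        (interval-weight (+ (A ℕ.+ k ℕ.* c)) (index i) (c′ ℕ.+ i ℕ.* c) {lo} {T} {ws}
          (trans eq (cong (interval (+ (A ℕ.+ k ℕ.* c))) (sym n≡))) (subst (λ n → Interpolates lo T (interval (+ (A ℕ.+ k ℕ.* c)) n) ws) (sym n≡) interp))
        where
        n≡ : index i ℕ.+ suc (c′ ℕ.+ i ℕ.* c) ≡ N
        n≡ = trans (index-size i i≤k) N≡

      record Selection (j i : ℕ) : Set where
        field
          chosen    : Vec (ℤ × ℚ) j
          isolated  : VAll.All (IsolatedNode {S} {ws} inS) chosen
          points    : Vec.map proj₁ chosen ≡ survivors A j i
          scale     : ℚ
          scaled    : ∀ a → Vec.foldr (λ _ → ℚ) (λ p z → proj₂ p * z) a chosen ≡ scale * a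
          scale-inv : scale * ∏< j (λ s → denominator (i ℕ.+ s)) ≡ 1ℚ

      select : ∀ j i → i ℕ.+ j ≡ suc k → Selection j i
      select zero    i _  = record
        { chosen = [] ; isolated = [] ; points = refl ; scale = 1ℚ
        ; scaled = λ a → sym (ℚ.*-identityˡ a) ; scale-inv = ℚ.*-identityˡ 1ℚ }
      select (suc j) i ij = record
        { chosen    = (+ (A ℕ.+ i ℕ.* c) , w) ∷ chosen
        ; isolated  = proj₁ (proj₂ here) ∷ isolated
        ; points    = cong (+ (A ℕ.+ i ℕ.* c) ∷_) points
        ; scale     = w * scale
        ; scaled    = λ a → trans (cong (w *_) (scaled a)) (sym (ℚ.*-assoc w scale a))
        ; scale-inv = trans (cong₂ (λ a b → w * scale * (a * b)) (cong denominator (ℕ.+-identityʳ i)) (∏<-cong j (λ s _ → cong denominator (ℕ.+-suc i s))))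
            (trans (interchange w scale (denominator i) (∏< j (λ s → denominator (suc i ℕ.+ s))))
              (trans (cong₂ _*_ (proj₂ (proj₂ here)) scale-inv) (ℚ.*-identityˡ 1ℚ)))
        }
        where
        here : Σ ℚ λ w → IsolatedNode {S} {ws} inS (+ (A ℕ.+ i ℕ.* c) , w) × w * denominator i ≡ 1ℚ
        here = survivor-weight i (ℕ.≤-pred (ℕ.m+n≤o⇒m≤o (suc i) (ℕ.≤-reflexive (trans (sym (ℕ.+-suc i j)) ij))))
        w : ℚ
        w = proj₁ here
        open Selection (select j (suc i) (trans (sym (ℕ.+-suc i j)) ij))

-- The single tuple of poles at which the integrand can be non-zero.

module Survivors (C : Character) (c′ : ℕ) where

  open ℚ₀ using (_+_; _*_; _-_; -_)
  open Character C
  open ConstantTerm₁ C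
  open ConstantTerm C
  open Interpolation C
  open Kernel C c′
  open Vanishing C c′
  open ProductFormula C c′
  open SurvivorWeights C c′ using (survivors)
  open IntervalWeights C using (applyUpTo-++; interval)
  open Packing c′ using (multiples; packing; HasClash; Clash)
  import Data.Vec.Relation.Unary.All as VAll
  open VAll using (_∷_; [])
  open import Data.List.Properties using (map-applyUpTo)
  open import Data.Vec.Properties using (lookup-map)

  -- Consecutive exponents differ by exactly `c`, so the groups of `c` poles join into one interval
  -- without gaps.
  special : ∀ k → ℕ → Vec ℤ k
  special zero    A = []
  special (suc k) A = ℤ.- + (A ℕ.+ k ℕ.* c) ∷ special k A

  applyUpTo-cong : {X : Set} {f g : ℕ → X} → ∀ n → (∀ i → f i ≡ g i) → applyUpTo f n ≡ applyUpTo g n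
  applyUpTo-cong zero    eq = refl
  applyUpTo-cong (suc n) eq = cong₂ _∷_ (eq 0) (applyUpTo-cong n (eq ∘ suc))

  grid-special : ∀ k A → grid (Vec.toList (special (suc k) A)) c ≡ applyUpTo (λ τ → ℤ.- + (A ℕ.+ k ℕ.* c) ℤ.+ + τ) (suc k ℕ.* c)
  grid-special zero    A = sym (applyUpTo-++ (λ τ → ℤ.- + (A ℕ.+ 0 ℕ.* c) ℤ.+ + τ) c 0)
  grid-special (suc k) A = trans (cong (applyUpTo (λ τ → ℤ.- + (A ℕ.+ suc k ℕ.* c) ℤ.+ + τ) c ++_) (trans (grid-special k A)
      (applyUpTo-cong (suc k ℕ.* c) (λ τ → trans (cong (λ z → z ℤ.+ + τ) (lem (+ A) (+ (k ℕ.* c)) (+ c))) (ℤ.+-assoc (ℤ.- + (A ℕ.+ suc k ℕ.* c)) (+ c) (+ τ))))))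
    (sym (applyUpTo-++ (λ τ → ℤ.- + (A ℕ.+ suc k ℕ.* c) ℤ.+ + τ) c (suc k ℕ.* c)))
    where
    lem : ∀ a k c → ℤ.- (a ℤ.+ k) ≡ ℤ.- (a ℤ.+ (c ℤ.+ k)) ℤ.+ c
    lem = ℤR.solve-∀

  special-nodes : ∀ k A → nodes (Vec.toList (special (suc k) A)) ≡ interval (+ (A ℕ.+ k ℕ.* c)) (suc k ℕ.* c)
  special-nodes k A = trans (cong (map (ℤ.-_)) (grid-special k A)) (trans (map-applyUpTo (λ τ → ℤ.- + (A ℕ.+ k ℕ.* c) ℤ.+ + τ) (ℤ.-_) (suc k ℕ.* c))
    (applyUpTo-cong (suc k ℕ.* c) (λ τ → lem (+ (A ℕ.+ k ℕ.* c)) (+ τ))))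
    where
    lem : ∀ a t → ℤ.- (ℤ.- a ℤ.+ t) ≡ a ℤ.- t
    lem = ℤR.solve-∀

  survivors-multiples : ∀ A j i → Vec.map (λ d → + (A ℕ.+ d)) (multiples j i) ≡ survivors A j i
  survivors-multiples A zero    i = refl
  survivors-multiples A (suc j) i = cong (_ ∷_) (survivors-multiples A j (suc i))

  lookup-special : ∀ k A (j : Fin k) → Σ ℕ λ m → m ℕ.≤ ℕ.pred k ℕ.* c × Vec.lookup (special k A) j ≡ ℤ.- + (A ℕ.+ m)
  lookup-special (suc k) A Fin.zero    = k ℕ.* c , ℕ.≤-refl , refl
  lookup-special (suc k) A (Fin.suc j) with lookup-special k A j
  ... | m , le , eq = m , ℕ.≤-trans le (ℕ.*-monoˡ-≤ c (ℕ.pred[n]≤n {k})) , eq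

  -- All nodes lie between `-c′` and `A + (k - 1) c`, and the one-variable factor vanishes on the
  -- part below `A`. What remains is just long enough for `k` points at distance `c`.
  window : ∀ A k u → InNodes (special k A) u → factor₁ A u ≡ 0ℚ ⊎ (Σ ℕ λ d → d ℕ.≤ ℕ.pred k ℕ.* c × u ≡ + (A ℕ.+ d))
  window A k u (j , l , l<c , eq) with lookup-special k A j
  ... | m , m≤ , eq′ with u ℤ.<? + A
  ...   | yes u<A = inj₁ (factor₁-zero A u (between (ℕ.≤-pred l<c) (trans eq (trans (cong ℤ.-_ eq′) (ℤ.neg-involutive (+ (A ℕ.+ m)))))) u<A)
  ...   | no  u≮A with u
  ...     | -[1+ _ ] = ⊥-elim (u≮A ℤ.-<+)
  ...     | + n      = inj₂ (n ℕ.∸ A , ℕ.m≤n+o⇒m∸n≤o n A (ℕ.≤-trans n≤ (ℕ.+-monoʳ-≤ A m≤)) , cong +_ (sym (ℕ.m+[n∸m]≡n (ℕ.≮⇒≥ (λ n<A → u≮A (ℤ.+<+ n<A))))))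
    where
    n≤ : n ℕ.≤ A ℕ.+ m
    n≤ = ℕ.≤-trans (ℕ.m≤m+n n l) (ℕ.≤-reflexive (ℤ.+-injective (trans eq (trans (cong ℤ.-_ eq′) (ℤ.neg-involutive (+ (A ℕ.+ m)))))))

  windows : ∀ A K {k} (v : Vec ℤ k) → VAll.All (InNodes (special K A)) v → ∏ᵥ (factor₁ A) v ≡ 0ℚ ⊎
            (Σ (Vec ℕ k) λ d → (∀ i → Vec.lookup d i ℕ.≤ ℕ.pred K ℕ.* c) × v ≡ Vec.map (λ x → + (A ℕ.+ x)) d)
  windows A K []      []       = inj₂ ([] , (λ ()) , refl)
  windows A K (u ∷ v) (n ∷ ns) with window A K u n | windows A K v ns
  ... | inj₁ z           | _                  = inj₁ (*-zeroˡ-≡ z)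
  ... | _                | inj₁ z             = inj₁ (*-zeroʳ-≡ {factor₁ A u} z)
  ... | inj₂ (x , le , refl) | inj₂ (d , les , refl) = inj₂ (x ∷ d , (λ { Fin.zero → le ; (Fin.suc i) → les i }) , refl)

  clash-zero : ∀ A {k} (d : Vec ℕ k) → HasClash d → pairs (Vec.map (λ x → + (A ℕ.+ x)) d) ≡ 0ℚ
  clash-zero A d (i , j , i<j , l , l′ , l<c , l′≤c , eq) = pairs-zero (Vec.map at d) i j i<j
    (subst₂ (λ x y → pair x y ≡ 0ℚ) (sym (lookup-map i at d)) (sym (lookup-map j at d))
      (pair-zero (at (Vec.lookup d i)) (at (Vec.lookup d j)) l l′ l<c l′≤c (cong +_
        (trans (ℕ.+-assoc A (Vec.lookup d i) l) (trans (cong (A ℕ.+_) eq) (sym (ℕ.+-assoc A (Vec.lookup d j) l′)))))))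
    where
    at : ℕ → ℤ
    at x = + (A ℕ.+ x)

  only-survivor : ∀ A k (v : Vec ℤ k) → VAll.All (InNodes (special k A)) v → v ≡ survivors A k 0 ⊎ integrand A v ≡ 0ℚ
  only-survivor A k v ns with windows A k v ns
  ... | inj₁ z = inj₂ (*-zeroˡ-≡ z)
  ... | inj₂ (d , les , refl) with packing k d les
  ...   | inj₁ refl = inj₁ (survivors-multiples A k 0)
  ...   | inj₂ cl   = inj₂ (*-zeroʳ-≡ {∏ᵥ (factor₁ A) (Vec.map (λ x → + (A ℕ.+ x)) d)} (clash-zero A d cl))

-- The pair product at the surviving tuple.

module SurvivorPairs (C : Character) (c′ : ℕ) where

  open ℚ₀ using (_+_; _*_; _-_; -_)
  open Character C
  open Interpolation C
  open Kernel C c′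
  open SurvivorWeights C c′ using (survivors)

  qpoch-+ : ∀ a m n → qpoch a (m ℕ.+ n) ≡ qpoch a m * qpoch (a ℤ.+ + m) n
  qpoch-+ a m n = trans (∏<-+ m n (λ l → θ (a ℤ.+ + l))) (cong (qpoch a m *_)
    (∏<-cong n (λ i _ → cong θ (sym (ℤ.+-assoc a (+ m) (+ i))))))

  step-pair : ∀ A i d → pair (+ (A ℕ.+ i ℕ.* c)) (+ (A ℕ.+ (i ℕ.+ suc d) ℕ.* c)) ≡
              qpoch (ℤ.- + (suc d ℕ.* c)) c * qpoch (1ℤ ℤ.+ + (suc d ℕ.* c)) c
  step-pair A i d = cong₂ (λ x y → qpoch x c * qpoch (1ℤ ℤ.+ y) c)
      (trans (cong (λ z → + (A ℕ.+ i ℕ.* c) ℤ.- + (A ℕ.+ z)) (ℕ.*-distribʳ-+ c i (suc d))) (lem₁ (+ A) (+ (i ℕ.* c)) (+ (suc d ℕ.* c))))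
      (trans (cong (λ z → + (A ℕ.+ z) ℤ.- + (A ℕ.+ i ℕ.* c)) (ℕ.*-distribʳ-+ c i (suc d))) (lem₂ (+ A) (+ (i ℕ.* c)) (+ (suc d ℕ.* c))))
    where
    lem₁ : ∀ a i d → a ℤ.+ i ℤ.- (a ℤ.+ (i ℤ.+ d)) ≡ ℤ.- d
    lem₁ = ℤR.solve-∀
    lem₂ : ∀ a i d → a ℤ.+ (i ℤ.+ d) ℤ.- (a ℤ.+ i) ≡ d
    lem₂ = ℤR.solve-∀

  first-pairs : ∀ A i j s → ∏ᵥ (pair (+ (A ℕ.+ i ℕ.* c))) (survivors A j (i ℕ.+ suc s)) ≡
                ∏< j (λ d → qpoch (ℤ.- + (suc (s ℕ.+ d) ℕ.* c)) c * qpoch (1ℤ ℤ.+ + (suc (s ℕ.+ d) ℕ.* c)) c)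
  first-pairs A i zero    s = refl
  first-pairs A i (suc j) s = cong₂ _*_
    (trans (step-pair A i s) (cong (λ z → qpoch (ℤ.- + (suc z ℕ.* c)) c * qpoch (1ℤ ℤ.+ + (suc z ℕ.* c)) c) (sym (ℕ.+-identityʳ s))))
    (trans (cong (λ z → ∏ᵥ (pair (+ (A ℕ.+ i ℕ.* c))) (survivors A j z)) (sym (ℕ.+-suc i (suc s))))
      (trans (first-pairs A i j (suc s)) (∏<-cong j (λ d _ → cong (λ z → qpoch (ℤ.- + (suc z ℕ.* c)) c * qpoch (1ℤ ℤ.+ + (suc z ℕ.* c)) c) (sym (ℕ.+-suc s d))))))

  telescope⁻ : ∀ k → ∏< k (λ d → qpoch (ℤ.- + (suc d ℕ.* c)) c) ≡ qpoch (ℤ.- + (k ℕ.* c)) (k ℕ.* c)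
  telescope⁻ zero    = refl
  telescope⁻ (suc k) = trans (∏<-snoc k _) (trans (cong (_* qpoch (ℤ.- + (suc k ℕ.* c)) c) (telescope⁻ k))
    (trans (ℚ.*-comm (qpoch (ℤ.- + (k ℕ.* c)) (k ℕ.* c)) _) (sym (trans (qpoch-+ (ℤ.- + (suc k ℕ.* c)) c (k ℕ.* c))
      (cong (λ z → qpoch (ℤ.- + (suc k ℕ.* c)) c * qpoch z (k ℕ.* c)) (lem (+ c) (+ (k ℕ.* c))))))))
    where
    lem : ∀ c k → ℤ.- (c ℤ.+ k) ℤ.+ c ≡ ℤ.- k
    lem = ℤR.solve-∀

  telescope⁺ : ∀ k → ∏< k (λ d → qpoch (1ℤ ℤ.+ + (suc d ℕ.* c)) c) * qpoch 1ℤ c ≡ qpoch 1ℤ (suc k ℕ.* c)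
  telescope⁺ zero    = trans (ℚ.*-identityˡ _) (cong (qpoch 1ℤ) (sym (ℕ.+-identityʳ c)))
  telescope⁺ (suc k) = trans (cong (_* qpoch 1ℤ c) (∏<-snoc k _)) (trans (lem (∏< k (λ d → qpoch (1ℤ ℤ.+ + (suc d ℕ.* c)) c)) _ (qpoch 1ℤ c))
    (trans (cong (_* qpoch (1ℤ ℤ.+ + (suc k ℕ.* c)) c) (telescope⁺ k))
      (trans (sym (qpoch-+ 1ℤ (suc k ℕ.* c) c)) (cong (qpoch 1ℤ) (ℕ.+-comm (suc k ℕ.* c) c)))))
    where
    lem : ∀ a b d → a * b * d ≡ a * d * b
    lem = solve-∀ ℚring

  -- The pairs of one point with all later ones are at distances `c`, `2c`, ..., so their Pochhammer
  -- symbols join end to end. The extra `(q)_c` for each point fills the gap at the start of the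
  -- ascending chain.
  pairs-survivors : ∀ A k i → pairs (survivors A k i) * ∏< k (λ _ → qpoch 1ℤ c) ≡
                    ∏< k (λ m → qpoch (ℤ.- + (m ℕ.* c)) (m ℕ.* c)) * ∏< k (λ m → qpoch 1ℤ (suc m ℕ.* c))
  pairs-survivors A zero    i = refl
  pairs-survivors A (suc k) i = begin
    ∏ᵥ (pair (+ (A ℕ.+ i ℕ.* c))) (survivors A k (suc i)) * R * (qc * Q)  ≡⟨ cong (λ z → z * R * (qc * Q)) first ⟩
    N * P * R * (qc * Q)                                                   ≡⟨ lem N P R qc Q ⟩
    N * (P * qc) * (R * Q)                                                 ≡⟨ cong₂ (λ x y → x * y * (R * Q)) (telescope⁻ k) (telescope⁺ k) ⟩
    n * p * (R * Q)                                                        ≡⟨ cong (n * p *_) (pairs-survivors A k (suc i)) ⟩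
    n * p * (∏< k f * ∏< k g)                                              ≡⟨ lem′ n p (∏< k f) (∏< k g) ⟩
    (∏< k f * n) * (∏< k g * p)                                            ≡⟨ cong₂ _*_ (∏<-snoc k f) (∏<-snoc k g) ⟨
    ∏< (suc k) f * ∏< (suc k) g                                            ∎
    where
    open ≡-Reasoning
    f g : ℕ → ℚ
    f m = qpoch (ℤ.- + (m ℕ.* c)) (m ℕ.* c)
    g m = qpoch 1ℤ (suc m ℕ.* c)
    N P R qc Q n p : ℚ
    N  = ∏< k (λ d → qpoch (ℤ.- + (suc d ℕ.* c)) c)
    P  = ∏< k (λ d → qpoch (1ℤ ℤ.+ + (suc d ℕ.* c)) c)
    R  = pairs (survivors A k (suc i))
    qc = qpoch 1ℤ c
    Q  = ∏< k (λ _ → qpoch 1ℤ c)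
    n  = qpoch (ℤ.- + (k ℕ.* c)) (k ℕ.* c)
    p  = qpoch 1ℤ (suc k ℕ.* c)
    first : ∏ᵥ (pair (+ (A ℕ.+ i ℕ.* c))) (survivors A k (suc i)) ≡ N * P
    first = trans (cong (λ z → ∏ᵥ (pair (+ (A ℕ.+ i ℕ.* c))) (survivors A k z)) (sym (ℕ.+-comm i 1)))
      (trans (first-pairs A i k 0) (∏<-* k _ _))
    lem : ∀ a b c d e → a * b * c * (d * e) ≡ a * (b * d) * (c * e)
    lem = solve-∀ ℚring
    lem′ : ∀ a b c d → a * b * (c * d) ≡ (c * a) * (d * b)
    lem′ = solve-∀ ℚring

  ∏ᵥ-survivors : ∀ f A j i → ∏ᵥ f (survivors A j i) ≡ ∏< j (λ s → f (+ (A ℕ.+ (i ℕ.+ s) ℕ.* c)))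
  ∏ᵥ-survivors f A zero    i = refl
  ∏ᵥ-survivors f A (suc j) i = cong₂ _*_ (cong (λ z → f (+ (A ℕ.+ z ℕ.* c))) (sym (ℕ.+-identityʳ i)))
    (trans (∏ᵥ-survivors f A j (suc i)) (∏<-cong j (λ s _ → cong (λ z → f (+ (A ℕ.+ z ℕ.* c))) (sym (ℕ.+-suc i s)))))

-- The constant term of the integrand: a q-Morris identity.

module Morris (C : Character) (c′ : ℕ) where

  open ℚ₀ using (_+_; _*_; _-_; -_)
  open Character C
  open ConstantTerm C
  open Interpolation C
  open Kernel C c′
  open Vanishing C c′
  open ProductFormula C c′
  open IntervalWeights C using (interval-distinct)
  open SurvivorWeights C c′ hiding (c)
  open Survivors C c′
  open SurvivorPairs C c′
  open import Data.Vec.Properties using (length-toList)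
  import Data.List.Relation.Unary.All.Properties as All

  poles-special : ∀ k A → poles A (Vec.toList (special k A)) ≡ ∏< k (λ i → qpoch (ℤ.- + (A ℕ.+ i ℕ.* c)) A)
  poles-special zero    A = refl
  poles-special (suc k) A = trans (cong (qpoch (ℤ.- + (A ℕ.+ k ℕ.* c)) A *_) (poles-special k A))
    (trans (ℚ.*-comm (qpoch (ℤ.- + (A ℕ.+ k ℕ.* c)) A) _) (sym (∏<-snoc k (λ i → qpoch (ℤ.- + (A ℕ.+ i ℕ.* c)) A))))

  ∏<-reverse : ∀ n (f : ℕ → ℚ) → ∏< (suc n) (λ i → f (n ℕ.∸ i)) ≡ ∏< (suc n) f
  ∏<-reverse zero    f = refl
  ∏<-reverse (suc n) f = trans (cong (f (suc n) *_) (∏<-reverse n f)) (trans (ℚ.*-comm (f (suc n)) _) (sym (∏<-snoc (suc n) f)))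

  length-special : ∀ k A → length (Vec.toList (special k A)) ≡ k
  length-special k A = length-toList (special k A)

  morris-num morris-den : ℕ → ℕ → ℚ
  morris-num k A = ∏< k (λ i → qpoch 1ℤ (A ℕ.+ c′ ℕ.+ i ℕ.* c) * qpoch 1ℤ (suc i ℕ.* c))
  morris-den k A = ∏< k (λ i → qpoch 1ℤ (A ℕ.+ i ℕ.* c) * (qpoch 1ℤ (c′ ℕ.+ i ℕ.* c) * qpoch 1ℤ c))

  -- The q-Morris identity with second parameter c - 1.
  morris : ∀ k A {κ} → HasCT k (integrand A) κ → κ * morris-den k A ≡ morris-num k A
  morris zero    A (ct-[] refl) = refl
  morris (suc k) A {κ} ct = begin
    κ * morris-den K A              ≡⟨ cong (κ *_) (trans (∏<-* K aq (λ i → y i * qpoch 1ℤ c)) (cong (Aq *_) (∏<-* K y (λ _ → qpoch 1ℤ c)))) ⟩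
    κ * (Aq * (Y * Q))              ≡⟨ cong (_* (Aq * (Y * Q))) κ-eq ⟩
    P * (B * R) * (Aq * (Y * Q))    ≡⟨ lem₁ P B R Aq Y Q ⟩
    P * Y * (Aq * B) * (R * Q)      ≡⟨ cong₂ (λ x y → P * Y * x * y) AB (pairs-survivors A K 0) ⟩
    P * Y * H * (X * G)             ≡⟨ lem₂ P Y H X G ⟩
    P * (X * Y) * (H * G)           ≡⟨ cong (_* (H * G)) PXY ⟩
    1ℚ * (H * G)                    ≡⟨ ℚ.*-identityˡ (H * G) ⟩
    H * G                           ≡⟨ ∏<-* K h g ⟨
    morris-num K A                  ∎
    where
    open ≡-Reasoning
    K : ℕ
    K = suc k
    aq y b h g p : ℕ → ℚ
    aq i = qpoch 1ℤ (A ℕ.+ i ℕ.* c)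
    y i  = qpoch 1ℤ (c′ ℕ.+ i ℕ.* c)
    b i  = qpoch (1ℤ ℤ.+ + (A ℕ.+ i ℕ.* c)) c′
    h i  = qpoch 1ℤ (A ℕ.+ c′ ℕ.+ i ℕ.* c)
    g m  = qpoch 1ℤ (suc m ℕ.* c)
    p i  = qpoch (ℤ.- + (A ℕ.+ i ℕ.* c)) A
    lem₁ : ∀ P B R Aq Y Q → P * (B * R) * (Aq * (Y * Q)) ≡ P * Y * (Aq * B) * (R * Q)
    lem₁ = solve-∀ ℚring
    lem₂ : ∀ P Y H X G → P * Y * H * (X * G) ≡ P * (X * Y) * (H * G)
    lem₂ = solve-∀ ℚring
    lem₃ : ∀ a b c → a * b * c ≡ b * (a * c)
    lem₃ = solve-∀ ℚring
    T : ℕ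
    T = A ℕ.+ K ℕ.* c
    νs : List ℤ
    νs = nodes (Vec.toList (special K A))
    interpolation : Σ (List (ℤ × ℚ)) λ ws → (map proj₁ ws ≡ νs) × Interpolates T T νs ws ×
      HasCT K (kernel A T (Vec.toList (special K A))) (weightedₖ ws K (integrand A))
    interpolation = interpolate-kernel A T K ℕ.≤-refl (special K A)
      (subst (AllPairs _≢_) (sym (special-nodes k A)) (interval-distinct (+ (A ℕ.+ k ℕ.* c)) (K ℕ.* c)))
    ws : List (ℤ × ℚ)
    ws = proj₁ interpolation
    ws-nodes : map proj₁ ws ≡ νs
    ws-nodes = proj₁ (proj₂ interpolation)
    inN : All (InNodes (special K A) ∘ proj₁) ws
    inN = All.map⁻ (subst (All (InNodes (special K A))) (sym ws-nodes) (nodes-index (special K A)))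
    selection : Selection A k {InNodes (special K A)} {ws} inN {T} {T} {K ℕ.* c} refl (trans ws-nodes (special-nodes k A))
      (subst (λ l → Interpolates T T l ws) (special-nodes k A) (proj₁ (proj₂ (proj₂ interpolation)))) K 0
    selection = select A k {InNodes (special K A)} {ws} inN {T} {T} {K ℕ.* c} refl (trans ws-nodes (special-nodes k A))
      (subst (λ l → Interpolates T T l ws) (special-nodes k A) (proj₁ (proj₂ (proj₂ interpolation)))) K 0 refl
    open Selection selection
    P Aq Y Q B R H G X Pol : ℚ
    P   = scale
    Aq  = ∏< K aq
    Y   = ∏< K y
    Q   = ∏< K (λ _ → qpoch 1ℤ c)
    B   = ∏< K b
    R   = pairs (survivors A K 0)
    H   = ∏< K h
    G   = ∏< K g
    X   = ∏< K (λ m → qpoch (ℤ.- + (m ℕ.* c)) (m ℕ.* c))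
    Pol = ∏< K p
    PXY : P * (X * Y) ≡ 1ℚ
    PXY = trans (cong (P *_) (sym (trans (∏<-* K (λ i → qpoch (ℤ.- + index A k i) (index A k i)) y)
      (cong (_* Y) (∏<-reverse k (λ m → qpoch (ℤ.- + (m ℕ.* c)) (m ℕ.* c))))))) scale-inv
    AB : Aq * B ≡ H
    AB = trans (sym (∏<-* K aq b)) (∏<-cong K (λ i _ → trans (sym (qpoch-+ 1ℤ (A ℕ.+ i ℕ.* c) c′))
      (cong (qpoch 1ℤ) (trans (ℕ.+-assoc A (i ℕ.* c) c′) (trans (cong (A ℕ.+_) (ℕ.+-comm (i ℕ.* c) c′)) (sym (ℕ.+-assoc A c′ (i ℕ.* c))))))))
    -- The factors are `1 - q^(l-A-ic)` with `l < A`: the special parameters avoid the roots of the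
    -- product formula, which can therefore be solved for `κ`.
    Pol≢0 : Pol ≢ 0ℚ
    Pol≢0 = ∏<-≢0 K (λ i _ → qpoch-≢0 (ℤ.- + (A ℕ.+ i ℕ.* c)) A (λ l l<A eq →
      ℕ.<⇒≢ (ℕ.<-≤-trans l<A (ℕ.m≤m+n A (i ℕ.* c))) (ℤ.+-injective (ℤ.i-j≡0⇒i≡j (+ l) (+ (A ℕ.+ i ℕ.* c)) (trans (ℤ.+-comm (+ l) (ℤ.- + (A ℕ.+ i ℕ.* c))) eq)))))
    by-weights : weightedₖ ws K (integrand A) ≡ P * (Pol * B * R)
    by-weights = trans (weightedₖ-single {S = InNodes (special K A)} inN chosen (integrand A) isolated
        (λ v ns → subst (λ t → v ≡ t ⊎ integrand A v ≡ 0ℚ) (sym points) (only-survivor A K v ns)))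
      (trans (scaled (integrand A (Vec.map proj₁ chosen))) (cong (λ t → P * t) (trans (cong (integrand A) points)
        (cong (_* R) (trans (∏ᵥ-survivors (factor₁ A) A K 0) (∏<-* K p b))))))
    -- Two evaluations of the same kernel. The symbols `(1/u_i)_A` at the survivors coincide with
    -- the symbols `(y_j)_A` of the product formula, so `Pol` appears on both sides and cancels.
    κ-eq : κ ≡ P * (B * R)
    κ-eq = cancelˡ Pol Pol≢0 (trans (ℚ.*-comm Pol κ) (trans (cong (κ *_) (sym (poles-special K A)))
      (trans (ct-unique (kernel-ct K A T (Vec.toList (special K A)) (ℕ.≤-reflexive (length-special K A)) ℕ.≤-refl ct)
               (subst (HasCT K (kernel A T (Vec.toList (special K A)))) by-weights (proj₂ (proj₂ (proj₂ interpolation)))))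
        (trans (lem₄ P Pol B R) refl))))
      where
      lem₄ : ∀ P o B R → P * (o * B * R) ≡ o * (P * (B * R))
      lem₄ = solve-∀ ℚring

-- The levels `z^(s)`, their variables and their exponents.

module Levels (c′ : ℕ) where

  open ℚ₀ using (_+_; _*_; _-_; -_)

  -- This is `binom(m, 2)`.
  tri : ℕ → ℕ
  tri zero    = 0
  tri (suc m) = m ℕ.+ tri m

  tri-square : ∀ m → tri m ℕ.+ tri (suc m) ≡ m ℕ.* m
  tri-square zero    = refl
  tri-square (suc m) = trans (lem m (tri m)) (trans (cong (λ z → z ℕ.+ m ℕ.+ suc m) (tri-square m)) (lem′ m))
    where
    open import Data.Nat.Tactic.RingSolver renaming (solve-∀ to ℕ-solve-∀)
    lem : ∀ m t → m ℕ.+ t ℕ.+ (suc m ℕ.+ (m ℕ.+ t)) ≡ t ℕ.+ (m ℕ.+ t) ℕ.+ m ℕ.+ suc m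
    lem = ℕ-solve-∀
    lem′ : ∀ m → m ℕ.* m ℕ.+ m ℕ.+ suc m ≡ suc m ℕ.* suc m
    lem′ = ℕ-solve-∀

  -- The exponent e = b + 1 - c, and binom(e + 1, 2).
  excess : ℕ → ℤ
  excess b = + b ℤ.- + c′

  triℤ : ℤ → ℕ
  triℤ (+ m)    = tri (suc m)
  triℤ -[1+ m ] = tri (suc m)

  Level : Set
  Level = ℕ × ℕ

  size : List Level → ℕ
  size []             = 0
  size ((k , _) ∷ ls) = k ℕ.+ size ls

  segment : (k : ℕ) → (ℕ → ℤ) → Vec ℤ k
  segment zero    X = []
  segment (suc k) X = X 0 ∷ segment k (X ∘ suc)

  leading : (ls : List Level) → (ℕ → ℤ) → List ℤ
  leading []             X = []
  leading ((k , _) ∷ ls) X = Vec.toList (segment k X)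

  drop : ℕ → (ℕ → ℤ) → (ℕ → ℤ)
  drop k X i = X (k ℕ.+ i)

  coordinate : ∀ {n} → Vec ℤ n → ℕ → ℤ
  coordinate []      _       = 0ℤ
  coordinate (x ∷ v) zero    = x
  coordinate (x ∷ v) (suc i) = coordinate v i

  c : ℕ
  c = suc c′

  Admissible : ℕ → List Level → Set
  Admissible A []             = ⊤
  Admissible A ((k , b) ∷ ls) = c′ ℕ.≤ A ℕ.+ b × (∀ X → length (leading ls X) ℕ.≤ k) × Admissible (A ℕ.+ b ℕ.∸ c′) ls

  -- The largest truncation order `A + k c` that the interpolation requires on any level, `A` being
  -- the parameter after the shift.
  bound : ℕ → List Level → ℕ
  bound A []             = 0
  bound A ((k , b) ∷ ls) = (A ℕ.+ b ℕ.∸ c′ ℕ.+ k ℕ.* c) ℕ.⊔ bound (A ℕ.+ b ℕ.∸ c′) ls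

  segment-++ : ∀ {k l} (u : Vec ℤ k) (v : Vec ℤ l) → segment k (coordinate (u Vec.++ v)) ≡ u
  segment-++ []      v = refl
  segment-++ (x ∷ u) v = cong (x ∷_) (segment-++ u v)

  coordinate-++ : ∀ {k l} (u : Vec ℤ k) (v : Vec ℤ l) i → drop k (coordinate (u Vec.++ v)) i ≡ coordinate v i
  coordinate-++ []      v i = refl
  coordinate-++ (x ∷ u) v i = coordinate-++ u v i

  segment-cong : ∀ k {X X′ : ℕ → ℤ} → (∀ i → X i ≡ X′ i) → segment k X ≡ segment k X′
  segment-cong zero    eq = refl
  segment-cong (suc k) eq = cong₂ _∷_ (eq 0) (segment-cong k (eq ∘ suc))

  leading-cong : ∀ ls {X X′ : ℕ → ℤ} → (∀ i → X i ≡ X′ i) → leading ls X ≡ leading ls X′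
  leading-cong []             eq = refl
  leading-cong ((k , _) ∷ ls) eq = cong Vec.toList (segment-cong k eq)

  levels : (ℕ → ℕ) → (ℕ → ℕ) → ℕ → ℕ → List Level
  levels k b s zero    = []
  levels k b s (suc m) = (k s , b s) ∷ levels k b (suc s) m

-- The substitution that brings a level to the normal form of the kernel.

module LevelShift (C : Character) (c′ : ℕ) where

  open ℚ₀ using (_+_; _*_; _-_; -_)
  open Character C
  open Kernel C c′
  open Levels c′ hiding (c)
  open SurvivorPairs C c′ using (qpoch-+)

  -- The reversal formula for q-Pochhammer symbols: every factor is turned over by
  -- `1 - x = - x (1 - 1/x)`, and the monomials collect into a sign and a power of `q`.
  reflect : ∀ u m → qpoch (1ℤ ℤ.+ u ℤ.- + m) m ≡ pow (- 1ℚ) m * qp (+ m ℤ.* u ℤ.- + tri m) * qpoch (ℤ.- u) m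
  reflect u zero    = trans (sym (cong (λ z → 1ℚ * z * 1ℚ) (trans (cong qp (lem u)) qp-0))) refl
    where
    lem : ∀ u → 0ℤ ℤ.* u ℤ.- 0ℤ ≡ 0ℤ
    lem = ℤR.solve-∀
  reflect u (suc m) = begin
    θ (1ℤ ℤ.+ u ℤ.- + suc m ℤ.+ 0ℤ) * ∏< m (λ l → θ (1ℤ ℤ.+ u ℤ.- + suc m ℤ.+ + suc l))
      ≡⟨ cong₂ _*_ (cong θ (lem₁ u (+ m))) (∏<-cong m (λ l _ → cong θ (lem₂ u (+ m) (+ l)))) ⟩
    θ (u ℤ.- + m) * qpoch (1ℤ ℤ.+ u ℤ.- + m) m
      ≡⟨ cong₂ _*_ θ-flip (reflect u m) ⟩
    - 1ℚ * qp (u ℤ.- + m) * θ (ℤ.- u ℤ.+ + m) * (pow (- 1ℚ) m * qp (+ m ℤ.* u ℤ.- + tri m) * qpoch (ℤ.- u) m)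
      ≡⟨ lem₃ (qp (u ℤ.- + m)) (θ (ℤ.- u ℤ.+ + m)) (pow (- 1ℚ) m) (qp (+ m ℤ.* u ℤ.- + tri m)) (qpoch (ℤ.- u) m) ⟩
    - 1ℚ * pow (- 1ℚ) m * (qp (u ℤ.- + m) * qp (+ m ℤ.* u ℤ.- + tri m)) * (qpoch (ℤ.- u) m * θ (ℤ.- u ℤ.+ + m))
      ≡⟨ cong₂ (λ a b → - 1ℚ * pow (- 1ℚ) m * a * b) (trans (sym (qp-+ _ _)) (cong qp (lem₄ u (+ m) (+ tri m)))) (sym (∏<-snoc m _)) ⟩
    - 1ℚ * pow (- 1ℚ) m * qp (+ suc m ℤ.* u ℤ.- + tri (suc m)) * qpoch (ℤ.- u) (suc m) ∎
    where
    open ≡-Reasoning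
    lem₁ : ∀ u m → 1ℤ ℤ.+ u ℤ.- (1ℤ ℤ.+ m) ℤ.+ 0ℤ ≡ u ℤ.- m
    lem₁ = ℤR.solve-∀
    lem₂ : ∀ u m l → 1ℤ ℤ.+ u ℤ.- (1ℤ ℤ.+ m) ℤ.+ (1ℤ ℤ.+ l) ≡ 1ℤ ℤ.+ u ℤ.- m ℤ.+ l
    lem₂ = ℤR.solve-∀
    lem₃ : ∀ q t p r b → - 1ℚ * q * t * (p * r * b) ≡ - 1ℚ * p * (q * r) * (b * t)
    lem₃ = solve-∀ ℚring
    lem₄ : ∀ u m t → (u ℤ.- m) ℤ.+ (m ℤ.* u ℤ.- t) ≡ (1ℤ ℤ.+ m) ℤ.* u ℤ.- (m ℤ.+ t)
    lem₄ = ℤR.solve-∀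
    lem₅ : ∀ a b → a * b ≡ 1ℚ → 1ℚ - a ≡ - 1ℚ * a * (1ℚ - b)
    lem₅ a b eq = trans (cong (_- a) (sym eq)) (lem a b)
      where
      lem : ∀ a b → a * b - a ≡ - 1ℚ * a * (1ℚ - b)
      lem = solve-∀ ℚring
    θ-flip : θ (u ℤ.- + m) ≡ - 1ℚ * qp (u ℤ.- + m) * θ (ℤ.- u ℤ.+ + m)
    θ-flip = lem₅ (qp (u ℤ.- + m)) (qp (ℤ.- u ℤ.+ + m)) (trans (sym (qp-+ _ _)) (trans (cong qp (lem u (+ m))) qp-0))
      where
      lem : ∀ u m → u ℤ.- m ℤ.+ (ℤ.- u ℤ.+ m) ≡ 0ℤ
      lem = ℤR.solve-∀

  constant : ℕ → ℚ
  constant b = pow (- 1ℚ) ℤ.∣ excess b ∣ * qp (+ triℤ (excess b))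

  levelFactor : ℕ → ℕ → ℤ → ℚ
  levelFactor A b z = qpoch (ℤ.- z) A * qpoch (1ℤ ℤ.+ z) b * qp (ℤ.- (excess b ℤ.* z))

  -- The sign of `e` decides which symbol is too long. For `e ≥ 0`, `e` factors of `(q z)_b` are
  -- reversed and prolong `(1/z)_A`; for `e < 0`, `-e` factors of `(1/z)_A` are reversed and prolong
  -- `(q z)_b`. In both cases the monomial cancels the power of `z`.
  levelFactor-shift : ∀ A b A′ → A ℕ.+ b ≡ A′ ℕ.+ c′ → ∀ z → levelFactor A b z ≡ constant b * factor₁ A′ (z ℤ.+ excess b)
  levelFactor-shift A b A′ eq z with c′ ℕ.≤? b
  ... | yes c′≤b = subst₂ (λ e A′ → qpoch (ℤ.- z) A * qpoch (1ℤ ℤ.+ z) b * qp (ℤ.- (e ℤ.* z)) ≡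
         pow (- 1ℚ) ℤ.∣ e ∣ * qp (+ triℤ e) * factor₁ A′ (z ℤ.+ e)) (sym e≡) (sym A′≡) main
    where
    m : ℕ
    m = b ℕ.∸ c′
    e≡ : excess b ≡ + m
    e≡ = trans (ℤ.m-n≡m⊖n b c′) (ℤ.⊖-≥ c′≤b)
    A′≡ : A′ ≡ m ℕ.+ A
    A′≡ = ℕ.+-cancelʳ-≡ c′ A′ (m ℕ.+ A) (trans (sym eq) (trans (cong (A ℕ.+_) (sym (ℕ.m∸n+n≡m c′≤b)))
      (trans (sym (ℕ.+-assoc A m c′)) (cong (ℕ._+ c′) (ℕ.+-comm A m)))))
    u : ℤ
    u = z ℤ.+ + m
    open ≡-Reasoning
    s : ℚ
    s = pow (- 1ℚ) m
    main : qpoch (ℤ.- z) A * qpoch (1ℤ ℤ.+ z) b * qp (ℤ.- (+ m ℤ.* z)) ≡ s * qp (+ tri (suc m)) * factor₁ (m ℕ.+ A) u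
    main = begin
      qpoch (ℤ.- z) A * qpoch (1ℤ ℤ.+ z) b * qp (ℤ.- (+ m ℤ.* z))
        ≡⟨ cong₂ (λ x y → x * y * qp (ℤ.- (+ m ℤ.* z))) (cong (λ x → qpoch x A) (l₁ z (+ m)))
             (trans (cong (qpoch (1ℤ ℤ.+ z)) (sym (ℕ.m+[n∸m]≡n {m} {b} (ℕ.m∸n≤m b c′)))) (trans (cong (λ x → qpoch (1ℤ ℤ.+ z) (m ℕ.+ x)) (ℕ.m∸[m∸n]≡n c′≤b)) (qpoch-+ (1ℤ ℤ.+ z) m c′))) ⟩
      qpoch (ℤ.- u ℤ.+ + m) A * (qpoch (1ℤ ℤ.+ z) m * qpoch (1ℤ ℤ.+ z ℤ.+ + m) c′) * qp (ℤ.- (+ m ℤ.* z))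
        ≡⟨ cong₂ (λ x y → qpoch (ℤ.- u ℤ.+ + m) A * (x * y) * qp (ℤ.- (+ m ℤ.* z)))
             (trans (cong (λ x → qpoch x m) (l₂ z (+ m))) (reflect u m)) (cong (λ x → qpoch x c′) (ℤ.+-assoc 1ℤ z (+ m))) ⟩
      qpoch (ℤ.- u ℤ.+ + m) A * (s * qp (+ m ℤ.* u ℤ.- + tri m) * qpoch (ℤ.- u) m * qpoch (1ℤ ℤ.+ u) c′) * qp (ℤ.- (+ m ℤ.* z))
        ≡⟨ l₃ _ s _ (qpoch (ℤ.- u) m) (qpoch (1ℤ ℤ.+ u) c′) _ ⟩
      s * (qp (+ m ℤ.* u ℤ.- + tri m) * qp (ℤ.- (+ m ℤ.* z))) * (qpoch (ℤ.- u) m * qpoch (ℤ.- u ℤ.+ + m) A * qpoch (1ℤ ℤ.+ u) c′)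
        ≡⟨ cong₂ (λ x y → s * x * (y * qpoch (1ℤ ℤ.+ u) c′)) (trans (sym (qp-+ _ _)) (cong qp expo)) (sym (qpoch-+ (ℤ.- u) m A)) ⟩
      s * qp (+ tri (suc m)) * factor₁ (m ℕ.+ A) u ∎
      where
      l₁ : ∀ z m → ℤ.- z ≡ ℤ.- (z ℤ.+ m) ℤ.+ m
      l₁ = ℤR.solve-∀
      l₂ : ∀ z m → 1ℤ ℤ.+ z ≡ 1ℤ ℤ.+ (z ℤ.+ m) ℤ.- m
      l₂ = ℤR.solve-∀
      l₃ : ∀ a s q b d r → a * (s * q * b * d) * r ≡ s * (q * r) * (b * a * d)
      l₃ = solve-∀ ℚring
      l₄ : ∀ m z t → m ℤ.* (z ℤ.+ m) ℤ.- t ℤ.+ ℤ.- (m ℤ.* z) ≡ m ℤ.* m ℤ.- t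
      l₄ = ℤR.solve-∀
      l₅ : ∀ t t′ → t ℤ.+ t′ ℤ.- t ≡ t′
      l₅ = ℤR.solve-∀
      expo : + m ℤ.* u ℤ.- + tri m ℤ.+ ℤ.- (+ m ℤ.* z) ≡ + tri (suc m)
      expo = trans (l₄ (+ m) z (+ tri m)) (trans (cong (ℤ._- + tri m) (trans (sym (ℤ.pos-* m m)) (cong +_ (sym (tri-square m))))) (l₅ (+ tri m) (+ tri (suc m))))
  ... | no c′≰b with ℕ.m≤n⇒∃[o]m+o≡n (ℕ.≰⇒> c′≰b)
  ...   | o , bo = subst₂ (λ e A → qpoch (ℤ.- z) A * qpoch (1ℤ ℤ.+ z) b * qp (ℤ.- (e ℤ.* z)) ≡
         pow (- 1ℚ) ℤ.∣ e ∣ * qp (+ triℤ e) * factor₁ A′ (z ℤ.+ e)) (sym e≡) (sym A≡) main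
    where
    m : ℕ
    m = suc o
    c′≡ : c′ ≡ m ℕ.+ b
    c′≡ = trans (sym bo) (cong suc (ℕ.+-comm b o))
    e≡ : excess b ≡ ℤ.- + m
    e≡ = trans (cong (λ z → + b ℤ.- + z) c′≡) (lem (+ b) (+ m))
      where
      lem : ∀ b m → b ℤ.- (m ℤ.+ b) ≡ ℤ.- m
      lem = ℤR.solve-∀
    A≡ : A ≡ m ℕ.+ A′
    A≡ = ℕ.+-cancelʳ-≡ b A (m ℕ.+ A′) (trans eq (trans (cong (A′ ℕ.+_) c′≡) (trans (sym (ℕ.+-assoc A′ m b)) (cong (ℕ._+ b) (ℕ.+-comm A′ m)))))
    u : ℤ
    u = z ℤ.- + m
    open ≡-Reasoning
    s : ℚ
    s = pow (- 1ℚ) m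
    main : qpoch (ℤ.- z) (m ℕ.+ A′) * qpoch (1ℤ ℤ.+ z) b * qp (ℤ.- (ℤ.- + m ℤ.* z)) ≡ s * qp (+ tri m) * factor₁ A′ u
    main = begin
      qpoch (ℤ.- z) (m ℕ.+ A′) * qpoch (1ℤ ℤ.+ z) b * qp (ℤ.- (ℤ.- + m ℤ.* z))
        ≡⟨ cong (λ x → x * qpoch (1ℤ ℤ.+ z) b * qp (ℤ.- (ℤ.- + m ℤ.* z))) (trans (qpoch-+ (ℤ.- z) m A′)
             (cong₂ _*_ (trans (cong (λ x → qpoch x m) (l₁ z (+ m))) (reflect (ℤ.- u ℤ.- 1ℤ) m)) (cong (λ x → qpoch x A′) (l₂ z (+ m))))) ⟩
      s * Q * qpoch (ℤ.- (ℤ.- u ℤ.- 1ℤ)) m * qpoch (ℤ.- u) A′ * qpoch (1ℤ ℤ.+ z) b * qp (ℤ.- (ℤ.- + m ℤ.* z))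
        ≡⟨ l₃ s Q _ (qpoch (ℤ.- u) A′) (qpoch (1ℤ ℤ.+ z) b) _ ⟩
      s * (Q * qp (ℤ.- (ℤ.- + m ℤ.* z))) * (qpoch (ℤ.- u) A′ * (qpoch (ℤ.- (ℤ.- u ℤ.- 1ℤ)) m * qpoch (1ℤ ℤ.+ z) b))
        ≡⟨ cong₂ (λ x y → s * x * (qpoch (ℤ.- u) A′ * y)) (trans (sym (qp-+ _ _)) (cong qp expo))
             (trans (cong₂ (λ x y → qpoch x m * qpoch y b) (l₆ u) (l₇ z (+ m))) (trans (sym (qpoch-+ (1ℤ ℤ.+ u) m b)) (cong (qpoch (1ℤ ℤ.+ u)) (sym c′≡)))) ⟩
      s * qp (+ tri m) * factor₁ A′ u ∎
      where
      Q : ℚ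
      Q = qp (+ m ℤ.* (ℤ.- u ℤ.- 1ℤ) ℤ.- + tri m)
      l₁ : ∀ z m → ℤ.- z ≡ 1ℤ ℤ.+ (ℤ.- (z ℤ.- m) ℤ.- 1ℤ) ℤ.- m
      l₁ = ℤR.solve-∀
      l₂ : ∀ z m → ℤ.- z ℤ.+ m ≡ ℤ.- (z ℤ.- m)
      l₂ = ℤR.solve-∀
      l₃ : ∀ s q b a d r → s * q * b * a * d * r ≡ s * (q * r) * (a * (b * d))
      l₃ = solve-∀ ℚring
      l₆ : ∀ u → ℤ.- (ℤ.- u ℤ.- 1ℤ) ≡ 1ℤ ℤ.+ u
      l₆ = ℤR.solve-∀
      l₇ : ∀ z m → 1ℤ ℤ.+ z ≡ 1ℤ ℤ.+ (z ℤ.- m) ℤ.+ m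
      l₇ = ℤR.solve-∀
      l₄ : ∀ m z t → m ℤ.* (ℤ.- (z ℤ.- m) ℤ.- 1ℤ) ℤ.- t ℤ.+ ℤ.- (ℤ.- m ℤ.* z) ≡ m ℤ.* m ℤ.- m ℤ.- t
      l₄ = ℤR.solve-∀
      l₅ : ∀ m t → t ℤ.+ (m ℤ.+ t) ℤ.- m ℤ.- t ≡ t
      l₅ = ℤR.solve-∀
      expo : + m ℤ.* (ℤ.- u ℤ.- 1ℤ) ℤ.- + tri m ℤ.+ ℤ.- (ℤ.- + m ℤ.* z) ≡ + tri m
      expo = trans (l₄ (+ m) z (+ tri m)) (trans (cong (λ x → x ℤ.- + m ℤ.- + tri m) (trans (sym (ℤ.pos-* m m)) (cong +_ (sym (tri-square m))))) (l₅ (+ m) (+ tri m)))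

-- Elimination of the levels, one after the other.

module Chain (C : Character) (c′ : ℕ) where

  open ℚ₀ using (_+_; _*_; _-_; -_)
  open Character C
  open ConstantTerm₁ C
  open ConstantTerm C
  open Interpolation C
  open Kernel C c′
  open Vanishing C c′ using (kernel)
  open ProductFormula C c′ using (kernel-ct; poles; integrand-ct)
  open Levels c′ hiding (c)
  open LevelShift C c′
  open Morris C c′ using (morris; morris-num; morris-den)
  open import Data.List.Properties using (length-map)

  level : ∀ {k} → ℕ → ℕ → ℕ → Vec ℤ k → List ℤ → ℚ
  level T A b v y = ∏ᵥ (levelFactor A b) v * pairs v * ∏ᵥ (λ z → Γ T (map (ℤ.-_) y) (z ℤ.+ excess b)) v

  -- Only the first level carries `(1/z)_A`, in accordance with `a_s = 0` for `s > 1`; eliminating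
  -- it creates such a factor on the next level, with a new `A`.
  chain : ℕ → ℕ → List Level → (ℕ → ℤ) → ℚ
  chain T A []             X = 1ℚ
  chain T A ((k , b) ∷ ls) X =
    level T A b (segment k X) (leading ls (drop k X)) * chain T 0 ls (drop k X)

  ∏-toList : ∀ {k} f (v : Vec ℤ k) → ∏ f (Vec.toList v) ≡ ∏ᵥ f v
  ∏-toList f []      = refl
  ∏-toList f (x ∷ v) = cong (f x *_) (∏-toList f v)

  -- The parameters are the inverses of the next variables, so the product `(y_j)_A` left by an
  -- elimination is the factor `(1/z)_A` that the next level lacks.
  chain-prefactor : ∀ T A ls X → poles A (map (ℤ.-_) (leading ls X)) * chain T 0 ls X ≡ chain T A ls X
  chain-prefactor T A []             X = ℚ.*-identityˡ 1ℚ
  chain-prefactor T A ((k , b) ∷ ls) X = trans (cong (_* chain T 0 ((k , b) ∷ ls) X)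
      (trans (∏-map (λ η → qpoch η A) (ℤ.-_) (Vec.toList (segment k X))) (∏-toList (λ z → qpoch (ℤ.- z) A) (segment k X))))
    (trans (lem (∏ᵥ (λ z → qpoch (ℤ.- z) A) (segment k X)) (∏ᵥ (levelFactor 0 b) (segment k X)) (pairs (segment k X)) _ (chain T 0 ls (drop k X)))
      (cong (λ a → a * pairs (segment k X) * ∏ᵥ (λ z → Γ T (map (ℤ.-_) (leading ls (drop k X))) (z ℤ.+ excess b)) (segment k X) * chain T 0 ls (drop k X))
        (trans (sym (∏ᵥ-* _ _ (segment k X))) (∏ᵥ-cong (λ z → lem′ (qpoch (ℤ.- z) A) (qpoch (1ℤ ℤ.+ z) b) _) (segment k X)))))
    where
    lem : ∀ a b c d e → a * (b * c * d * e) ≡ a * b * c * d * e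
    lem = solve-∀ ℚring
    lem′ : ∀ a b c → a * (1ℚ * b * c) ≡ a * b * c
    lem′ = solve-∀ ℚring

  ∏ᵥ-map : ∀ {k} f (g : ℤ → ℤ) (v : Vec ℤ k) → ∏ᵥ f (Vec.map g v) ≡ ∏ᵥ (f ∘ g) v
  ∏ᵥ-map f g []      = refl
  ∏ᵥ-map f g (x ∷ v) = cong (f (g x) *_) (∏ᵥ-map f g v)

  pairs-shift : ∀ {k} e (v : Vec ℤ k) → pairs (Vec.map (ℤ._+ e) v) ≡ pairs v
  pairs-shift e []      = refl
  pairs-shift e (x ∷ v) = cong₂ _*_ (trans (∏ᵥ-map (pair (x ℤ.+ e)) (ℤ._+ e) v) (∏ᵥ-cong (λ y →
      cong₂ (λ a b → qpoch a c * qpoch (1ℤ ℤ.+ b) c) (lem x y e) (lem y x e)) v)) (pairs-shift e v)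
    where
    lem : ∀ x y e → x ℤ.+ e ℤ.- (y ℤ.+ e) ≡ x ℤ.- y
    lem = ℤR.solve-∀

  ∏ᵥ-const : ∀ {k} a (v : Vec ℤ k) → ∏ᵥ (λ _ → a) v ≡ pow a k
  ∏ᵥ-const a []      = refl
  ∏ᵥ-const a (_ ∷ v) = cong (a *_) (∏ᵥ-const a v)

  level-kernel : ∀ T A b A′ → A ℕ.+ b ≡ A′ ℕ.+ c′ → ∀ y {k} (v : Vec ℤ k) →
    ∏ᵥ (levelFactor A b) v * pairs v * ∏ᵥ (λ z → Γ T y (z ℤ.+ excess b)) v ≡
    pow (constant b) k * kernel A′ T y (Vec.map (ℤ._+ excess b) v)
  level-kernel T A b A′ eq y {k} v = trans (cong₂ (λ a d → a * d * ∏ᵥ (λ z → Γ T y (z ℤ.+ excess b)) v)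
      (trans (∏ᵥ-cong (levelFactor-shift A b A′ eq) v) (trans (∏ᵥ-* _ _ v) (cong₂ _*_ (∏ᵥ-const (constant b) v) (sym (∏ᵥ-map (factor₁ A′) (ℤ._+ excess b) v)))))
      (sym (pairs-shift (excess b) v)))
    (trans (cong (λ a → pow (constant b) k * ∏ᵥ (factor₁ A′) w * pairs w * a) (sym (∏ᵥ-map (Γ T y) (ℤ._+ excess b) v)))
      (lem (pow (constant b) k) (∏ᵥ (factor₁ A′) w) (pairs w) _))
    where
    w : Vec ℤ k
    w = Vec.map (ℤ._+ excess b) v
    lem : ∀ a b c d → a * b * c * d ≡ a * (b * c * d)
    lem = solve-∀ ℚring

  chain-num chain-den : ℕ → List Level → ℚ
  chain-num A []             = 1ℚ
  chain-num A ((k , b) ∷ ls) = pow (constant b) k * morris-num k (A ℕ.+ b ℕ.∸ c′) * chain-num (A ℕ.+ b ℕ.∸ c′) ls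
  chain-den A []             = 1ℚ
  chain-den A ((k , b) ∷ ls) = morris-den k (A ℕ.+ b ℕ.∸ c′) * chain-den (A ℕ.+ b ℕ.∸ c′) ls

  chain-cong : ∀ T A ls {X X′ : ℕ → ℤ} → (∀ i → X i ≡ X′ i) → chain T A ls X ≡ chain T A ls X′
  chain-cong T A []             eq = refl
  chain-cong T A ((k , b) ∷ ls) eq = cong₂ _*_
    (cong₂ (level T A b) (segment-cong k eq) (leading-cong ls (λ i → eq (k ℕ.+ i))))
    (chain-cong T 0 ls (λ i → eq (k ℕ.+ i)))

  -- A translation of the exponents scales each variable by a power of `q` and leaves the constant
  -- term alone, so the product formula applies after `level-kernel`; `chain-prefactor` absorbs what
  -- it leaves behind.
  split-ct : ∀ T A k b ls → c′ ℕ.≤ A ℕ.+ b → (∀ X → length (leading ls X) ℕ.≤ k) → A ℕ.+ b ℕ.∸ c′ ℕ.+ k ℕ.* c ℕ.≤ T →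
             ∀ {l μ} → HasCT k (integrand (A ℕ.+ b ℕ.∸ c′)) μ → (v : Vec ℤ l) →
             HasCT k (λ u → chain T A ((k , b) ∷ ls) (coordinate (u Vec.++ v)))
                     (pow (constant b) k * μ * chain T (A ℕ.+ b ℕ.∸ c′) ls (coordinate v))
  split-ct T A k b ls c′≤ next≤k T≥ {l} {μ} μ-ct v = ct-ext step (subst (HasCT k (λ u → (F * D) * kernel A′ T y (Vec.map (ℤ._+ excess b) u))) value
      (ct-scale (F * D) (ct-shift {k} {kernel A′ T y} (excess b)
        (kernel-ct k A′ T y (subst (ℕ._≤ k) (sym (length-map (ℤ.-_) (leading ls (coordinate v)))) (next≤k (coordinate v))) T≥ μ-ct))))
    where
    A′ : ℕ
    A′ = A ℕ.+ b ℕ.∸ c′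
    y : List ℤ
    y = map (ℤ.-_) (leading ls (coordinate v))
    F D : ℚ
    F = chain T 0 ls (coordinate v)
    D = pow (constant b) k
    value : F * D * (μ * poles A′ y) ≡ D * μ * chain T A′ ls (coordinate v)
    value = trans (lem₁ F D μ (poles A′ y)) (cong (D * μ *_) (chain-prefactor T A′ ls (coordinate v)))
      where
      lem₁ : ∀ a b c d → a * b * (c * d) ≡ b * c * (d * a)
      lem₁ = solve-∀ ℚring
    step : ∀ (u : Vec ℤ k) → chain T A ((k , b) ∷ ls) (coordinate (u Vec.++ v)) ≡ F * D * kernel A′ T y (Vec.map (ℤ._+ excess b) u)
    step u = trans (cong₂ _*_ (cong₂ (level T A b) (segment-++ u v) (leading-cong ls (coordinate-++ u v))) (chain-cong T 0 ls (coordinate-++ u v)))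
      (trans (cong (_* F) (level-kernel T A b A′ (sym (ℕ.m∸n+n≡m c′≤)) y u))
        (lem₂ D (kernel A′ T y (Vec.map (ℤ._+ excess b) u)) F))
      where
      lem₂ : ∀ a b c → a * b * c ≡ c * a * b
      lem₂ = solve-∀ ℚring

  record ChainCT (T A : ℕ) (ls : List Level) : Set where
    field
      value    : ℚ
      value-ct : HasCT (size ls) (λ v → chain T A ls (coordinate v)) value
      equation : value * chain-den A ls ≡ chain-num A ls

  chain-ct : ∀ T A ls → Admissible A ls → bound A ls ℕ.≤ T → ChainCT T A ls
  chain-ct T A []             _ _ = record { value = 1ℚ ; value-ct = ct-[] refl ; equation = ℚ.*-identityˡ 1ℚ }
  chain-ct T A ((k , b) ∷ ls) (c′≤ , next≤k , adm) T≥ = record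
    { value    = D * μ * Rest.value
    ; value-ct = ct-++ k (λ v → D * μ * chain T A′ ls (coordinate v))
        (λ v → split-ct T A k b ls c′≤ next≤k (ℕ.m⊔n≤o⇒m≤o (A′ ℕ.+ k ℕ.* c) (bound A′ ls) T≥) μ-ct v)
        (ct-scale (D * μ) Rest.value-ct)
    ; equation = trans (lem D μ Rest.value (morris-den k A′) (chain-den A′ ls))
        (cong₂ (λ x y → D * x * y) (morris k A′ μ-ct) Rest.equation)
    }
    where
    A′ : ℕ
    A′ = A ℕ.+ b ℕ.∸ c′
    D μ : ℚ
    D = pow (constant b) k
    μ = proj₁ (integrand-ct k A′)
    μ-ct : HasCT k (integrand A′) μ
    μ-ct = proj₂ (integrand-ct k A′)
    module Rest = ChainCT (chain-ct T A′ ls adm (ℕ.m⊔n≤o⇒n≤o (A′ ℕ.+ k ℕ.* c) (bound A′ ls) T≥))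
    lem : ∀ a m k d e → a * m * k * (d * e) ≡ a * (m * d) * (k * e)
    lem = solve-∀ ℚring

-- Integers as rationals, signs, and the values `q = 2^(u+1)`.

module PowersOfTwo where

  open ℚ₀ using (_+_; _*_; _-_; -_)
  open import Data.Rational.Literals using (fromℤ)
  import Data.Rational.Unnormalised as ℚᵘ
  import Data.Rational.Unnormalised.Properties as ℚᵘ

  ι : ℤ → ℚ
  ι = fromℤ

  ι-+ : ∀ a b → ι (a ℤ.+ b) ≡ ι a + ι b
  ι-+ a b = ℚ.toℚᵘ-injective (ℚᵘ.≃-trans (ℚᵘ.*≡* (lem a b)) (ℚᵘ.≃-sym (ℚ.toℚᵘ-homo-+ (ι a) (ι b))))
    where
    lem : ∀ a b → (a ℤ.+ b) ℤ.* 1ℤ ≡ (a ℤ.* 1ℤ ℤ.+ b ℤ.* 1ℤ) ℤ.* 1ℤ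
    lem = ℤR.solve-∀

  ι-* : ∀ a b → ι (a ℤ.* b) ≡ ι a * ι b
  ι-* a b = ℚ.toℚᵘ-injective (ℚᵘ.≃-trans (ℚᵘ.*≡* refl) (ℚᵘ.≃-sym (ℚ.toℚᵘ-homo-* (ι a) (ι b))))

  ι-neg : ∀ a → ι (ℤ.- a) ≡ - ι a
  ι-neg a = a-b≡0⇒a≡b (trans (lem (ι (ℤ.- a)) (ι a)) (trans (sym (ι-+ (ℤ.- a) a)) (cong ι (ℤ.+-inverseˡ a))))
    where
    lem : ∀ x y → x - (- y) ≡ x + y
    lem = solve-∀ ℚring

  ι-injective : ∀ {a b} → ι a ≡ ι b → a ≡ b
  ι-injective = cong ℚ₀.ℚ.numerator

  ι-sign : ∀ m → ι (ℤ.-1ℤ ℤ.^ m) ≡ pow (- 1ℚ) m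
  ι-sign zero    = refl
  ι-sign (suc m) = trans (ι-* ℤ.-1ℤ (ℤ.-1ℤ ℤ.^ m)) (cong (- 1ℚ *_) (ι-sign m))

  pow-+ : ∀ b m n → pow b (m ℕ.+ n) ≡ pow b m * pow b n
  pow-+ b zero    n = sym (ℚ.*-identityˡ (pow b n))
  pow-+ b (suc m) n = trans (cong (b *_) (pow-+ b m n)) (sym (ℚ.*-assoc b (pow b m) (pow b n)))

  pow-* : ∀ b m n → pow b (m ℕ.* n) ≡ pow (pow b n) m
  pow-* b zero    n = refl
  pow-* b (suc m) n = trans (pow-+ b n (m ℕ.* n)) (cong (pow b n *_) (pow-* b m n))

  module Power (b b⁻¹ : ℚ) (b-inv : b * b⁻¹ ≡ 1ℚ) where

    zpow : ℤ → ℚ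
    zpow (+ n)    = pow b n
    zpow -[1+ n ] = pow b⁻¹ (suc n)

    zpow-⊖ : ∀ m n → zpow (m ℤ.⊖ n) ≡ pow b m * pow b⁻¹ n
    zpow-⊖ m       zero    = sym (ℚ.*-identityʳ (pow b m))
    zpow-⊖ zero    (suc n) = sym (ℚ.*-identityˡ (pow b⁻¹ (suc n)))
    zpow-⊖ (suc m) (suc n) = trans (cong zpow (ℤ.[1+m]⊖[1+n]≡m⊖n m n)) (trans (zpow-⊖ m n)
      (trans (sym (ℚ.*-identityˡ (pow b m * pow b⁻¹ n))) (trans (cong (_* (pow b m * pow b⁻¹ n)) (sym b-inv)) (interchange b b⁻¹ (pow b m) (pow b⁻¹ n)))))

    zpow-+ : ∀ x y → zpow (x ℤ.+ y) ≡ zpow x * zpow y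
    zpow-+ (+ m)    (+ n)    = pow-+ b m n
    zpow-+ (+ m)    -[1+ n ] = zpow-⊖ m (suc n)
    zpow-+ -[1+ m ] (+ n)    = trans (zpow-⊖ n (suc m)) (ℚ.*-comm (pow b n) (pow b⁻¹ (suc m)))
    zpow-+ -[1+ m ] -[1+ n ] = trans (cong (pow b⁻¹) (cong suc (sym (ℕ.+-suc m n)))) (pow-+ b⁻¹ (suc m) (suc n))

  open Power (- 1ℚ) (- 1ℚ) refl using () renaming (zpow to signℤ; zpow-+ to signℤ-+)

  sign : ℤ → ℚ
  sign x = pow (- 1ℚ) ℤ.∣ x ∣

  sign≡ : ∀ x → sign x ≡ signℤ x
  sign≡ (+ n)    = refl
  sign≡ -[1+ n ] = refl

  -- The absolute value in the exponent is not additive. As -1 is its own inverse, `sign` agrees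
  -- with a power with integer exponent, which is multiplicative.
  sign-+ : ∀ x y → sign (x ℤ.+ y) ≡ sign x * sign y
  sign-+ x y = trans (sign≡ (x ℤ.+ y)) (trans (signℤ-+ x y) (sym (cong₂ _*_ (sign≡ x) (sign≡ y))))

  sign-* : ∀ k x → sign (+ k ℤ.* x) ≡ pow (sign x) k
  sign-* k x = trans (cong (pow (- 1ℚ)) (ℤ.abs-* (+ k) x)) (pow-* (- 1ℚ) k ℤ.∣ x ∣)

  two : ℚ
  two = 1ℚ + 1ℚ

  open Power two ℚ₀.½ refl using () renaming (zpow to 2^_; zpow-+ to 2^-+) public

  2^≥1 : ∀ n → 1ℚ ℚ₀.≤ pow two n
  2^≥1 zero    = ℚ.≤-refl
  2^≥1 (suc n) = ℚ.≤-trans (ℚ.≤-trans (2^≥1 n) (ℚ.≤-trans (ℚ.≤-reflexive (sym (ℚ.+-identityˡ (pow two n))))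
      (ℚ.+-monoˡ-≤ (pow two n) (ℚ.≤-trans 0≤1 (2^≥1 n))))) (ℚ.≤-reflexive (lem (pow two n)))
    where
    0≤1 : 0ℚ ℚ₀.≤ 1ℚ
    0≤1 = ℚ.<⇒≤ (ℚ.positive⁻¹ 1ℚ)
    lem : ∀ p → p + p ≡ (1ℚ + 1ℚ) * p
    lem = solve-∀ ℚring

  2^>1 : ∀ n → 1ℚ ℚ₀.< pow two (suc n)
  2^>1 n = ℚ.≤-<-trans (2^≥1 n) (subst₂ ℚ₀._<_ (ℚ.+-identityˡ (pow two n)) (lem (pow two n))
      (ℚ.+-monoˡ-< (pow two n) (ℚ.<-≤-trans (ℚ.positive⁻¹ 1ℚ) (2^≥1 n))))
    where
    lem : ∀ p → p + p ≡ (1ℚ + 1ℚ) * p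
    lem = solve-∀ ℚring

  2^≢1 : ∀ a → a ≢ 0ℤ → 2^ a ≢ 1ℚ
  2^≢1 (+ zero)  a≢0 = ⊥-elim (a≢0 refl)
  2^≢1 (+ suc n) _   = λ eq → ℚ.<-irrefl (sym eq) (2^>1 n)
  2^≢1 -[1+ n ]  _   = λ eq → ℚ.<-irrefl (sym (trans (sym (ℚ.*-identityʳ (pow two (suc n)))) (trans (cong (pow two (suc n) *_) (sym eq))
     (trans (sym (2^-+ (+ suc n) -[1+ n ])) (cong 2^_ (ℤ.+-inverseʳ (+ suc n))))))) (2^>1 n)

  -- q = 2^(u+1); the equality of Laurent polynomials in q is tested at these values.
  powerOfTwo : ℕ → Character
  powerOfTwo u = record
    { qp   = λ a → 2^ (+ suc u ℤ.* a)
    ; qp-+ = λ a b → trans (cong 2^_ (ℤ.*-distribˡ-+ (+ suc u) a b)) (2^-+ (+ suc u ℤ.* a) (+ suc u ℤ.* b))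
    ; qp-0 = cong 2^_ (ℤ.*-zeroʳ (+ suc u))
    ; qp≢1 = λ a a≢0 → 2^≢1 (+ suc u ℤ.* a) (λ eq → a≢0 (ℤ.*-cancelˡ-≡ (+ suc u) a 0ℤ (trans eq (sym (ℤ.*-zeroʳ (+ suc u))))))
    }

open PowersOfTwo

-- Evaluation of formal Laurent polynomials at powers of `q`.

module Evaluation (C : Character) where

  open ℚ₀ using (_+_; _*_; _-_; -_)
  open Character C
  open ConstantTerm₁ C
  open ConstantTerm C
  open import Defs
  open import Data.Vec.Properties using (≡-dec)

  ev : ∀ {N} → Vec ℤ N → Poly N → ℚ
  ev x []            = 0ℚ
  ev x ((α , v) ∷ p) = ι α * qp (dot v x) + ev x p

  module _ {N : ℕ} (x : Vec ℤ N) where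

    ev-⊕ : ∀ p r → ev x (p ⊕ r) ≡ ev x p + ev x r
    ev-⊕ []            r = sym (ℚ.+-identityˡ (ev x r))
    ev-⊕ ((α , v) ∷ p) r = trans (cong (λ z → ι α * qp (dot v x) + z) (ev-⊕ p r)) (sym (ℚ.+-assoc (ι α * qp (dot v x)) (ev x p) (ev x r)))

    ev-⊗ : ∀ p r → ev x (p ⊗ r) ≡ ev x p * ev x r
    ev-⊗ []            r = sym (ℚ.*-zeroˡ (ev x r))
    ev-⊗ ((α , v) ∷ p) r = trans (ev-⊕ (map (λ u → (α ℤ.* proj₁ u , v +v proj₂ u)) r) (p ⊗ r))
      (trans (cong₂ _+_ (row r) (ev-⊗ p r)) (sym (ℚ.*-distribʳ-+ (ev x r) (ι α * qp (dot v x)) (ev x p))))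
      where
      lem : ∀ a q b r e → a * b * (q * r) + a * q * e ≡ a * q * (b * r + e)
      lem = solve-∀ ℚring
      row : ∀ r → ev x (map (λ u → (α ℤ.* proj₁ u , v +v proj₂ u)) r) ≡ ι α * qp (dot v x) * ev x r
      row []            = sym (ℚ.*-zeroʳ (ι α * qp (dot v x)))
      row ((β , w) ∷ r) = trans (cong₂ _+_ (cong₂ _*_ (ι-* α β) (χᵥ-⊞ v w x)) (row r))
        (lem (ι α) (qp (dot v x)) (ι β) (qp (dot w x)) (ev x r))

    ev-neg : ∀ p → ev x (negP p) ≡ - ev x p
    ev-neg []            = refl
    ev-neg ((α , v) ∷ p) = trans (cong₂ (λ a b → a * qp (dot v x) + b) (ι-neg α) (ev-neg p)) (lem (ι α) (qp (dot v x)) (ev x p))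
      where
      lem : ∀ a q e → - a * q + - e ≡ - (a * q + e)
      lem = solve-∀ ℚring

    ev-mono : ∀ α v → ev x (mono α v) ≡ ι α * qp (dot v x)
    ev-mono α v = ℚ.+-identityʳ (ι α * qp (dot v x))

    ev-mono1 : ∀ v → ev x (mono 1ℤ v) ≡ qp (dot v x)
    ev-mono1 v = trans (ev-mono 1ℤ v) (ℚ.*-identityˡ (qp (dot v x)))

    ev-one : ev x oneP ≡ 1ℚ
    ev-one = trans (ev-mono1 zeroV) (trans (cong qp (dot-zeros x)) qp-0)

    ev-prodP : ∀ ps → ev x (prodP ps) ≡ ∏ (ev x) ps
    ev-prodP []       = ev-one
    ev-prodP (p ∷ ps) = trans (ev-⊗ p (prodP ps)) (cong (ev x p *_) (ev-prodP ps))

    -- The starting power `s` is general because the induction on `T` moves the list of powers up by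
    -- one.
    ev-powers : ∀ p s T → ev x (sumP (map (powP p) (applyUpTo (s ℕ.+_) (suc T)))) ≡ ev x (powP p s) * geo T (ev x p)
    ev-powers p s zero    = trans (ev-⊕ (powP p (s ℕ.+ 0)) []) (trans (ℚ.+-identityʳ (ev x (powP p (s ℕ.+ 0))))
      (trans (cong (λ z → ev x (powP p z)) (ℕ.+-identityʳ s)) (sym (ℚ.*-identityʳ (ev x (powP p s))))))
    ev-powers p s (suc T) = trans (ev-⊕ (powP p (s ℕ.+ 0)) rest) (trans (cong₂ _+_ (cong (λ z → ev x (powP p z)) (ℕ.+-identityʳ s))
        (trans (cong (λ z → ev x (sumP (map (powP p) z))) (shift (suc T) (λ i → i))) (trans (ev-powers p (suc s) T) (cong (_* geo T (ev x p)) (ev-⊗ p (powP p s))))))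
      (lem (ev x (powP p s)) (ev x p) (geo T (ev x p))))
      where
      rest : Poly N
      rest = sumP (map (powP p) (applyUpTo (λ i → s ℕ.+ suc i) (suc T)))
      lem : ∀ a e g → a + e * a * g ≡ a * (1ℚ + e * g)
      lem = solve-∀ ℚring
      shift : ∀ n (f : ℕ → ℕ) → applyUpTo (λ i → s ℕ.+ suc (f i)) n ≡ applyUpTo (λ i → suc s ℕ.+ f i) n
      shift zero    f = refl
      shift (suc n) f = cong₂ _∷_ (ℕ.+-suc s (f 0)) (shift n (f ∘ suc))

  module _ {N : ℕ} (zs : Vec ℤ N) where

    point : Vec ℤ (suc N)
    point = 1ℤ ∷ zs

    dot-unit-0 : ∀ d → dot (unit (suc N) 0 d) point ≡ d
    dot-unit-0 d = trans (cong₂ ℤ._+_ (ℤ.*-identityʳ d) (trans (cong (λ v → dot v zs) (tabulate-zeros N)) (dot-zeros zs))) (ℤ.+-identityʳ d)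

    ev-qmon : ∀ d v → ev point (qmon d v) ≡ qp (d ℤ.+ dot v point)
    ev-qmon d v = trans (ev-mono1 point (unit (suc N) 0 d +v v)) (cong qp (trans (dot-⊞ (unit (suc N) 0 d) v point) (cong (ℤ._+ dot v point) (dot-unit-0 d))))

    ev-poch : ∀ d v m → ev point (poch d v m) ≡ qpoch (d ℤ.+ dot v point) m
    ev-poch d v m = trans (ev-prodP point (map f (upTo m))) (trans (∏-map (ev point) f (upTo m)) (trans (∏-applyUpTo (ev point ∘ f) id m)
      (∏<-cong m (λ l _ → trans (ev-⊕ point oneP (negP (qmon (d ℤ.+ + l) v))) (cong₂ _+_ (ev-one point) (trans (ev-neg point (qmon (d ℤ.+ + l) v))
        (cong -_ (trans (ev-qmon (d ℤ.+ + l) v) (cong qp (lem d (+ l) (dot v point)))))))))))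
      where
      f : ℕ → Poly (suc N)
      f l = oneP ⊕ negP (qmon (d ℤ.+ + l) v)
      lem : ∀ d l w → d ℤ.+ l ℤ.+ w ≡ d ℤ.+ w ℤ.+ l
      lem = ℤR.solve-∀

    ev-geom : ∀ T d v → ev point (geom T d v) ≡ geo T (qp (d ℤ.+ dot v point))
    ev-geom T d v = trans (ev-powers point (qmon d v) 0 T) (trans (cong₂ (λ a b → a * geo T b) (ev-one point) (ev-qmon d v)) (ℚ.*-identityˡ (geo T (qp (d ℤ.+ dot v point)))))

    ev-pochInv : ∀ T d v m → ev point (pochInv T d v m) ≡ ∏< m (λ l → geo T (qp (d ℤ.+ + l ℤ.+ dot v point)))
    ev-pochInv T d v m = trans (ev-prodP point (map f (upTo m))) (trans (∏-map (ev point) f (upTo m)) (trans (∏-applyUpTo (ev point ∘ f) id m)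
      (∏<-cong m (λ l _ → ev-geom T (d ℤ.+ + l) v))))
      where
      f : ℕ → Poly (suc N)
      f l = geom T (d ℤ.+ + l) v

    ev-qPoch : ∀ m → ev point (qPoch m) ≡ qpoch 1ℤ m
    ev-qPoch m = trans (ev-poch 1ℤ zeroV m) (cong (λ z → qpoch (1ℤ ℤ.+ z) m) (dot-zeros point))

  -- The terms kept by `ctZ` are free of the z-variables, so the point `zs₀` at which they are
  -- evaluated may be arbitrary.
  ctZ-ct : ∀ {N} (p : Poly (suc N)) (zs₀ : Vec ℤ N) → HasCT N (λ zs → ev (1ℤ ∷ zs) p) (ev (1ℤ ∷ zs₀) (ctZ p))
  ctZ-ct []                zs₀ = ct-const 0ℚ
  ctZ-ct {N} ((α , m ∷ w) ∷ p) zs₀ with ≡-dec ℤ._≟_ w zeroV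
  ... | yes refl = ct-+ (ct-ext (λ zs → cong (λ z → ι α * qp (m ℤ.* 1ℤ ℤ.+ z)) (trans (dot-zeros zs) (sym (dot-zeros zs₀)))) (ct-const (ι α * qp (dot (m ∷ zeros) (1ℤ ∷ zs₀))))) (ctZ-ct p zs₀)
  ... | no w≢0 = subst (HasCT N (λ zs → ev (1ℤ ∷ zs) ((α , m ∷ w) ∷ p))) (ℚ.+-identityˡ (ev (1ℤ ∷ zs₀) (ctZ p))) (ct-+ vanishing (ctZ-ct p zs₀))
    where
    nonzero : δᵥ w ≡ 0ℚ
    nonzero with zeros? w
    ... | inj₁ w≡0 = ⊥-elim (w≢0 w≡0)
    ... | inj₂ z   = z
    vanishing : HasCT N (λ zs → ι α * qp (m ℤ.* 1ℤ ℤ.+ dot w zs)) 0ℚ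
    vanishing = ct-ext (λ zs → trans (cong (ι α *_) (qp-+ (m ℤ.* 1ℤ) (dot w zs))) (sym (ℚ.*-assoc (ι α) (qp (m ℤ.* 1ℤ)) (qp (dot w zs)))))
      (subst (HasCT N (λ zs → ι α * qp (m ℤ.* 1ℤ) * χᵥ w zs)) (*-zeroʳ-≡ {ι α * qp (m ℤ.* 1ℤ)} nonzero) (ct-scale (ι α * qp (m ℤ.* 1ℤ)) (ct-χᵥ w)))

-- Recovering coefficients from values.

module Coefficients where

  open ℚ₀ using (_+_; _*_; _-_; -_)
  open import Defs
  open import Data.Vec.Properties using (≡-dec)

  δᵥ-diff : ∀ {k} (v : Vec ℤ k) → δᵥ (v ⊞ neg v) ≡ 1ℚ
  δᵥ-diff []      = refl
  δᵥ-diff (m ∷ v) = trans (cong₂ (λ a b → δ a * b) (ℤ.+-inverseʳ m) (δᵥ-diff v)) (ℚ.*-identityʳ 1ℚ)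

  ⊞-neg-injective : ∀ {k} (v w : Vec ℤ k) → v ⊞ neg w ≡ zeros → v ≡ w
  ⊞-neg-injective []      []      _  = refl
  ⊞-neg-injective (m ∷ v) (n ∷ w) eq = cong₂ _∷_ (ℤ.i-j≡0⇒i≡j m n (cong Vec.head eq)) (⊞-neg-injective v w (cong Vec.tail eq))

  δᵥ-diff-≢ : ∀ {k} (v w : Vec ℤ k) → v ≢ w → δᵥ (v ⊞ neg w) ≡ 0ℚ
  δᵥ-diff-≢ v w v≢w with zeros? (v ⊞ neg w)
  ... | inj₁ eq = ⊥-elim (v≢w (⊞-neg-injective v w eq))
  ... | inj₂ z  = z

  coeffℚ : ∀ {N} → Poly N → Vec ℤ N → ℚ
  coeffℚ []            w = 0ℚ
  coeffℚ ((α , v) ∷ p) w = ι α * δᵥ (v ⊞ neg w) + coeffℚ p w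

  coeffℚ-ι : ∀ {N} (p : Poly N) w → coeffℚ p w ≡ ι (coeff p w)
  coeffℚ-ι []            w = refl
  coeffℚ-ι ((α , v) ∷ p) w with ≡-dec ℤ._≟_ v w
  ... | yes refl = trans (cong₂ (λ a b → ι α * a + b) (δᵥ-diff v) (coeffℚ-ι p v)) (trans (cong (_+ ι (coeff p v)) (ℚ.*-identityʳ (ι α))) (sym (ι-+ α (coeff p v))))
  ... | no v≢w   = trans (cong₂ _+_ (*-zeroʳ-≡ {ι α} (δᵥ-diff-≢ v w v≢w)) (coeffℚ-ι p w)) (ℚ.+-identityˡ (ι (coeff p w)))

  -- The coefficient of z^w, as a function of the exponent u in q = 2^u.
  slice : ∀ {N} → Poly (suc N) → Vec ℤ N → ℤ → ℚ
  slice []                w u = 0ℚ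
  slice ((α , m ∷ v) ∷ p) w u = ι α * δᵥ (v ⊞ neg w) * 2^ (m ℤ.* u) + slice p w u

  module _ (u : ℕ) where

    private
      C : Character
      C = powerOfTwo u

    open Character C
    open ConstantTerm₁ C
    open ConstantTerm C
    open Evaluation C

    -- The coefficient of `z^w` is the constant term after multiplication by `z^(-w)`; it is thus
    -- determined by the values at integer points.
    slice-ct : ∀ {N} (p : Poly (suc N)) w → HasCT N (λ zs → ev (1ℤ ∷ zs) p * qp (ℤ.- dot w zs)) (slice p w (+ suc u))
    slice-ct []                w = ct-ext (λ zs → ℚ.*-zeroˡ (qp (ℤ.- dot w zs))) (ct-const 0ℚ)
    slice-ct {N} ((α , m ∷ v) ∷ p) w = ct-ext expand (ct-+ (subst (HasCT N (λ zs → ι α * 2^ (m ℤ.* + suc u) * χᵥ (v ⊞ neg w) zs))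
        (lem′ (ι α) (2^ (m ℤ.* + suc u)) (δᵥ (v ⊞ neg w))) (ct-scale (ι α * 2^ (m ℤ.* + suc u)) (ct-χᵥ (v ⊞ neg w)))) (slice-ct p w))
      where
      lem : ∀ a q r e s → (a * (q * r) + e) * s ≡ a * q * (r * s) + e * s
      lem = solve-∀ ℚring
      lem′ : ∀ a b c → a * b * c ≡ a * c * b
      lem′ = solve-∀ ℚring
      lem₀ : ∀ u m → u ℤ.* (m ℤ.* 1ℤ) ≡ m ℤ.* u
      lem₀ = ℤR.solve-∀
      expand : ∀ zs → (ι α * qp (m ℤ.* 1ℤ ℤ.+ dot v zs) + ev (1ℤ ∷ zs) p) * qp (ℤ.- dot w zs) ≡
               ι α * 2^ (m ℤ.* + suc u) * χᵥ (v ⊞ neg w) zs + ev (1ℤ ∷ zs) p * qp (ℤ.- dot w zs)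
      expand zs = trans (cong (λ z → (ι α * z + ev (1ℤ ∷ zs) p) * qp (ℤ.- dot w zs)) (trans (qp-+ (m ℤ.* 1ℤ) (dot v zs)) (cong (λ z → 2^ z * qp (dot v zs)) (lem₀ (+ suc u) m))))
        (trans (lem (ι α) (2^ (m ℤ.* + suc u)) (qp (dot v zs)) (ev (1ℤ ∷ zs) p) (qp (ℤ.- dot w zs)))
          (cong (λ z → ι α * 2^ (m ℤ.* + suc u) * z + ev (1ℤ ∷ zs) p * qp (ℤ.- dot w zs))
            (trans (sym (qp-+ (dot v zs) (ℤ.- dot w zs))) (cong qp (sym (trans (dot-⊞ v (neg w) zs) (cong (λ z → dot v zs ℤ.+ z) (dot-neg w zs))))))))

    slice-agree : ∀ {N} (p r : Poly (suc N)) → (∀ zs → ev (1ℤ ∷ zs) p ≡ ev (1ℤ ∷ zs) r) → ∀ w → slice p w (+ suc u) ≡ slice r w (+ suc u)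
    slice-agree p r eq w = ct-unique (slice-ct p w) (ct-ext (λ zs → cong (_* qp (ℤ.- dot w zs)) (eq zs)) (slice-ct r w))

  -- From here on the variable is the exponent `u` of `q = 2^u`: the one-variable theory, with base
  -- 2, is applied to functions of `u`.
  open ConstantTerm₁ (powerOfTwo 0) using (χ₁; Laurent; laurent-vanish; HasCT₁; ct₁-unique; ct₁-ext; ct₁-const; ct₁-+; ct₁-scale; ct₁-χ)

  2^-χ₁ : ∀ m u → 2^ (m ℤ.* u) ≡ χ₁ m u
  2^-χ₁ m u = cong 2^_ (sym (ℤ.*-identityˡ (m ℤ.* u)))

  slice-laurent : ∀ {N} (p : Poly (suc N)) w → Laurent (slice p w)
  slice-laurent []                w = nil λ _ → refl
  slice-laurent ((α , m ∷ v) ∷ p) w = term (ι α * δᵥ (v ⊞ neg w)) m tt (slice-laurent p w)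
    λ u → cong (λ z → ι α * δᵥ (v ⊞ neg w) * z + slice p w u) (2^-χ₁ m u)

  slice-coefficient : ∀ {N} (p : Poly (suc N)) n w → HasCT₁ (λ u → slice p w u * 2^ (ℤ.- n ℤ.* u)) (coeffℚ p (n ∷ w))
  slice-coefficient []                n w = ct₁-ext (λ u → ℚ.*-zeroˡ (2^ (ℤ.- n ℤ.* u))) (ct₁-const 0ℚ)
  slice-coefficient ((α , m ∷ v) ∷ p) n w = ct₁-ext expand (ct₁-+ (subst (HasCT₁ (λ u → ι α * d * χ₁ (m ℤ.- n) u))
      (lem (ι α) d (δ (m ℤ.- n))) (ct₁-scale (ι α * d) (ct₁-χ (m ℤ.- n)))) (slice-coefficient p n w))
    where
    d : ℚ
    d = δᵥ (v ⊞ neg w)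
    lem : ∀ a b c → a * b * c ≡ a * (c * b)
    lem = solve-∀ ℚring
    lem′ : ∀ a b e c → (a * b + e) * c ≡ a * (b * c) + e * c
    lem′ = solve-∀ ℚring
    lem₀ : ∀ m n u → m ℤ.* u ℤ.+ ℤ.- n ℤ.* u ≡ (m ℤ.- n) ℤ.* u
    lem₀ = ℤR.solve-∀
    expand : ∀ u → (ι α * d * 2^ (m ℤ.* u) + slice p w u) * 2^ (ℤ.- n ℤ.* u) ≡ ι α * d * χ₁ (m ℤ.- n) u + slice p w u * 2^ (ℤ.- n ℤ.* u)
    expand u = trans (lem′ (ι α * d) (2^ (m ℤ.* u)) (slice p w u) (2^ (ℤ.- n ℤ.* u)))
      (cong (λ z → ι α * d * z + slice p w u * 2^ (ℤ.- n ℤ.* u)) (trans (sym (2^-+ (m ℤ.* u) (ℤ.- n ℤ.* u))) (trans (cong 2^_ (lem₀ m n u)) (2^-χ₁ (m ℤ.- n) u))))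

  -- Two extractions. For each fixed `q` the values at all `z` determine the slices; as Laurent
  -- polynomials in `2^u` the slices then agree for every integer `u`, and their coefficients are
  -- constant terms in `2^u`.
  ≈-from-values : ∀ {N} (p r : Poly (suc N)) →
    (∀ u zs → Evaluation.ev (powerOfTwo u) (1ℤ ∷ zs) p ≡ Evaluation.ev (powerOfTwo u) (1ℤ ∷ zs) r) → p ≈ r
  ≈-from-values p r eq (n ∷ w) = ι-injective (trans (sym (coeffℚ-ι p (n ∷ w))) (trans
      (ct₁-unique (slice-coefficient p n w) (ct₁-ext (λ u → cong (_* 2^ (ℤ.- n ℤ.* u)) (slices u)) (slice-coefficient r n w)))
      (coeffℚ-ι r (n ∷ w))))
    where
    slices : ∀ u → slice p w u ≡ slice r w u
    -- Agreement is known from `u = 1` onwards; `u = 0` would mean `q = 1`, for which no character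
    -- is available.
    slices u = a-b≡0⇒a≡b (laurent-vanish (span-- (slice-laurent p w) (slice-laurent r w)) 1ℤ
      (λ { (+ suc u) _ → a≡b⇒a-b≡0 (slice-agree u p r (eq u) w) ; (+ zero) (ℤ.+≤+ ()) }) u)

open Coefficients

-- The values of the left side as a chain of levels.

module LeftSide (C : Character) (c′ : ℕ) where

  open ℚ₀ using (_+_; _*_; _-_; -_)
  open Character C
  open Interpolation C using (∏ᵥ)
  open Kernel C c′ using (pair; pairs; Γ)
  open Families C c′ using (Γ-∏)
  open Levels c′
  open LevelShift C c′
  open Chain C c′
  open Evaluation C
  open import Defs
  open import Data.Nat.ListAction using (sum)
  open import Data.Bool using (if_then_else_)
  open import Relation.Nullary.Decidable using (dec-true; dec-false)

  ∏ᵥ-segment : ∀ f m (Y : ℕ → ℤ) → ∏ᵥ f (segment m Y) ≡ ∏< m (f ∘ Y)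
  ∏ᵥ-segment f zero    Y = refl
  ∏ᵥ-segment f (suc m) Y = cong (f (Y 0) *_) (∏ᵥ-segment f m (Y ∘ suc))

  -- `pairs` groups the pairs by their smaller index, the theorem by their larger one; the induction
  -- exchanges the two groupings.
  pairs-segment : ∀ m (Y : ℕ → ℤ) → pairs (segment m Y) ≡ ∏< m (λ j → ∏< j (λ i → pair (Y i) (Y j)))
  pairs-segment zero    Y = refl
  pairs-segment (suc m) Y = trans (cong₂ _*_ (∏ᵥ-segment (pair (Y 0)) m (Y ∘ suc)) (pairs-segment m (Y ∘ suc)))
    (trans (sym (∏<-* m (λ j → pair (Y 0) (Y (suc j))) (λ j → ∏< j (λ i → pair (Y (suc i)) (Y (suc j)))))) (sym (ℚ.*-identityˡ _)))

  ∏-segment : ∀ f m (Y : ℕ → ℤ) → ∏ f (Vec.toList (segment m Y)) ≡ ∏< m (f ∘ Y)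
  ∏-segment f zero    Y = refl
  ∏-segment f (suc m) Y = cong (f (Y 0) *_) (∏-segment f m (Y ∘ suc))

  ∏-ints1 : ∀ {A : Set} (f : ℕ → ℚ) m → ∏ f (ints1 m) ≡ ∏< m (f ∘ suc)
  ∏-ints1 f m = trans (∏-map f suc (upTo m)) (∏-applyUpTo (f ∘ suc) id m)

  sum-snoc : ∀ (f g : ℕ → ℕ) m → sum (map f (map suc (applyUpTo g (suc m)))) ≡ sum (map f (map suc (applyUpTo g m))) ℕ.+ f (suc (g m))
  sum-snoc f g zero    = ℕ.+-identityʳ (f (suc (g 0)))
  sum-snoc f g (suc m) = trans (cong (f (suc (g 0)) ℕ.+_) (sum-snoc f (g ∘ suc) m)) (sym (ℕ.+-assoc (f (suc (g 0))) _ (f (suc (g (suc m))))))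

  dot-unit-coordinate : ∀ N j e (x : Vec ℤ N) → dot (unit N j e) x ≡ e ℤ.* coordinate x j
  dot-unit-coordinate zero    j       e []      = sym (ℤ.*-zeroʳ e)
  dot-unit-coordinate (suc N) zero    e (y ∷ x) = trans (cong (λ v → e ℤ.* y ℤ.+ dot v x) (tabulate-zeros N)) (trans (cong (λ z → e ℤ.* y ℤ.+ z) (dot-zeros x)) (ℤ.+-identityʳ (e ℤ.* y)))
  dot-unit-coordinate (suc N) (suc j) e (y ∷ x) = trans (ℤ.+-identityˡ (dot (unit N j e) x)) (dot-unit-coordinate N j e x)

  module _ (n : ℕ) (k : ℕ → ℕ) (a : ℕ) (b : ℕ → ℕ) (T : ℕ) (zs : Vec ℤ (off k (suc n))) where

    private
      x : Vec ℤ (dim n k)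
      x = 1ℤ ∷ zs

      X : ℕ → ℤ
      X = coordinate zs

      Z : ℕ → ℕ → ℤ
      Z s = drop (off k s) X

    dot-zv : ∀ s i e → dot (zv n k s (suc i) e) x ≡ e ℤ.* Z s i
    dot-zv s i e = trans (dot-unit-coordinate (dim n k) (off k s ℕ.+ suc i) e x)
      (cong (λ j → e ℤ.* coordinate x j) (ℕ.+-suc (off k s) i))

    ev-products : ∀ (f : ℕ → Poly (dim n k)) m → ev x (prodP (map f (ints1 m))) ≡ ∏< m (λ i → ev x (f (suc i)))
    ev-products f m = trans (ev-prodP x (map f (ints1 m))) (trans (∏-map (ev x) f (ints1 m)) (∏-ints1 {ℕ} (ev x ∘ f) m))

    ev-double : ∀ (f : ℕ → ℕ → Poly (dim n k)) (l : ℕ → ℕ) m →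
      ev x (prodP (concatMap (λ j → map (f j) (ints1 (l j))) (ints1 m))) ≡ ∏< m (λ j → ∏< (l (suc j)) (λ i → ev x (f (suc j) (suc i))))
    ev-double f l m = trans (ev-prodP x (concatMap (λ j → map (f j) (ints1 (l j))) (ints1 m)))
      (trans (∏-concatMap (ev x) (λ j → map (f j) (ints1 (l j))) (ints1 m))
        (trans (∏-ints1 {ℕ} (λ j → ∏ (ev x) (map (f j) (ints1 (l j)))) m)
          (∏<-cong m (λ j _ → trans (∏-map (ev x) (f (suc j)) (ints1 (l (suc j)))) (∏-ints1 {ℕ} (ev x ∘ f (suc j)) (l (suc j)))))))

    ex≡ : ∀ s → ex b (suc c′) s ≡ excess (b s)
    ex≡ s = lem (+ b s) (+ c′)
      where
      lem : ∀ b c → b ℤ.+ 1ℤ ℤ.- (1ℤ ℤ.+ c) ≡ b ℤ.- c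
      lem = ℤR.solve-∀

    dot-zv₁ : ∀ s i → dot (zv n k s (suc i) 1ℤ) x ≡ Z s i
    dot-zv₁ s i = trans (dot-zv s i 1ℤ) (ℤ.*-identityˡ (Z s i))

    dot-zv₋₁ : ∀ s i → dot (zv n k s (suc i) ℤ.-1ℤ) x ≡ ℤ.- Z s i
    dot-zv₋₁ s i = trans (dot-zv s i ℤ.-1ℤ) (ℤ.-1*i≡-i (Z s i))

    dot-ratio : ∀ s i s′ i′ → dot (zv n k s (suc i) 1ℤ +v zv n k s′ (suc i′) ℤ.-1ℤ) x ≡ Z s i ℤ.- Z s′ i′
    dot-ratio s i s′ i′ = trans (dot-⊞ (zv n k s (suc i) 1ℤ) (zv n k s′ (suc i′) ℤ.-1ℤ) x) (cong₂ ℤ._+_ (dot-zv₁ s i) (dot-zv₋₁ s′ i′))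

    module _ (s : ℕ) where

      private
        e : ℤ
        e = ex b (suc c′) s
        z : ℕ → ℤ → Vec ℤ (dim n k)
        z = zv n k s

      ev-own : ev x (prodP (map (λ i → poch 0ℤ (z i ℤ.-1ℤ) (aa a s) ⊗ poch 1ℤ (z i 1ℤ) (b s)) (ints1 (k s)))) ≡
               ∏< (k s) (λ i → qpoch (ℤ.- Z s i) (aa a s) * qpoch (1ℤ ℤ.+ Z s i) (b s))
      ev-own = trans (ev-products _ (k s)) (∏<-cong (k s) (λ i _ → trans (ev-⊗ x (poch 0ℤ (z (suc i) ℤ.-1ℤ) (aa a s)) (poch 1ℤ (z (suc i) 1ℤ) (b s)))
        (cong₂ _*_ (trans (ev-poch zs 0ℤ (z (suc i) ℤ.-1ℤ) (aa a s)) (cong (λ w → qpoch w (aa a s)) (trans (ℤ.+-identityˡ (dot (z (suc i) ℤ.-1ℤ) x)) (dot-zv₋₁ s i))))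
                   (trans (ev-poch zs 1ℤ (z (suc i) 1ℤ) (b s)) (cong (λ w → qpoch (1ℤ ℤ.+ w) (b s)) (dot-zv₁ s i))))))

      ev-pairs : ev x (prodP (concatMap (λ j → map (λ i → poch 0ℤ (z i 1ℤ +v z j ℤ.-1ℤ) (suc c′) ⊗ poch 1ℤ (z j 1ℤ +v z i ℤ.-1ℤ) (suc c′)) (ints1 (j ℕ.∸ 1))) (ints1 (k s)))) ≡
                 ∏< (k s) (λ j → ∏< j (λ i → pair (Z s i) (Z s j)))
      ev-pairs = trans (ev-double (λ j i → poch 0ℤ (z i 1ℤ +v z j ℤ.-1ℤ) (suc c′) ⊗ poch 1ℤ (z j 1ℤ +v z i ℤ.-1ℤ) (suc c′)) (ℕ._∸ 1) (k s))
        (∏<-cong (k s) (λ j _ → ∏<-cong j (λ i _ →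
          trans (ev-⊗ x (poch 0ℤ (z (suc i) 1ℤ +v z (suc j) ℤ.-1ℤ) (suc c′)) (poch 1ℤ (z (suc j) 1ℤ +v z (suc i) ℤ.-1ℤ) (suc c′)))
          (cong₂ _*_ (trans (ev-poch zs 0ℤ (z (suc i) 1ℤ +v z (suc j) ℤ.-1ℤ) (suc c′)) (cong (λ w → qpoch w (suc c′)) (trans (ℤ.+-identityˡ (dot (z (suc i) 1ℤ +v z (suc j) ℤ.-1ℤ) x)) (dot-ratio s i s j))))
                     (trans (ev-poch zs 1ℤ (z (suc j) 1ℤ +v z (suc i) ℤ.-1ℤ) (suc c′)) (cong (λ w → qpoch (1ℤ ℤ.+ w) (suc c′)) (dot-ratio s j s i)))))))

      ev-monomials : ev x (prodP (map (λ i → mono 1ℤ (z i (ℤ.- e))) (ints1 (k s)))) ≡ ∏< (k s) (λ i → qp (ℤ.- (excess (b s) ℤ.* Z s i)))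
      ev-monomials = trans (ev-products (λ i → mono 1ℤ (z i (ℤ.- e))) (k s)) (∏<-cong (k s) (λ i _ → trans (ev-mono1 x (z (suc i) (ℤ.- e)))
        (cong qp (trans (dot-zv s i (ℤ.- e)) (trans (sym (ℤ.neg-distribˡ-* e (Z s i))) (cong (λ w → ℤ.- (w ℤ.* Z s i)) (ex≡ s)))))))

      ev-geometric : ev x (prodP (concatMap (λ j → map (λ i → pochInv T e (z i 1ℤ +v zv n k (suc s) j ℤ.-1ℤ) (suc c′)) (ints1 (k s))) (ints1 (kext n k (suc s))))) ≡
        ∏< (kext n k (suc s)) (λ j → ∏< (k s) (λ i → ∏< (suc c′) (λ l → geo T (qp (Z s i ℤ.+ excess (b s) ℤ.+ (ℤ.- Z (suc s) j ℤ.+ + l))))))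
      ev-geometric = trans (ev-double (λ j i → pochInv T e (z i 1ℤ +v zv n k (suc s) j ℤ.-1ℤ) (suc c′)) (λ _ → k s) (kext n k (suc s)))
        (∏<-cong (kext n k (suc s)) (λ j _ → ∏<-cong (k s) (λ i _ → trans (ev-pochInv zs T e (z (suc i) 1ℤ +v zv n k (suc s) (suc j) ℤ.-1ℤ) (suc c′))
          (∏<-cong (suc c′) (λ l _ → cong (λ w → geo T (qp w)) (trans (cong₂ (λ p r → p ℤ.+ + l ℤ.+ r) (ex≡ s) (dot-ratio s i (suc s) j)) (lem (excess (b s)) (+ l) (Z s i) (Z (suc s) j))))))))
        where
        lem : ∀ e l z w → e ℤ.+ l ℤ.+ (z ℤ.- w) ≡ z ℤ.+ e ℤ.+ (ℤ.- w ℤ.+ l)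
        lem = ℤR.solve-∀

      -- The next level is described only by the products over its variables. This suffices for the
      -- geometric factors and hides the case distinction in `kext`, which leaves an empty product
      -- after the last level.
      ev-factor : ∀ (y : List ℤ) → (∀ f → ∏ f y ≡ ∏< (kext n k (suc s)) (f ∘ Z (suc s))) →
                  ev x (factor n (suc c′) k a b T s) ≡ level T (aa a s) (b s) (segment (k s) (Z s)) y
      ev-factor y y-eq = trans (ev-⊗ x own (two′ ⊗ (three ⊗ four))) (trans (cong (ev x own *_) (trans (ev-⊗ x two′ (three ⊗ four)) (cong (ev x two′ *_) (ev-⊗ x three four))))
        (trans (cong₂ _*_ ev-own (cong₂ _*_ ev-pairs (cong₂ _*_ ev-monomials ev-geometric))) assemble))
        where
        own two′ three four : Poly (dim n k)
        own   = prodP (map (λ i → poch 0ℤ (z i ℤ.-1ℤ) (aa a s) ⊗ poch 1ℤ (z i 1ℤ) (b s)) (ints1 (k s)))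
        two′  = prodP (concatMap (λ j → map (λ i → poch 0ℤ (z i 1ℤ +v z j ℤ.-1ℤ) (suc c′) ⊗ poch 1ℤ (z j 1ℤ +v z i ℤ.-1ℤ) (suc c′)) (ints1 (j ℕ.∸ 1))) (ints1 (k s)))
        three = prodP (map (λ i → mono 1ℤ (z i (ℤ.- e))) (ints1 (k s)))
        four  = prodP (concatMap (λ j → map (λ i → pochInv T e (z i 1ℤ +v zv n k (suc s) j ℤ.-1ℤ) (suc c′)) (ints1 (k s))) (ints1 (kext n k (suc s))))
        f₁ f₂ : ℕ → ℚ
        f₁ i = qpoch (ℤ.- Z s i) (aa a s) * qpoch (1ℤ ℤ.+ Z s i) (b s)
        f₂ i = qp (ℤ.- (excess (b s) ℤ.* Z s i))
        P G : ℚ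
        P = ∏< (k s) (λ j → ∏< j (λ i → pair (Z s i) (Z s j)))
        g : ℕ → ℕ → ℚ
        g i j = ∏< (suc c′) (λ l → geo T (qp (Z s i ℤ.+ excess (b s) ℤ.+ (ℤ.- Z (suc s) j ℤ.+ + l))))
        G = ∏< (kext n k (suc s)) (λ j → ∏< (k s) (λ i → g i j))
        lem : ∀ a p m g → a * (p * (m * g)) ≡ a * m * p * g
        lem = solve-∀ ℚring
        geometric : ∏ᵥ (λ u → Γ T (map (ℤ.-_) y) (u ℤ.+ excess (b s))) (segment (k s) (Z s)) ≡ G
        geometric = trans (∏ᵥ-segment (λ u → Γ T (map (ℤ.-_) y) (u ℤ.+ excess (b s))) (k s) (Z s))
          (trans (∏<-cong (k s) (λ i _ → trans (Γ-∏ T (map (ℤ.-_) y) (Z s i ℤ.+ excess (b s)))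
              (trans (∏-map (λ η → ∏< (suc c′) (λ l → geo T (qp (Z s i ℤ.+ excess (b s) ℤ.+ (η ℤ.+ + l))))) (ℤ.-_) y)
                (y-eq (λ w → ∏< (suc c′) (λ l → geo T (qp (Z s i ℤ.+ excess (b s) ℤ.+ (ℤ.- w ℤ.+ + l)))))))))
            (∏<-swap (k s) (kext n k (suc s)) g))
        assemble : ∏< (k s) f₁ * (P * (∏< (k s) f₂ * G)) ≡ level T (aa a s) (b s) (segment (k s) (Z s)) y
        assemble = trans (lem (∏< (k s) f₁) P (∏< (k s) f₂) G)
          (cong₂ _*_ (cong₂ _*_ (trans (sym (∏<-* (k s) f₁ f₂)) (sym (∏ᵥ-segment (levelFactor (aa a s) (b s)) (k s) (Z s)))) (sym (pairs-segment (k s) (Z s)))) (sym geometric))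

    off-suc : ∀ s → off k (suc (suc s)) ≡ off k (suc s) ℕ.+ k (suc s)
    off-suc s = sum-snoc k id s

    leading-next : ∀ s m → suc s ℕ.+ m ≡ n → ∀ Y f → ∏ f (leading (levels k b (suc (suc s)) m) Y) ≡ ∏< (kext n k (suc (suc s))) (f ∘ Y)
    leading-next s zero    eq Y f = cong (λ t → ∏< (if t then k (suc (suc s)) else 0) (f ∘ Y))
      (sym (dec-false (suc (suc s) ℕ.≤? n) (λ le → ℕ.<⇒≢ le (trans (sym (ℕ.+-identityʳ (suc s))) eq))))
    leading-next s (suc m) eq Y f = trans (∏-segment f (k (suc (suc s))) Y) (cong (λ t → ∏< (if t then k (suc (suc s)) else 0) (f ∘ Y))
      (sym (dec-true (suc (suc s) ℕ.≤? n) (ℕ.≤-trans (ℕ.m≤m+n (suc (suc s)) m) (ℕ.≤-reflexive (trans (sym (ℕ.+-suc (suc s) m)) eq))))))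

    ev-factors : ∀ m s → s ℕ.+ m ≡ n →
      ∏< m (λ i → ev x (factor n (suc c′) k a b T (suc (s ℕ.+ i)))) ≡ chain T (aa a (suc s)) (levels k b (suc s) m) (Z (suc s))
    ev-factors zero    s eq = refl
    ev-factors (suc m) s eq = cong₂ _*_
      (trans (cong (λ i → ev x (factor n (suc c′) k a b T (suc i))) (ℕ.+-identityʳ s))
        (ev-factor (suc s) (leading (levels k b (suc (suc s)) m) (drop (k (suc s)) (Z (suc s))))
          (λ f → trans (leading-next s m eq′ (drop (k (suc s)) (Z (suc s))) f) (∏<-cong (kext n k (suc (suc s))) (λ i _ → cong f (next i))))))
      (trans (∏<-cong m (λ i _ → cong (λ j → ev x (factor n (suc c′) k a b T (suc j))) (ℕ.+-suc s i)))
        (trans (ev-factors m (suc s) eq′) (chain-cong T 0 (levels k b (suc (suc s)) m) (λ i → sym (next i)))))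
      where
      eq′ : suc s ℕ.+ m ≡ n
      eq′ = trans (sym (ℕ.+-suc s m)) eq
      next : ∀ i → drop (k (suc s)) (Z (suc s)) i ≡ Z (suc (suc s)) i
      next i = cong X (trans (sym (ℕ.+-assoc (off k (suc s)) (k (suc s)) i)) (cong (ℕ._+ i) (sym (off-suc s))))

    ev-lhs : ev x (lhs n (suc c′) k a b T) ≡ chain T a (levels k b 1 n) X
    ev-lhs = trans (ev-products (factor n (suc c′) k a b T) n) (ev-factors n 0 refl)

  size-levels : ∀ k b m s (g : ℕ → ℕ) → (∀ i → g i ≡ s ℕ.+ i) → size (levels k b (suc s) m) ≡ sum (map k (map suc (applyUpTo g m)))
  size-levels k b zero    s g eq = refl
  size-levels k b (suc m) s g eq = cong₂ ℕ._+_ (cong (k ∘ suc) (sym (trans (eq 0) (ℕ.+-identityʳ s))))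
    (size-levels k b m (suc s) (g ∘ suc) (λ i → trans (eq (suc i)) (ℕ.+-suc s i)))

-- The values of the right side, and the bookkeeping of the parameters.

module RightSide (C : Character) (c′ : ℕ) where

  open ℚ₀ using (_+_; _*_; _-_; -_)
  open Character C
  open Kernel C c′ using (c)
  open Morris C c′ using (morris-num; morris-den)
  open Levels c′ hiding (c)
  open LevelShift C c′
  open Chain C c′
  open Evaluation C
  open LeftSide C c′ using (∏-ints1; sum-snoc)
  open import Defs
  open import Data.Nat.ListAction using (sum)
  open import Data.Nat.DivMod using (_/_; m*n/n≡m)
  import Data.List as List
  open import Data.Nat.Tactic.RingSolver renaming (solve-∀ to ℕ-solve-∀)
  open import Data.Vec.Properties using (length-toList)

  double-tri : ∀ m → tri (suc m) ℕ.* 2 ≡ suc m ℕ.* m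
  double-tri zero    = refl
  double-tri (suc m) = trans (ℕ.*-distribʳ-+ 2 (suc m) (tri (suc m))) (trans (cong (suc m ℕ.* 2 ℕ.+_) (double-tri m)) (lem m))
    where
    lem : ∀ m → suc m ℕ.* 2 ℕ.+ suc m ℕ.* m ≡ suc (suc m) ℕ.* suc m
    lem = ℕ-solve-∀

  double-triℤ : ∀ e → (e ℤ.+ 1ℤ) ℤ.* (e ℤ.+ 1ℤ ℤ.- 1ℤ) ≡ + (triℤ e ℕ.* 2)
  double-triℤ (+ m)    = trans (lem (+ m)) (trans (sym (ℤ.pos-* (suc m) m)) (cong +_ (sym (double-tri m))))
    where
    lem : ∀ m → (m ℤ.+ 1ℤ) ℤ.* (m ℤ.+ 1ℤ ℤ.- 1ℤ) ≡ (1ℤ ℤ.+ m) ℤ.* m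
    lem = ℤR.solve-∀
  double-triℤ -[1+ m ] = trans (lem (+ m)) (trans (sym (ℤ.pos-* (suc m) m)) (cong +_ (sym (double-tri m))))
    where
    lem : ∀ m → (ℤ.- (1ℤ ℤ.+ m) ℤ.+ 1ℤ) ℤ.* (ℤ.- (1ℤ ℤ.+ m) ℤ.+ 1ℤ ℤ.- 1ℤ) ≡ (1ℤ ℤ.+ m) ℤ.* m
    lem = ℤR.solve-∀

  binom2≡ : ∀ b → binom2 (+ b ℤ.+ + 2 ℤ.- + suc c′) ≡ triℤ (excess b)
  binom2≡ b = trans (cong binom2 (lem (+ b) (+ c′))) (trans (cong (λ z → ℤ.∣ z ∣ / 2) (double-triℤ (excess b))) (m*n/n≡m (triℤ (excess b)) 2))
    where
    lem : ∀ b c → b ℤ.+ + 2 ℤ.- (1ℤ ℤ.+ c) ≡ (b ℤ.- c) ℤ.+ 1ℤ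
    lem = ℤR.solve-∀

  sign-sum : ∀ (f : ℕ → ℤ) ss → sign (List.foldr ℤ._+_ 0ℤ (map f ss)) ≡ ∏ (sign ∘ f) ss
  sign-sum f []       = refl
  sign-sum f (s ∷ ss) = trans (sign-+ (f s) (List.foldr ℤ._+_ 0ℤ (map f ss))) (cong (sign (f s) *_) (sign-sum f ss))

  qp-sum : ∀ (f : ℕ → ℕ) ss → qp (+ sum (map f ss)) ≡ ∏ (λ s → qp (+ f s)) ss
  qp-sum f []       = qp-0
  qp-sum f (s ∷ ss) = trans (qp-+ (+ f s) (+ sum (map f ss))) (cong (qp (+ f s) *_) (qp-sum f ss))

  pow-mul : ∀ a b n → pow (a * b) n ≡ pow a n * pow b n
  pow-mul a b zero    = refl
  pow-mul a b (suc n) = trans (cong (a * b *_) (pow-mul a b n)) (interchange a b (pow a n) (pow b n))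

  module _ (n : ℕ) (k : ℕ → ℕ) (a : ℕ) (b : ℕ → ℕ)
           (large : ∀ s → 1 ℕ.≤ s → s ℕ.≤ n → s ℕ.* c ℕ.≤ a ℕ.+ σ b s ℕ.+ s) where

    -- The parameter a + σ_s + s(1 - c) of the theorem.
    parameter : ℕ → ℕ
    parameter s = a ℕ.+ σ b s ℕ.+ s ℕ.∸ s ℕ.* c

    large₀ : ∀ s → s ℕ.≤ n → s ℕ.* c ℕ.≤ a ℕ.+ σ b s ℕ.+ s
    large₀ zero    _  = ℕ.z≤n
    large₀ (suc s) le = large (suc s) (ℕ.s≤s ℕ.z≤n) le

    σ-suc : ∀ s → a ℕ.+ σ b (suc s) ℕ.+ suc s ≡ suc (a ℕ.+ σ b s ℕ.+ s ℕ.+ b (suc s))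
    σ-suc s = trans (cong (λ z → a ℕ.+ z ℕ.+ suc s) (sum-snoc b id s)) (lem a (σ b s) (b (suc s)) s)
      where
      lem : ∀ a g b s → a ℕ.+ (g ℕ.+ b) ℕ.+ suc s ≡ suc (a ℕ.+ g ℕ.+ s ℕ.+ b)
      lem = ℕ-solve-∀

    large-suc : ∀ s → suc s ℕ.≤ n → c′ ℕ.+ s ℕ.* c ℕ.≤ a ℕ.+ σ b s ℕ.+ s ℕ.+ b (suc s)
    large-suc s le = ℕ.≤-pred (subst (suc (c′ ℕ.+ s ℕ.* c) ℕ.≤_) (σ-suc s) (large₀ (suc s) le))

    -- The hypothesis at `s` makes the truncated subtraction exact, so that it commutes with the
    -- addition.
    parameter-+ : ∀ s → suc s ℕ.≤ n → parameter s ℕ.+ b (suc s) ≡ a ℕ.+ σ b s ℕ.+ s ℕ.+ b (suc s) ℕ.∸ s ℕ.* c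
    parameter-+ s le = sym (ℕ.+-∸-comm (b (suc s)) (large₀ s (ℕ.<⇒≤ le)))

    -- This is the hypothesis of the theorem at `s + 1`: the parameter that the elimination of level
    -- `s + 1` produces is not negative.
    parameter-admissible : ∀ s → suc s ℕ.≤ n → c′ ℕ.≤ parameter s ℕ.+ b (suc s)
    parameter-admissible s le = subst (c′ ℕ.≤_) (sym (parameter-+ s le)) (ℕ.m+n≤o⇒m≤o∸n c′ (large-suc s le))

    parameter-suc : ∀ s → suc s ℕ.≤ n → parameter s ℕ.+ b (suc s) ℕ.∸ c′ ≡ parameter (suc s)
    parameter-suc s le = trans (cong (ℕ._∸ c′) (parameter-+ s le)) (trans (ℕ.∸-+-assoc (a ℕ.+ σ b s ℕ.+ s ℕ.+ b (suc s)) (s ℕ.* c) c′)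
      (trans (cong (a ℕ.+ σ b s ℕ.+ s ℕ.+ b (suc s) ℕ.∸_) (ℕ.+-comm (s ℕ.* c) c′)) (cong (ℕ._∸ (suc s ℕ.* c)) (sym (σ-suc s)))))

    parameter-0 : parameter 0 ≡ a
    parameter-0 = trans (ℕ.+-identityʳ (a ℕ.+ 0)) (ℕ.+-identityʳ a)

    in-range : ∀ {s m} → s ℕ.+ suc m ≡ n → suc s ℕ.≤ n
    in-range {s} {m} eq = ℕ.≤-trans (ℕ.m≤m+n (suc s) m) (ℕ.≤-reflexive (trans (sym (ℕ.+-suc s m)) eq))

    levels-admissible : (∀ s → 1 ℕ.≤ s → s ℕ.< n → k (suc s) ℕ.≤ k s) → ∀ m s → s ℕ.+ m ≡ n → Admissible (parameter s) (levels k b (suc s) m)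
    levels-admissible mono zero    s eq = tt
    levels-admissible mono (suc m) s eq = parameter-admissible s (in-range eq) , next m eq ,
        subst (λ A → Admissible A (levels k b (suc (suc s)) m)) (sym (parameter-suc s (in-range eq)))
          (levels-admissible mono m (suc s) (trans (sym (ℕ.+-suc s m)) eq))
      where
      next : ∀ m → s ℕ.+ suc m ≡ n → ∀ X → length (leading (levels k b (suc (suc s)) m) X) ℕ.≤ k (suc s)
      next zero    eq X = ℕ.z≤n
      next (suc m) eq X = ℕ.≤-trans (ℕ.≤-reflexive (length-toList (segment (k (suc (suc s))) X)))
        (mono (suc s) (ℕ.s≤s ℕ.z≤n) (in-range {suc s} {m} (trans (sym (ℕ.+-suc s (suc m))) eq)))

    chain-num-levels : ∀ m s → s ℕ.+ m ≡ n → chain-num (parameter s) (levels k b (suc s) m) ≡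
      ∏< m (λ i → pow (constant (b (suc (s ℕ.+ i)))) (k (suc (s ℕ.+ i)))) * ∏< m (λ i → morris-num (k (suc (s ℕ.+ i))) (parameter (suc (s ℕ.+ i))))
    chain-num-levels zero    s eq = refl
    chain-num-levels (suc m) s eq = trans (cong (λ A → pow (constant (b (suc s))) (k (suc s)) * morris-num (k (suc s)) A * chain-num A (levels k b (suc (suc s)) m)) (parameter-suc s (in-range eq)))
      (trans (cong (pow (constant (b (suc s))) (k (suc s)) * morris-num (k (suc s)) (parameter (suc s)) *_) (trans (chain-num-levels m (suc s) (trans (sym (ℕ.+-suc s m)) eq))
          (cong₂ _*_ (∏<-cong m (λ i _ → cong f (sym (ℕ.+-suc s i)))) (∏<-cong m (λ i _ → cong g (sym (ℕ.+-suc s i)))))))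
        (trans (interchange (f s) (g s) (∏< m (λ i → f (s ℕ.+ suc i))) (∏< m (λ i → g (s ℕ.+ suc i))))
          (cong (λ t → f t * ∏< m (λ i → f (s ℕ.+ suc i)) * (g t * ∏< m (λ i → g (s ℕ.+ suc i)))) (sym (ℕ.+-identityʳ s)))))
      where
      f g : ℕ → ℚ
      f t = pow (constant (b (suc t))) (k (suc t))
      g t = morris-num (k (suc t)) (parameter (suc t))

    chain-den-levels : ∀ m s → s ℕ.+ m ≡ n → chain-den (parameter s) (levels k b (suc s) m) ≡
      ∏< m (λ i → morris-den (k (suc (s ℕ.+ i))) (parameter (suc (s ℕ.+ i))))
    chain-den-levels zero    s eq = refl
    chain-den-levels (suc m) s eq = trans (cong (λ A → morris-den (k (suc s)) A * chain-den A (levels k b (suc (suc s)) m)) (parameter-suc s (in-range eq)))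
      (cong₂ _*_ (cong g (sym (ℕ.+-identityʳ s))) (trans (chain-den-levels m (suc s) (trans (sym (ℕ.+-suc s m)) eq)) (∏<-cong m (λ i _ → cong g (sym (ℕ.+-suc s i))))))
      where
      g : ℕ → ℚ
      g t = morris-den (k (suc t)) (parameter (suc t))

    module _ (zs : Vec ℤ (off k (suc n))) where

      private
        x : Vec ℤ (dim n k)
        x = 1ℤ ∷ zs

      ev-prodF₁ : ∀ (fs : List (Frac (dim n k))) → ev x (proj₁ (prodF fs)) ≡ ∏ (ev x ∘ proj₁) fs
      ev-prodF₁ []       = ev-one x
      ev-prodF₁ (f ∷ fs) = trans (ev-⊗ x (proj₁ f) (proj₁ (prodF fs))) (cong (ev x (proj₁ f) *_) (ev-prodF₁ fs))

      ev-prodF₂ : ∀ (fs : List (Frac (dim n k))) → ev x (proj₂ (prodF fs)) ≡ ∏ (ev x ∘ proj₂) fs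
      ev-prodF₂ []       = ev-one x
      ev-prodF₂ (f ∷ fs) = trans (ev-⊗ x (proj₂ f) (proj₂ (prodF fs))) (cong (ev x (proj₂ f) *_) (ev-prodF₂ fs))

      ev-MF₁ : ∀ K A → ev x (proj₁ (MF {dim n k} K A c′ c)) ≡ morris-num K A
      ev-MF₁ K A = trans (ev-prodF₁ (map f (upTo K))) (trans (∏-map (ev x ∘ proj₁) f (upTo K)) (trans (∏-applyUpTo (ev x ∘ proj₁ ∘ f) id K)
        (∏<-cong K (λ i _ → trans (ev-⊗ x (qPoch (A ℕ.+ c′ ℕ.+ i ℕ.* c)) (qPoch (suc i ℕ.* c))) (cong₂ _*_ (ev-qPoch zs (A ℕ.+ c′ ℕ.+ i ℕ.* c)) (ev-qPoch zs (suc i ℕ.* c)))))))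
        where
        f : ℕ → Frac (dim n k)
        f i = (qPoch (A ℕ.+ c′ ℕ.+ i ℕ.* c) ⊗ qPoch (suc i ℕ.* c)) , (qPoch (A ℕ.+ i ℕ.* c) ⊗ (qPoch (c′ ℕ.+ i ℕ.* c) ⊗ qPoch c))

      ev-MF₂ : ∀ K A → ev x (proj₂ (MF {dim n k} K A c′ c)) ≡ morris-den K A
      ev-MF₂ K A = trans (ev-prodF₂ (map f (upTo K))) (trans (∏-map (ev x ∘ proj₂) f (upTo K)) (trans (∏-applyUpTo (ev x ∘ proj₂ ∘ f) id K)
        (∏<-cong K (λ i _ → trans (ev-⊗ x (qPoch (A ℕ.+ i ℕ.* c)) (qPoch (c′ ℕ.+ i ℕ.* c) ⊗ qPoch c))
          (cong₂ _*_ (ev-qPoch zs (A ℕ.+ i ℕ.* c)) (trans (ev-⊗ x (qPoch (c′ ℕ.+ i ℕ.* c)) (qPoch c)) (cong₂ _*_ (ev-qPoch zs (c′ ℕ.+ i ℕ.* c)) (ev-qPoch zs c))))))))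
        where
        f : ℕ → Frac (dim n k)
        f i = (qPoch (A ℕ.+ c′ ℕ.+ i ℕ.* c) ⊗ qPoch (suc i ℕ.* c)) , (qPoch (A ℕ.+ i ℕ.* c) ⊗ (qPoch (c′ ℕ.+ i ℕ.* c) ⊗ qPoch c))

      private
        E : ℤ
        E = List.foldr ℤ._+_ 0ℤ (map (λ s → + k s ℤ.* ex b c s) (ints1 n))
        Q : ℕ
        Q = sum (map (λ s → k s ℕ.* binom2 (+ b s ℤ.+ + 2 ℤ.- + c)) (ints1 n))
        F : ℕ → Frac (dim n k)
        F s = MF (k s) (parameter s) c′ c

      ev-constant : ev x (mono (ℤ.-1ℤ ℤ.^ ℤ.∣ E ∣) (unit (dim n k) 0 (+ Q))) ≡ ∏< n (λ i → pow (constant (b (suc i))) (k (suc i)))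
      ev-constant = trans (ev-mono x (ℤ.-1ℤ ℤ.^ ℤ.∣ E ∣) (unit (dim n k) 0 (+ Q)))
        (trans (cong₂ _*_ (trans (ι-sign ℤ.∣ E ∣) (trans (sign-sum (λ s → + k s ℤ.* ex b c s) (ints1 n)) (∏-ints1 {ℕ} (λ s → sign (+ k s ℤ.* ex b c s)) n)))
            (trans (cong qp (dot-unit-0 zs (+ Q))) (trans (qp-sum (λ s → k s ℕ.* binom2 (+ b s ℤ.+ + 2 ℤ.- + c)) (ints1 n)) (∏-ints1 {ℕ} (λ s → qp (+ (k s ℕ.* binom2 (+ b s ℤ.+ + 2 ℤ.- + c)))) n))))
          (trans (sym (∏<-* n (λ i → sign (+ k (suc i) ℤ.* ex b c (suc i))) (λ i → qp (+ (k (suc i) ℕ.* binom2 (+ b (suc i) ℤ.+ + 2 ℤ.- + c))))))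
            (∏<-cong n (λ i _ → term≡ (suc i)))))
        where
        lem : ∀ b c → b ℤ.+ 1ℤ ℤ.- (1ℤ ℤ.+ c) ≡ b ℤ.- c
        lem = ℤR.solve-∀
        term≡ : ∀ s → sign (+ k s ℤ.* ex b c s) * qp (+ (k s ℕ.* binom2 (+ b s ℤ.+ + 2 ℤ.- + c))) ≡ pow (constant (b s)) (k s)
        term≡ s = trans (cong₂ _*_ (trans (sign-* (k s) (ex b c s)) (cong (λ e → pow (sign e) (k s)) (lem (+ b s) (+ c′))))
            (trans (cong (λ t → qp (+ (k s ℕ.* t))) (binom2≡ (b s))) (trans (cong qp (ℤ.pos-* (k s) (triℤ (excess (b s))))) (sym (pow-qp (+ triℤ (excess (b s))) (k s))))))
          (sym (pow-mul (sign (excess (b s))) (qp (+ triℤ (excess (b s)))) (k s)))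

      ev-rhs₁ : ev x (proj₁ (rhs n c k a b)) ≡ chain-num a (levels k b 1 n)
      ev-rhs₁ = trans (ev-⊗ x (mono (ℤ.-1ℤ ℤ.^ ℤ.∣ E ∣) (unit (dim n k) 0 (+ Q))) (proj₁ (prodF (map F (ints1 n)))))
        (trans (cong₂ _*_ ev-constant (trans (ev-prodF₁ (map F (ints1 n))) (trans (∏-map (ev x ∘ proj₁) F (ints1 n)) (trans (∏-ints1 {ℕ} (ev x ∘ proj₁ ∘ F) n)
            (∏<-cong n (λ i _ → ev-MF₁ (k (suc i)) (parameter (suc i))))))))
          (trans (sym (chain-num-levels n 0 refl)) (cong (λ A → chain-num A (levels k b 1 n)) parameter-0)))

      ev-rhs₂ : ev x (proj₂ (rhs n c k a b)) ≡ chain-den a (levels k b 1 n)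
      ev-rhs₂ = trans (ev-⊗ x oneP (proj₂ (prodF (map F (ints1 n))))) (trans (cong₂ _*_ (ev-one x) (trans (ev-prodF₂ (map F (ints1 n)))
          (trans (∏-map (ev x ∘ proj₂) F (ints1 n)) (trans (∏-ints1 {ℕ} (ev x ∘ proj₂ ∘ F) n) (∏<-cong n (λ i _ → ev-MF₂ (k (suc i)) (parameter (suc i))))))))
        (trans (ℚ.*-identityˡ _) (trans (sym (chain-den-levels n 0 refl)) (cong (λ A → chain-den A (levels k b 1 n)) parameter-0))))

-- Comparison of both sides and the final identity.

module Identity where

  open ℚ₀ using (_+_; _*_)
  open import Defs

  module _ (n c′ : ℕ) (k : ℕ → ℕ) (a : ℕ) (b : ℕ → ℕ) (T : ℕ)
           (decreasing : ∀ s → 1 ℕ.≤ s → s ℕ.< n → k (suc s) ℕ.≤ k s)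
           (large : ∀ s → 1 ℕ.≤ s → s ℕ.≤ n → s ℕ.* suc c′ ℕ.≤ a ℕ.+ σ b s ℕ.+ s)
           (T≥ : Levels.bound c′ a (Levels.levels c′ k b 1 n) ℕ.≤ T) where

    open Levels c′ using (Level; levels; coordinate; Admissible)

    module _ (u : ℕ) (zs : Vec ℤ (off k (suc n))) where

      private
        C : Character
        C = powerOfTwo u

      open ConstantTerm C
      open Evaluation C
      open Chain C c′
      open LeftSide C c′ using (ev-lhs; size-levels)
      open RightSide C c′ using (ev-rhs₁; ev-rhs₂; levels-admissible; parameter-0)

      private
        ls : List Level
        ls = levels k b 1 n
        x : Vec ℤ (dim n k)
        x = 1ℤ ∷ zs
        L : Poly (dim n k)
        L = lhs n (suc c′) k a b T
        R : Frac (dim n k)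
        R = rhs n (suc c′) k a b
        module K = ChainCT (chain-ct T a ls
          (subst (λ A → Admissible A ls) (parameter-0 n k a b large) (levels-admissible n k a b large decreasing n 0 refl)) T≥)

      constant-term : ev x (ctZ L) ≡ K.value
      constant-term = ct-unique (ctZ-ct L zs) (ct-ext (λ zs → ev-lhs n k a b T zs)
        (subst (λ N → HasCT N (λ v → chain T a ls (coordinate v)) K.value) (size-levels k b n 0 id (λ _ → refl)) K.value-ct))

      values-agree : ev x (ctZ L ⊗ proj₂ R) ≡ ev x (proj₁ R ⊗ oneP)
      values-agree = trans (ev-⊗ x (ctZ L) (proj₂ R)) (trans (cong₂ _*_ constant-term (ev-rhs₂ n k a b large zs)) (trans K.equation
        (trans (sym (ev-rhs₁ n k a b large zs)) (sym (trans (ev-⊗ x (proj₁ R) oneP) (trans (cong (ev x (proj₁ R) *_) (ev-one x)) (ℚ.*-identityʳ (ev x (proj₁ R)))))))))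

    identity : poly (ctZ (lhs n (suc c′) k a b T)) ≈F rhs n (suc c′) k a b
    identity = ≈-from-values (ctZ (lhs n (suc c′) k a b T) ⊗ proj₂ (rhs n (suc c′) k a b)) (proj₁ (rhs n (suc c′) k a b) ⊗ oneP) values-agree
open import Defs
open import Data.Nat using (ℕ; suc; _+_; _*_; _≤_; _<_)
open import Data.Product using (∃-syntax)

theorem1p2 : (n c : ℕ) → 1 ≤ n → 1 ≤ c →
    (k : ℕ → ℕ) → (∀ s → 1 ≤ s → s < n → k (suc s) ≤ k s) →
    (a : ℕ) (b : ℕ → ℕ) →
    (∀ s → 1 ≤ s → s ≤ n → s * c ≤ a + σ b s + s) →
    ∃[ T₀ ] (∀ T → T₀ ≤ T → poly (ctZ (lhs n c k a b T)) ≈F rhs n c k a b)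
theorem1p2 n (suc c′) _ _ k decreasing a b large =
  -- From this order on, the terms cut off from the geometric series have exponents too large to
  -- reach the constant term on any level.
  Levels.bound c′ a (Levels.levels c′ k b 1 n) ,
  λ T T≥ → Identity.identity n c′ k a b T decreasing large T≥
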